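{- Let $U\in\mathbb U$ with $d(U)=L$. Then: (1) $[U]_{\beta\eta}=\{M\in\mathcal M^L : M \text{ is closed, and } M\rhd^*_{\beta\eta}N \text{ for some } N \text{ with } N:\langle()\vdash U\rangle\}$. (2) $[U]_{\beta}=[U]_{h}=\{M\in\mathcal M^L : M:\langle()\vdash U\rangle\}$. (3) $[U]_{\beta\eta}$ is stable under reduction: if $M\in[U]_{\beta\eta}$ and $M\rhd^*_{\beta\eta}N$ then $N\in[U]_{\beta\eta}$.
   Context: Indexes: an index is a finite sequence of natural numbers; $\mathcal L_{\mathbb N}$ is the set of indexes, $\oslash$ the empty sequence, $i::L$ the sequence obtained by prepending $i\in\mathbb N$ to $L$, $L::K$ concatenation; $L_1\preceq L_2$ (also written $L_2\succeq L_1$) iff $L_2=L_1::L_3$ for some index $L_3$. Terms: let $\mathcal V$ be a countably infinite set of variables. The set $\mathcal M$ of terms, the set $\mathrm{fv}(M)$ of free indexed variables, the degree $d(M)\in\mathcal L_{\mathbb N}$ and joinability $M\diamond N$ are defined simultaneously: for $x\in\mathcal V$ and index $L$, $x^L\in\mathcal M$, $\mathrm{fv}(x^L)=\{x^L\}$, $d(x^L)=L$; if $M,N\in\mathcal M$, $d(M)\preceq d(N)$ and $M\diamond N$, then $MN\in\mathcal M$, $\mathrm{fv}(MN)=\mathrm{fv}(M)\cup\mathrm{fv}(N)$, $d(MN)=d(M)$; if $M\in\mathcal M$ and $L\succeq d(M)$ then $\lambda x^L.M\in\mathcal M$, $\mathrm{fv}(\lambda x^L.M)=\mathrm{fv}(M)\setminus\{x^L\}$,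 $d(\lambda x^L.M)=d(M)$. $M\diamond N$ means: whenever $x^L\in\mathrm{fv}(M)$ and $x^K\in\mathrm{fv}(N)$ then $L=K$. Terms are taken modulo $\alpha$-conversion ($\lambda x^L.M=\lambda y^L.M[x^L:=y^L]$ with $y$ fresh). Capture-avoiding (simultaneous) substitution $M[(x_i^{L_i}:=N_i)_n]$ is only defined when $M,N_1,\dots,N_n$ are pairwise joinable and $d(N_i)=L_i$. $M$ is closed iff $\mathrm{fv}(M)=\emptyset$. $\rhd_\beta$ is the least relation on $\mathcal M$ compatible with abstraction and application (when results are terms) containing $(\lambda x^L.M)N\rhd_\beta M[x^L:=N]$ for $d(N)=L$; $\rhd_\eta$ likewise from $\lambda x^L.(Mx^L)\rhd_\eta M$ when $x^L\notin\mathrm{fv}(M)$; $\rhd_{\beta\eta}=\rhd_\beta\cup\rhd_\eta$; $(\lambda x^L.M)NN_1\dots N_n\rhd_h M[x^L:=N]N_1\dots N_n$ ($n\ge 0$); $\rhd_r^*$ is the reflexive–transitive closure. Lifting: $(x^L)^{+i}=x^{i::L}$, $(M_1M_2)^{+i}=M_1^{+i}M_2^{+i}$, $(\lambda x^L.M)^{+i}=\lambda x^{i::L}.M^{+i}$. Types: $\mathcal A$ is a countably infinite set of atomic types, $\overline e_0,\overline e_1,\dots$ expansion variables. Sets $\mathbb T\subseteq\mathbb U$ and degree $d:\mathbb U\to\mathcal L_{\mathbb N}$: $a\in\mathbb T$, $d(a)=\oslash$ for $a\in\mathcal A$; if $U\in\mathbb U$, $T\in\mathbb T$ then $U\to T\in\mathbb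 T$, $d(U\to T)=\oslash$; $\omega^L\in\mathbb U$ with $d(\omega^L)=L$; if $U_1,U_2\in\mathbb U$ with $d(U_1)=d(U_2)$ then $U_1\sqcap U_2\in\mathbb U$ of that degree; if $U\in\mathbb U$ then $\overline e_iU\in\mathbb U$ with $d(\overline e_iU)=i::d(U)$. Types are quotiented by: $\sqcap$ commutative, associative, idempotent; $\overline e_i(U_1\sqcap U_2)=\overline e_iU_1\sqcap\overline e_iU_2$; $\omega^L\sqcap U=U$ when $d(U)=L$; $\overline e_i\omega^K=\omega^{i::K}$. Environments: a type environment is a finite set $\{x_1^{L_1}:U_1,\dots,x_n^{L_n}:U_n\}$ with $U_i\in\mathbb U$ giving each $x^L$ at most one type; $()$ is the empty one; $\Gamma,\Delta$ is union of environments with disjoint domains; $env^\omega_M$ assigns $\omega^L$ to each $x^L\in\mathrm{fv}(M)$; $\Gamma_1\sqcap\Gamma_2$ assigns $U\sqcap U'$ to common $x^L$ (types of equal degree) and keeps the other declarations; $\overline e_j\{x_i^{L_i}:U_i\}=\{x_i^{j::L_i}:\overline e_jU_i\}$; $\Gamma_1\diamond\Gamma_2$ iff $x^L\in\mathrm{dom}\,\Gamma_1$, $x^K\in\mathrm{dom}\,\Gamma_2$ imply $L=K$. Subtyping $\sqsubseteq$ (on types, on environments, on typings $\langle\Gamma\vdash U\rangle$) is the least relation closed under: reflexivity; transitivity; $U_1\sqcap U_2\sqsubseteq U_1$ if $d(U_1)=d(U_2)$; $U_1\sqcap U_2\sqsubseteq V_1\sqcap V_2$ if $U_1\sqsubseteq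 V_1,U_2\sqsubseteq V_2$; $U_1\to T_1\sqsubseteq U_2\to T_2$ if $U_2\sqsubseteq U_1$ and $T_1\sqsubseteq T_2$; $\overline e_iU_1\sqsubseteq\overline e_iU_2$ if $U_1\sqsubseteq U_2$; $\Gamma,y^L:U_1\sqsubseteq\Gamma,y^L:U_2$ if $U_1\sqsubseteq U_2$; $\langle\Gamma_1\vdash U_1\rangle\sqsubseteq\langle\Gamma_2\vdash U_2\rangle$ if $U_1\sqsubseteq U_2$ and $\Gamma_2\sqsubseteq\Gamma_1$. Typing: $M:\langle\Gamma\vdash U\rangle$ is derivable by the rules ($T\in\mathbb T$, $U\in\mathbb U$): (ax) $x^\oslash:\langle(x^\oslash:T)\vdash T\rangle$; ($\omega$) $M:\langle env^\omega_M\vdash\omega^{d(M)}\rangle$; ($\to_I$) from $M:\langle\Gamma,(x^L:U)\vdash T\rangle$ infer $\lambda x^L.M:\langle\Gamma\vdash U\to T\rangle$; ($\to_I'$) from $M:\langle\Gamma\vdash T\rangle$ and $x^L\notin\mathrm{dom}\,\Gamma$ infer $\lambda x^L.M:\langle\Gamma\vdash\omega^L\to T\rangle$; ($\to_E$) from $M_1:\langle\Gamma_1\vdash U\to T\rangle$, $M_2:\langle\Gamma_2\vdash U\rangle$, $\Gamma_1\diamond\Gamma_2$ infer $M_1M_2:\langle\Gamma_1\sqcap\Gamma_2\vdash T\rangle$; ($\sqcap_I$) from $M:\langle\Gamma\vdash U_1\rangle$, $M:\langle\Gamma\vdash U_2\rangle$ infer $M:\langle\Gamma\vdash U_1\sqcap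 U_2\rangle$; ($e$) from $M:\langle\Gamma\vdash U\rangle$ infer $M^{+j}:\langle\overline e_j\Gamma\vdash\overline e_jU\rangle$; ($\sqsubseteq$) from $M:\langle\Gamma\vdash U\rangle$ and $\langle\Gamma\vdash U\rangle\sqsubseteq\langle\Gamma'\vdash U'\rangle$ infer $M:\langle\Gamma'\vdash U'\rangle$. Realisability: $\mathcal V=\mathcal V_1\cup\mathcal V_2$ with $\mathcal V_1,\mathcal V_2$ disjoint and countably infinite. For $\mathcal X,\mathcal Y\subseteq\mathcal M$: $\mathcal X^{+i}=\{M^{+i}:M\in\mathcal X\}$; $\mathcal X\leadsto\mathcal Y=\{M\in\mathcal M: MN\in\mathcal Y$ for all $N\in\mathcal X$ with $M\diamond N\}$; for $r\in\{\beta,\beta\eta,h\}$, $\mathcal X$ is $r$-saturated if $M\rhd_r^*N$ and $N\in\mathcal X$ imply $M\in\mathcal X$. $\mathcal M^L=\{M\in\mathcal M:d(M)=L\}$; for $x\in\mathcal V_1$, $\mathcal N^L_x=\{x^LN_1\dots N_k\in\mathcal M:k\ge0\}$. An $r$-interpretation is a map $\mathcal I:\mathcal A\to\mathcal P(\mathcal M^\oslash)$ such that each $\mathcal I(a)$ is $r$-saturated and $\mathcal N^\oslash_x\subseteq\mathcal I(a)$ for all $x\in\mathcal V_1$; it is extended to $\mathbb U$ by $\mathcal I(\omega^L)=\mathcal M^L$, $\mathcal I(\overline e_iU)=\mathcal I(U)^{+i}$, $\mathcal I(U_1\sqcap U_2)=\mathcal I(U_1)\cap\mathcal I(U_2)$,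 $\mathcal I(U\to T)=\mathcal I(U)\leadsto\mathcal I(T)$. $[U]_r=\{M\in\mathcal M: M$ closed and $M\in\mathcal I(U)$ for every $r$-interpretation $\mathcal I\}$. -}

module Defs where

open import Data.Nat using (ℕ; zero; suc; _+_; _<_; _<ᵇ_; _≡ᵇ_; pred)
import Data.Nat as Nat
open import Data.Bool using (Bool; true; false; if_then_else_; _∧_; _∨_)
open import Data.List using (List; []; _∷_; _++_; length)
import Data.List.Properties as LP
open import Data.List.Membership.Propositional using (_∈_)
open import Data.Maybe using (Maybe; just; nothing)
import Data.Maybe as Maybe
open import Data.Product using (Σ; _×_; _,_)
open import Relation.Nullary using (¬_; Dec; yes; no; does)
open import Relation.Binary.PropositionalEquality using (_≡_; refl)
open import Relation.Binary.Construct.Closure.ReflexiveTransitive using (Star)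
import Data.Sum
import Data.Empty
open import Data.Unit using (⊤; tt)
open import Level using (Level) renaming (suc to lsuc; zero to lzero)

Index : Set
Index = List ℕ

_≟L_ : (L K : Index) → Dec (L ≡ K)
_≟L_ = LP.≡-dec Nat._≟_

_⪯_ : Index → Index → Set
L₁ ⪯ L₂ = Σ Index (λ L₃ → L₂ ≡ L₁ ++ L₃)

data Var : Set where
  v₁ : ℕ → Var
  v₂ : ℕ → Var

_≟V_ : (x y : Var) → Dec (x ≡ y)
v₁ m ≟V v₁ n with m Nat.≟ n
... | yes refl = yes refl
... | no ne = no λ { refl → ne refl }
v₁ m ≟V v₂ n = no λ ()
v₂ m ≟V v₁ n = no λ ()
v₂ m ≟V v₂ n with m Nat.≟ n
... | yes refl = yes refl
... | no ne = no λ { refl → ne refl }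

sameVar : Var → Index → Var → Index → Bool
sameVar x L y K = does (x ≟V y) ∧ does (L ≟L K)

-- Terms, in locally nameless representation (this realises the quotient
-- by α-conversion): free indexed variables x^L are named, bound variables
-- are de Bruijn indices, each binder carries the index L of its variable.

data Tm : Set where
  fv  : Var → Index → Tm
  bv  : ℕ → Tm
  lam : Index → Tm → Tm
  app : Tm → Tm → Tm

fvs : Tm → List (Var × Index)
fvs (fv x L) = (x , L) ∷ []
fvs (bv i) = []
fvs (lam L M) = fvs M
fvs (app M N) = fvs M ++ fvs N

lookupD : List Index → ℕ → Index
lookupD [] i = []
lookupD (L ∷ Δ) zero = L
lookupD (L ∷ Δ) (suc i) = lookupD Δ i

-- degree, relative to the list Δ of indexes of enclosing binders
deg : List Index → Tm → Index
deg Δ (fv x L) = L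
deg Δ (bv i) = lookupD Δ i
deg Δ (lam L M) = deg (L ∷ Δ) M
deg Δ (app M N) = deg Δ M

_◇_ : Tm → Tm → Set
M ◇ N = ∀ x L K → (x , L) ∈ fvs M → (x , K) ∈ fvs N → L ≡ K

data WF (Δ : List Index) : Tm → Set where
  wf-fv  : ∀ x L → WF Δ (fv x L)
  wf-bv  : ∀ i → i < length Δ → WF Δ (bv i)
  wf-app : ∀ {M N} → WF Δ M → WF Δ N → deg Δ M ⪯ deg Δ N → M ◇ N →
           WF Δ (app M N)
  wf-lam : ∀ {L M} → WF (L ∷ Δ) M → deg (L ∷ Δ) M ⪯ L → WF Δ (lam L M)

Term : Tm → Set
Term M = WF [] M

d : Tm → Index
d M = deg [] M

𝓜^ : Index → Tm → Set
𝓜^ L M = Term M × d M ≡ L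

Closed : Tm → Set
Closed M = fvs M ≡ []

lift : ℕ → Tm → Tm
lift i (fv x L) = fv x (i ∷ L)
lift i (bv n) = bv n
lift i (lam L M) = lam (i ∷ L) (lift i M)
lift i (app M N) = app (lift i M) (lift i N)

closeAt : ℕ → Var → Index → Tm → Tm
closeAt k x L (fv y K) = if sameVar x L y K then bv k else fv y K
closeAt k x L (bv i) = bv i
closeAt k x L (lam K M) = lam K (closeAt (suc k) x L M)
closeAt k x L (app M N) = app (closeAt k x L M) (closeAt k x L N)

ƛ : Var → Index → Tm → Tm
ƛ x L M = lam L (closeAt 0 x L M)

shift : ℕ → ℕ → Tm → Tm
shift n c (fv x L) = fv x L
shift n c (bv i) = if i <ᵇ c then bv i else bv (i + n)
shift n c (lam L M) = lam L (shift n (suc c) M)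
shift n c (app M N) = app (shift n c M) (shift n c N)

substAt : ℕ → Tm → Tm → Tm
substAt k N (fv x L) = fv x L
substAt k N (bv i) =
  if i <ᵇ k then bv i else (if i ≡ᵇ k then shift k 0 N else bv (pred i))
substAt k N (lam L M) = lam L (substAt (suc k) N M)
substAt k N (app M₁ M₂) = app (substAt k N M₁) (substAt k N M₂)

_[0≔_] : Tm → Tm → Tm
M [0≔ N ] = substAt 0 N M

downAt : ℕ → Tm → Tm
downAt c (fv x L) = fv x L
downAt c (bv i) = if i <ᵇ c then bv i else bv (pred i)
downAt c (lam L M) = lam L (downAt (suc c) M)
downAt c (app M N) = app (downAt c M) (downAt c N)

NotFree : ℕ → Tm → Set
NotFree c (fv x L) = ⊤
NotFree c (bv i) = ¬ (i ≡ c)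
NotFree c (lam L M) = NotFree (suc c) M
NotFree c (app M N) = NotFree c M × NotFree c N

data βroot (Δ : List Index) : Tm → Tm → Set where
  β : ∀ {L M N} → deg Δ N ≡ L → βroot Δ (app (lam L M) N) (M [0≔ N ])

data ηroot (Δ : List Index) : Tm → Tm → Set where
  η : ∀ {L M} → NotFree 0 M → ηroot Δ (lam L (app M (bv 0))) (downAt 0 M)

data Compat (R : List Index → Tm → Tm → Set) (Δ : List Index) : Tm → Tm → Set where
  root : ∀ {M N} → R Δ M N → Compat R Δ M N
  appL : ∀ {M M' N} → Compat R Δ M M' → Compat R Δ (app M N) (app M' N)
  appR : ∀ {M N N'} → Compat R Δ N N' → Compat R Δ (app M N) (app M N')
  lamC : ∀ {L M M'} → Compat R (L ∷ Δ) M M' → Compat R Δ (lam L M) (lam L M')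

data HeadRed : Tm → Tm → Set where
  hβ   : ∀ {L M N} → d N ≡ L → HeadRed (app (lam L M) N) (M [0≔ N ])
  happ : ∀ {M M' N} → HeadRed M M' → HeadRed (app M N) (app M' N)

data Kind : Set where
  βk βηk hk : Kind

Raw : Kind → Tm → Tm → Set
Raw βk M N = Compat βroot [] M N
Raw βηk M N = Data.Sum._⊎_ (Compat βroot [] M N) (Compat ηroot [] M N)
Raw hk M N = HeadRed M N

Step : Kind → Tm → Tm → Set
Step r M N = Term M × Term N × Raw r M N

_▷*[_]_ : Tm → Kind → Tm → Set
M ▷*[ r ] N = Star (Step r) M N

-- Types, indexed by their degree

mutual
  data 𝕋 : Set where
    atom : ℕ → 𝕋
    _⇒_  : ∀ {L} → 𝕌 L → 𝕋 → 𝕋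

  data 𝕌 : Index → Set where
    ty  : 𝕋 → 𝕌 []
    ω   : ∀ L → 𝕌 L
    _⊓_ : ∀ {L} → 𝕌 L → 𝕌 L → 𝕌 L
    ē   : ∀ {L} (i : ℕ) → 𝕌 L → 𝕌 (i ∷ L)

infixr 5 _⇒_
infixl 6 _⊓_

-- the equations by which types are quotiented
mutual
  data _≈T_ : 𝕋 → 𝕋 → Set where
    ≈T-refl  : ∀ {T} → T ≈T T
    ≈T-sym   : ∀ {T T'} → T ≈T T' → T' ≈T T
    ≈T-trans : ∀ {T₁ T₂ T₃} → T₁ ≈T T₂ → T₂ ≈T T₃ → T₁ ≈T T₃
    ⇒-cong   : ∀ {L} {U U' : 𝕌 L} {T T'} → U ≈ U' → T ≈T T' → (U ⇒ T) ≈T (U' ⇒ T')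

  data _≈_ : ∀ {L} → 𝕌 L → 𝕌 L → Set where
    ≈-refl   : ∀ {L} {U : 𝕌 L} → U ≈ U
    ≈-sym    : ∀ {L} {U V : 𝕌 L} → U ≈ V → V ≈ U
    ≈-trans  : ∀ {L} {U V W : 𝕌 L} → U ≈ V → V ≈ W → U ≈ W
    ty-cong  : ∀ {T T'} → T ≈T T' → ty T ≈ ty T'
    ⊓-cong   : ∀ {L} {U U' V V' : 𝕌 L} → U ≈ U' → V ≈ V' → (U ⊓ V) ≈ (U' ⊓ V')
    ē-cong   : ∀ {L i} {U U' : 𝕌 L} → U ≈ U' → ē i U ≈ ē i U'
    ⊓-comm   : ∀ {L} {U V : 𝕌 L} → (U ⊓ V) ≈ (V ⊓ U)
    ⊓-assoc  : ∀ {L} {U V W : 𝕌 L} → ((U ⊓ V) ⊓ W) ≈ (U ⊓ (V ⊓ W))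
    ⊓-idem   : ∀ {L} {U : 𝕌 L} → (U ⊓ U) ≈ U
    ē-⊓      : ∀ {L i} {U V : 𝕌 L} → ē i (U ⊓ V) ≈ (ē i U ⊓ ē i V)
    ω-unit   : ∀ {L} {U : 𝕌 L} → (ω L ⊓ U) ≈ U
    ē-ω      : ∀ {K i} → ē i (ω K) ≈ ω (i ∷ K)

-- subtyping (on the quotient: equal types are related by reflexivity)
data _⊑_ : ∀ {L} → 𝕌 L → 𝕌 L → Set where
  ⊑-refl  : ∀ {L} {U V : 𝕌 L} → U ≈ V → U ⊑ V
  ⊑-trans : ∀ {L} {U V W : 𝕌 L} → U ⊑ V → V ⊑ W → U ⊑ W
  ⊓-lb    : ∀ {L} {U₁ U₂ : 𝕌 L} → (U₁ ⊓ U₂) ⊑ U₁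
  ⊓-mono  : ∀ {L} {U₁ U₂ V₁ V₂ : 𝕌 L} → U₁ ⊑ V₁ → U₂ ⊑ V₂ → (U₁ ⊓ U₂) ⊑ (V₁ ⊓ V₂)
  ⇒-mono  : ∀ {L} {U₁ U₂ : 𝕌 L} {T₁ T₂} → U₂ ⊑ U₁ → ty T₁ ⊑ ty T₂ →
            ty (U₁ ⇒ T₁) ⊑ ty (U₂ ⇒ T₂)
  ē-mono  : ∀ {L i} {U₁ U₂ : 𝕌 L} → U₁ ⊑ U₂ → ē i U₁ ⊑ ē i U₂

-- Type environments: finite partial maps x^L ↦ U (with d(U) = L)

Env : Set
Env = Var → (L : Index) → Maybe (𝕌 L)

∅ : Env
∅ _ _ = nothing

single : Var → (L : Index) → 𝕌 L → Env
single x L U y K with x ≟V y | L ≟L K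
... | yes _ | yes refl = just U
... | _ | _ = nothing

remove : Var → Index → Env → Env
remove x L Γ y K = if sameVar x L y K then nothing else Γ y K

env^ω : Tm → Env
env^ω M y K = go (fvs M)
  where
  go : List (Var × Index) → Maybe (𝕌 K)
  go [] = nothing
  go ((x , L) ∷ xs) = if sameVar x L y K then just (ω K) else go xs

_⊓E_ : Env → Env → Env
(Γ₁ ⊓E Γ₂) y K with Γ₁ y K | Γ₂ y K
... | just U | just V = just (U ⊓ V)
... | just U | nothing = just U
... | nothing | m = m

ēE : ℕ → Env → Env
ēE j Γ y [] = nothing
ēE j Γ y (i ∷ K) with i Nat.≟ j
... | yes refl = Maybe.map (ē i) (Γ y K)
... | no _ = nothing

IsJust : ∀ {A : Set} → Maybe A → Set
IsJust (just _) = ⊤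
IsJust nothing = Data.Empty.⊥

_◇E_ : Env → Env → Set
Γ₁ ◇E Γ₂ = ∀ x L K → IsJust (Γ₁ x L) → IsJust (Γ₂ x K) → L ≡ K

data MaybeRel {L : Index} : Maybe (𝕌 L) → Maybe (𝕌 L) → Set where
  nothing : MaybeRel nothing nothing
  just    : ∀ {U V} → U ⊑ V → MaybeRel (just U) (just V)

_⊑E_ : Env → Env → Set
Γ ⊑E Γ' = ∀ x L → MaybeRel (Γ x L) (Γ' x L)

data _∶⟨_⊢_⟩ : ∀ {L} → Tm → Env → 𝕌 L → Set where
  ax   : ∀ x (T : 𝕋) → fv x [] ∶⟨ single x [] (ty T) ⊢ ty T ⟩
  ω-ty : ∀ {M} → Term M → M ∶⟨ env^ω M ⊢ ω (d M) ⟩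
  →I   : ∀ {M Γ T x L} {U : 𝕌 L} → M ∶⟨ Γ ⊢ ty T ⟩ → Γ x L ≡ just U →
         Term (ƛ x L M) → ƛ x L M ∶⟨ remove x L Γ ⊢ ty (U ⇒ T) ⟩
  →I'  : ∀ {M Γ T x L} → M ∶⟨ Γ ⊢ ty T ⟩ → Γ x L ≡ nothing →
         Term (ƛ x L M) → ƛ x L M ∶⟨ Γ ⊢ ty (ω L ⇒ T) ⟩
  →E   : ∀ {M₁ M₂ Γ₁ Γ₂ K T} {U : 𝕌 K} → M₁ ∶⟨ Γ₁ ⊢ ty (U ⇒ T) ⟩ →
         M₂ ∶⟨ Γ₂ ⊢ U ⟩ → Γ₁ ◇E Γ₂ → Term (app M₁ M₂) →
         app M₁ M₂ ∶⟨ Γ₁ ⊓E Γ₂ ⊢ ty T ⟩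
  ⊓I   : ∀ {M Γ L} {U₁ U₂ : 𝕌 L} → M ∶⟨ Γ ⊢ U₁ ⟩ → M ∶⟨ Γ ⊢ U₂ ⟩ →
         M ∶⟨ Γ ⊢ U₁ ⊓ U₂ ⟩
  e    : ∀ {M Γ L} {U : 𝕌 L} j → M ∶⟨ Γ ⊢ U ⟩ → lift j M ∶⟨ ēE j Γ ⊢ ē j U ⟩
  sub  : ∀ {M Γ Γ' L} {U U' : 𝕌 L} → M ∶⟨ Γ ⊢ U ⟩ → Γ' ⊑E Γ → U ⊑ U' →
         M ∶⟨ Γ' ⊢ U' ⟩

Pred : Set₁
Pred = Tm → Set

_⇝_ : Pred → Pred → Pred
(𝒳 ⇝ 𝒴) M = Term M × (∀ N → 𝒳 N → M ◇ N → 𝒴 (app M N))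

_⁺ : Pred → ℕ → Pred
(𝒳 ⁺) i M = Σ Tm (λ N → 𝒳 N × M ≡ lift i N)

Saturated : Kind → Pred → Set
Saturated r 𝒳 = ∀ M N → M ▷*[ r ] N → 𝒳 N → 𝒳 M

data Spine (x : Var) (L : Index) : Tm → Set where
  hd : Spine x L (fv x L)
  ap : ∀ {M N} → Spine x L M → Spine x L (app M N)

𝒩 : Index → Var → Pred
𝒩 L x M = Term M × Spine x L M

record Interp (r : Kind) : Set₁ where
  field
    I      : ℕ → Pred
    I-deg  : ∀ a M → I a M → 𝓜^ [] M
    I-sat  : ∀ a → Saturated r (I a)
    I-neut : ∀ a n M → 𝒩 [] (v₁ n) M → I a M

mutual
  ⟦_⟧T : ∀ {r} → 𝕋 → Interp r → Pred
  ⟦ atom a ⟧T ℐ = Interp.I ℐ a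
  ⟦ U ⇒ T ⟧T ℐ = ⟦ U ⟧ ℐ ⇝ ⟦ T ⟧T ℐ

  ⟦_⟧ : ∀ {r L} → 𝕌 L → Interp r → Pred
  ⟦ ty T ⟧ ℐ = ⟦ T ⟧T ℐ
  ⟦ ω L ⟧ ℐ = 𝓜^ L
  ⟦ U ⊓ V ⟧ ℐ M = ⟦ U ⟧ ℐ M × ⟦ V ⟧ ℐ M
  ⟦ ē i U ⟧ ℐ = (⟦ U ⟧ ℐ ⁺) i

Real : Kind → ∀ {L} → 𝕌 L → Tm → Set₁
Real r U M = Term M × Closed M × ((ℐ : Interp r) → ⟦ U ⟧ ℐ M)

{-# OPTIONS --safe #-}
-- Modulo the equations on types, a type of degree L is ē_L (T₁ ⊓ ... ⊓ Tₙ), and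
-- all indexes occurring in a term of degree L have prefix L.  Typing is therefore
-- equivalent to a syntax-directed system (Typ) whose types are lists of strict
-- types and in which lifting is invisible; there the substitution lemma and its
-- converse give subject reduction for βη and subject expansion for β.
-- Soundness is the usual adequacy argument.  For completeness, fix an environment
-- giving each relevant list of strict types to infinitely many variables of 𝒱₂,
-- and interpret atoms by typability in it (for β and h) or by having a typable
-- reduct (for βη); terms with a free variable of 𝒱₁ are added to every atom.
-- Testing an arrow type against a fresh variable of the right type shows that
-- every type is then interpreted by typability.  For βη the intersection and
-- arrow cases use confluence, which also gives stability under reduction.
module Submission where

open import Defs
open import Data.Bool using (true; false; if_then_else_)
open import Data.Empty using (⊥; ⊥-elim)
open import Data.Fin using (Fin; toℕ)
import Data.Fin.Properties as FinP
open import Data.List using (List; []; _∷_; _++_; length; map; drop; lookup)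
open import Data.List.Membership.Propositional using (_∈_)
import Data.List.Membership.DecPropositional as DecMembership
import Data.List.Membership.Propositional.Properties as MP
import Data.List.Properties as LP
open import Data.List.Relation.Binary.Subset.Propositional using (_⊆_)
open import Data.List.Relation.Unary.All as All using (All; []; _∷_)
import Data.List.Relation.Unary.All.Properties as AllP
open import Data.List.Relation.Unary.Any as Any using (Any; here; there)
import Data.List.Relation.Unary.Any.Properties as AnyP
open import Data.Maybe as Maybe using (Maybe; just; nothing)
open import Data.Nat as ℕ using (ℕ; zero; suc; _+_; _*_; _<_; _≤_; s≤s; z≤n; _<ᵇ_; _≡ᵇ_; pred; _⊔_)
open import Data.Nat.DivMod using (_mod_; m<n⇒m%n≡m; [m+kn]%n≡m%n)
import Data.Nat.Properties as ℕP
open import Data.Product using (Σ; _×_; _,_; proj₁; proj₂)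
import Data.Product.Properties as ProdP
open import Data.Sum using (_⊎_; inj₁; inj₂; [_,_]′)
open import Data.Unit using (tt)
open import Function using (_∘_; id)
open import Function.Bundles using (_⇔_; mk⇔)
open import Relation.Binary.Construct.Closure.ReflexiveTransitive using (Star; _◅_; _◅◅_; gmap) renaming (ε to done)
open import Relation.Binary.PropositionalEquality using (_≡_; _≢_; refl; sym; trans; cong; cong₂; subst; subst₂; module ≡-Reasoning)
open import Relation.Nullary using (¬_; Dec; yes; no; does)

-- Renaming and simultaneous substitution

-- Three facts shape the proof. Subject expansion fails for η: a variable may have an atomic type, a
-- λ never does, so `λy.xy` need not be typable where `x` is. Plain typability is therefore
-- saturated for β and h only; for βη it is replaced by having a typable reduct, and then different
-- conjuncts come with unrelated reducts, which is what confluence repairs. Next, an interpretation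
-- must contain all neutral terms headed by 𝒱₁, typable or not. Adding to the atoms every term with
-- a free variable of 𝒱₁ meets this, and the closed terms, the only ones that [U] contains, are not
-- affected. Finally, terms are raw and well-formedness is a separate predicate involving degrees
-- and joinability. Confluence, the degree lemmas and the two substitution lemmas for typing are
-- proved on raw terms, and well-formedness is restored afterwards. To prove each property once,
-- `substAt`, `closeAt`, `shift` and `downAt` are all expressed through one simultaneous
-- substitution `inst` and one renaming `ren`.

data Name : Set where
  bn : ℕ → Name
  fn : Var → Index → Name

var : Name → Tm
var (bn i)   = bv i
var (fn x L) = fv x L

degN : List Index → Name → Index
degN Δ n = deg Δ (var n)

Subst : Set
Subst = Name → Tm

ext : (ℕ → ℕ) → ℕ → ℕ
ext ρ zero    = zero
ext ρ (suc i) = suc (ρ i)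

ren : (ℕ → ℕ) → Tm → Tm
ren ρ (fv x L)  = fv x L
ren ρ (bv i)    = bv (ρ i)
ren ρ (lam L M) = lam L (ren (ext ρ) M)
ren ρ (app M N) = app (ren ρ M) (ren ρ N)

wk : Tm → Tm
wk = ren suc

exts : Subst → Subst
exts σ (bn zero)    = bv zero
exts σ (bn (suc i)) = wk (σ (bn i))
exts σ (fn x L)     = wk (σ (fn x L))

inst : Subst → Tm → Tm
inst σ (fv x L)  = σ (fn x L)
inst σ (bv i)    = σ (bn i)
inst σ (lam L M) = lam L (inst (exts σ) M)
inst σ (app M N) = app (inst σ M) (inst σ N)

_•_ : Tm → Subst → Subst
(N • σ) (bn zero)    = N
(N • σ) (bn (suc i)) = σ (bn i)
(N • σ) (fn x L)     = σ (fn x L)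

ext-cong : ∀ {ρ ρ'} → (∀ i → ρ i ≡ ρ' i) → ∀ i → ext ρ i ≡ ext ρ' i
ext-cong eq zero    = refl
ext-cong eq (suc i) = cong suc (eq i)

ren-cong : ∀ {ρ ρ'} → (∀ i → ρ i ≡ ρ' i) → ∀ M → ren ρ M ≡ ren ρ' M
ren-cong eq (fv x L)  = refl
ren-cong eq (bv i)    = cong bv (eq i)
ren-cong eq (lam L M) = cong (lam L) (ren-cong (ext-cong eq) M)
ren-cong eq (app M N) = cong₂ app (ren-cong eq M) (ren-cong eq N)

exts-cong : ∀ {σ τ} → (∀ n → σ n ≡ τ n) → ∀ n → exts σ n ≡ exts τ n
exts-cong eq (bn zero)    = refl
exts-cong eq (bn (suc i)) = cong wk (eq (bn i))
exts-cong eq (fn x L)     = cong wk (eq (fn x L))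

inst-cong : ∀ {σ τ} → (∀ n → σ n ≡ τ n) → ∀ M → inst σ M ≡ inst τ M
inst-cong eq (fv x L)  = eq (fn x L)
inst-cong eq (bv i)    = eq (bn i)
inst-cong eq (lam L M) = cong (lam L) (inst-cong (exts-cong eq) M)
inst-cong eq (app M N) = cong₂ app (inst-cong eq M) (inst-cong eq N)

exts-var : ∀ n → exts var n ≡ var n
exts-var (bn zero)    = refl
exts-var (bn (suc i)) = refl
exts-var (fn x L)     = refl

inst-var : ∀ M → inst var M ≡ M
inst-var (fv x L)  = refl
inst-var (bv i)    = refl
inst-var (lam L M) = cong (lam L) (trans (inst-cong exts-var M) (inst-var M))
inst-var (app M N) = cong₂ app (inst-var M) (inst-var N)

ren-ren : ∀ ρ ρ' M → ren ρ (ren ρ' M) ≡ ren (ρ ∘ ρ') M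
ren-ren ρ ρ' (fv x L)  = refl
ren-ren ρ ρ' (bv i)    = refl
ren-ren ρ ρ' (lam L M) = cong (lam L)
  (trans (ren-ren (ext ρ) (ext ρ') M) (ren-cong (λ { zero → refl ; (suc i) → refl }) M))
ren-ren ρ ρ' (app M N) = cong₂ app (ren-ren ρ ρ' M) (ren-ren ρ ρ' N)

ren-wk : ∀ ρ M → ren (ext ρ) (wk M) ≡ wk (ren ρ M)
ren-wk ρ M = trans (ren-ren (ext ρ) suc M) (sym (ren-ren suc ρ M))

renName : (ℕ → ℕ) → Name → Name
renName ρ (bn i)   = bn (ρ i)
renName ρ (fn x L) = fn x L

inst-ren : ∀ σ ρ M → inst σ (ren ρ M) ≡ inst (σ ∘ renName ρ) M
inst-ren σ ρ (fv x L)  = refl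
inst-ren σ ρ (bv i)    = refl
inst-ren σ ρ (lam L M) = cong (lam L)
  (trans (inst-ren (exts σ) (ext ρ) M)
         (inst-cong (λ { (bn zero) → refl ; (bn (suc i)) → refl ; (fn x L) → refl }) M))
inst-ren σ ρ (app M N) = cong₂ app (inst-ren σ ρ M) (inst-ren σ ρ N)

ren-inst : ∀ ρ σ M → ren ρ (inst σ M) ≡ inst (ren ρ ∘ σ) M
ren-inst ρ σ (fv x L)  = refl
ren-inst ρ σ (bv i)    = refl
ren-inst ρ σ (lam L M) = cong (lam L)
  (trans (ren-inst (ext ρ) (exts σ) M)
         (inst-cong (λ { (bn zero)    → refl
                      ; (bn (suc i)) → ren-wk ρ (σ (bn i))
                      ; (fn x L)     → ren-wk ρ (σ (fn x L)) }) M))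
ren-inst ρ σ (app M N) = cong₂ app (ren-inst ρ σ M) (ren-inst ρ σ N)

inst-wk : ∀ σ M → inst (exts σ) (wk M) ≡ wk (inst σ M)
inst-wk σ M = begin
  inst (exts σ) (wk M)           ≡⟨ inst-ren (exts σ) suc M ⟩
  inst (exts σ ∘ renName suc) M  ≡⟨ inst-cong (λ { (bn i) → refl ; (fn x L) → refl }) M ⟩
  inst (wk ∘ σ) M                ≡⟨ sym (ren-inst suc σ M) ⟩
  wk (inst σ M)                  ∎
  where open ≡-Reasoning

inst-inst : ∀ σ τ M → inst σ (inst τ M) ≡ inst (inst σ ∘ τ) M
inst-inst σ τ (fv x L)  = refl
inst-inst σ τ (bv i)    = refl
inst-inst σ τ (lam L M) = cong (lam L)
  (trans (inst-inst (exts σ) (exts τ) M)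
         (inst-cong (λ { (bn zero)    → refl
                      ; (bn (suc i)) → inst-wk σ (τ (bn i))
                      ; (fn x L)     → inst-wk σ (τ (fn x L)) }) M))
inst-inst σ τ (app M N) = cong₂ app (inst-inst σ τ M) (inst-inst σ τ N)

•-wk : ∀ N σ M → inst (N • σ) (wk M) ≡ inst σ M
•-wk N σ M = trans (inst-ren (N • σ) suc M)
                   (inst-cong (λ { (bn i) → refl ; (fn x L) → refl }) M)

ren-as-inst : ∀ ρ M → inst (var ∘ renName ρ) M ≡ ren ρ M
ren-as-inst ρ M = trans (sym (inst-ren var ρ M)) (inst-var (ren ρ M))

exts-• : ∀ N σ n → inst (N • var) (exts σ n) ≡ (N • σ) n
exts-• N σ (bn zero)    = refl
exts-• N σ (bn (suc i)) = trans (•-wk N var (σ (bn i))) (inst-var _)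
exts-• N σ (fn x L)     = trans (•-wk N var (σ (fn x L))) (inst-var _)

-- The operations of the definitions as instances of renaming and substitution

shift-ren : ∀ n M → shift n 0 M ≡ ren (_+ n) M
shift-ren n M = trans (go 0 M) (ren-cong (λ i → refl) M)
  where
  shf : ℕ → ℕ → ℕ
  shf zero    i       = i + n
  shf (suc c) zero    = zero
  shf (suc c) (suc i) = suc (shf c i)

  shf-bv : ∀ c i → (if i <ᵇ c then bv i else bv (i + n)) ≡ bv (shf c i)
  shf-bv zero    i       = refl
  shf-bv (suc c) zero    = refl
  shf-bv (suc c) (suc i) with i <ᵇ c | shf-bv c i
  ... | true  | eq = cong wk eq
  ... | false | eq = cong wk eq

  go : ∀ c M → shift n c M ≡ ren (shf c) M
  go c (fv x L)  = refl
  go c (bv i)    = shf-bv c i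
  go c (lam L M) = cong (lam L)
    (trans (go (suc c) M) (ren-cong (λ { zero → refl ; (suc i) → refl }) M))
  go c (app M N) = cong₂ app (go c M) (go c N)

exts^ : ℕ → Subst → Subst
exts^ zero    σ = σ
exts^ (suc k) σ = exts (exts^ k σ)

exts^-fn : ∀ k N x L → exts^ k (N • var) (fn x L) ≡ fv x L
exts^-fn zero    N x L = refl
exts^-fn (suc k) N x L = cong wk (exts^-fn k N x L)

-- `substAt` compares the index with `k`, whereas `exts^` recurses on `k`. The two agree because
-- passing one more binder weakens the result (`step`), which for the hit case says that
-- `shift (suc k) 0 N` is `wk (shift k 0 N)`.
substAt-bv : ∀ k N i → substAt k N (bv i) ≡ exts^ k (N • var) (bn i)
substAt-bv zero    N zero    = trans (shift-ren 0 N)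
  (trans (ren-cong ℕP.+-identityʳ N) (trans (sym (ren-as-inst id N))
    (trans (inst-cong (λ { (bn i) → refl ; (fn x L) → refl }) N) (inst-var N))))
substAt-bv zero    N (suc i) = refl
substAt-bv (suc k) N zero    = refl
substAt-bv (suc k) N (suc i) = trans (step k i) (cong wk (substAt-bv k N i))
  where
  pos : ∀ k i → (i <ᵇ k) ≡ false → (i ≡ᵇ k) ≡ false → suc (pred i) ≡ i
  pos zero    zero    _ ()
  pos zero    (suc i) _ _ = refl
  pos (suc k) zero    () _
  pos (suc k) (suc i) _ _ = refl

  step : ∀ k i → substAt (suc k) N (bv (suc i)) ≡ wk (substAt k N (bv i))
  step k i with i <ᵇ k in p | i ≡ᵇ k in q
  ... | true  | _     = refl
  ... | false | true  = trans (shift-ren (suc k) N)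
        (trans (ren-cong (λ j → ℕP.+-suc j k) N)
        (trans (sym (ren-ren suc (_+ k) N)) (cong wk (sym (shift-ren k N)))))
  ... | false | false = cong bv (sym (pos k i p q))

substAt-inst : ∀ k N M → substAt k N M ≡ inst (exts^ k (N • var)) M
substAt-inst k N (fv x L)  = sym (exts^-fn k N x L)
substAt-inst k N (bv i)    = substAt-bv k N i
substAt-inst k N (lam L M) = cong (lam L) (substAt-inst (suc k) N M)
substAt-inst k N (app M P) = cong₂ app (substAt-inst k N M) (substAt-inst k N P)

[0≔]-inst : ∀ M N → M [0≔ N ] ≡ inst (N • var) M
[0≔]-inst M N = substAt-inst 0 N M

inst-[0≔] : ∀ σ M N → inst σ (M [0≔ N ]) ≡ inst (exts σ) M [0≔ inst σ N ]
inst-[0≔] σ M N = begin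
  inst σ (M [0≔ N ])                        ≡⟨ cong (inst σ) ([0≔]-inst M N) ⟩
  inst σ (inst (N • var) M)                  ≡⟨ inst-inst σ (N • var) M ⟩
  inst (inst σ ∘ (N • var)) M                ≡⟨ inst-cong (λ { (bn zero) → refl ; (bn (suc i)) → refl ; (fn x L) → refl }) M ⟩
  inst (inst σ N • σ) M                      ≡⟨ inst-cong (λ n → sym (exts-• (inst σ N) σ n)) M ⟩
  inst (inst (inst σ N • var) ∘ exts σ) M     ≡⟨ sym (inst-inst (inst σ N • var) (exts σ) M) ⟩
  inst (inst σ N • var) (inst (exts σ) M)     ≡⟨ sym ([0≔]-inst (inst (exts σ) M) (inst σ N)) ⟩
  inst (exts σ) M [0≔ inst σ N ]             ∎
  where open ≡-Reasoning

exts-[0≔] : ∀ σ M N → inst (exts σ) M [0≔ N ] ≡ inst (N • σ) M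
exts-[0≔] σ M N = trans ([0≔]-inst (inst (exts σ) M) N)
  (trans (inst-inst (N • var) (exts σ) M) (inst-cong (exts-• N σ) M))

ren-[0≔] : ∀ ρ M N → ren ρ (M [0≔ N ]) ≡ ren (ext ρ) M [0≔ ren ρ N ]
ren-[0≔] ρ M N = begin
  ren ρ (M [0≔ N ])                 ≡⟨ cong (ren ρ) ([0≔]-inst M N) ⟩
  ren ρ (inst (N • var) M)           ≡⟨ ren-inst ρ (N • var) M ⟩
  inst (ren ρ ∘ (N • var)) M         ≡⟨ inst-cong (λ { (bn zero) → refl ; (bn (suc i)) → refl ; (fn x L) → refl }) M ⟩
  inst ((ren ρ N • var) ∘ renName (ext ρ)) M ≡⟨ sym (inst-ren (ren ρ N • var) (ext ρ) M) ⟩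
  inst (ren ρ N • var) (ren (ext ρ) M) ≡⟨ sym ([0≔]-inst (ren (ext ρ) M) (ren ρ N)) ⟩
  ren (ext ρ) M [0≔ ren ρ N ]       ∎
  where open ≡-Reasoning

wk-[0≔] : ∀ M N → wk M [0≔ N ] ≡ M
wk-[0≔] M N = trans ([0≔]-inst (wk M) N) (trans (•-wk N var M) (inst-var M))

ext-wk-[0≔] : ∀ M → ren (ext suc) M [0≔ bv 0 ] ≡ M
ext-wk-[0≔] M = begin
  ren (ext suc) M [0≔ bv 0 ]         ≡⟨ [0≔]-inst (ren (ext suc) M) (bv 0) ⟩
  inst (bv 0 • var) (ren (ext suc) M) ≡⟨ inst-ren (bv 0 • var) (ext suc) M ⟩
  inst ((bv 0 • var) ∘ renName (ext suc)) M ≡⟨ inst-cong (λ { (bn zero) → refl ; (bn (suc i)) → refl ; (fn x L) → refl }) M ⟩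
  inst var M                          ≡⟨ inst-var M ⟩
  M                                  ∎
  where open ≡-Reasoning

wk-down : ∀ M → NotFree 0 M → wk (downAt 0 M) ≡ M
wk-down M nf = go 0 M nf
  where
  ext^ : ℕ → ℕ → ℕ
  ext^ zero    = suc
  ext^ (suc k) = ext (ext^ k)

  go-bv : ∀ k i → ¬ (i ≡ k) → ren (ext^ k) (downAt k (bv i)) ≡ bv i
  go-bv zero    zero    ne = ⊥-elim (ne refl)
  go-bv zero    (suc i) ne = refl
  go-bv (suc k) zero    ne = refl
  go-bv (suc k) (suc i) ne with i <ᵇ k in p | go-bv k i (ne ∘ cong suc)
  ... | true  | eq = cong wk eq
  ... | false | eq = lem k i p ne
    where
    lem : ∀ k i → (i <ᵇ k) ≡ false → ¬ (suc i ≡ suc k) → bv (ext (ext^ k) i) ≡ bv (suc i)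
    lem zero    zero    _ ne = ⊥-elim (ne refl)
    lem zero    (suc i) _ _  = refl
    lem (suc k) zero    () _
    lem (suc k) (suc i) p ne = cong wk (lem k i p (ne ∘ cong suc))

  go : ∀ k M → NotFree k M → ren (ext^ k) (downAt k M) ≡ M
  go k (fv x L)  nf       = refl
  go k (bv i)    ne       = go-bv k i ne
  go k (lam L M) nf       = cong (lam L) (go (suc k) M nf)
  go k (app M N) (p , q)  = cong₂ app (go k M p) (go k N q)

-- Instantiating index 0, here by `bv 0`, is a left inverse of `wk`.
wk-injective : ∀ {M N} → wk M ≡ wk N → M ≡ N
wk-injective {M} {N} eq = trans (sym (wk-[0≔] M (bv 0)))
  (trans (cong _[0≔ bv 0 ] eq) (wk-[0≔] N (bv 0)))

notFree-ren : ∀ {k k' ρ} → (∀ i → i ≡ k → ρ i ≡ k') → ∀ M → NotFree k' (ren ρ M) → NotFree k M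
notFree-ren h (fv x L)  nf      = tt
notFree-ren h (bv i)    nf      = λ eq → nf (h i eq)
notFree-ren h (lam L M) nf      =
  notFree-ren (λ { zero () ; (suc i) eq → cong suc (h i (ℕP.suc-injective eq)) }) M nf
notFree-ren h (app M N) (p , q) = notFree-ren h M p , notFree-ren h N q

ren-notFree : ∀ {k ρ} → (∀ i → ρ i ≢ k) → ∀ M → NotFree k (ren ρ M)
ren-notFree h (fv x L)  = tt
ren-notFree h (bv i)    = h i
ren-notFree h (lam L M) = ren-notFree (λ { zero () ; (suc i) eq → h i (ℕP.suc-injective eq) }) M
ren-notFree h (app M N) = ren-notFree h M , ren-notFree h N

down-wk : ∀ M → downAt 0 (wk M) ≡ M
down-wk M = wk-injective (wk-down (wk M) (ren-notFree (λ i ()) M))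

-- Degrees under renaming and substitution

LookupRen : List Index → List Index → (ℕ → ℕ) → Set
LookupRen Δ Δ' ρ = ∀ i → lookupD Δ' (ρ i) ≡ lookupD Δ i

ext-lookup : ∀ {Δ Δ' ρ L} → LookupRen Δ Δ' ρ → LookupRen (L ∷ Δ) (L ∷ Δ') (ext ρ)
ext-lookup h zero    = refl
ext-lookup h (suc i) = h i

deg-ren : ∀ {Δ Δ' ρ} → LookupRen Δ Δ' ρ → ∀ M → deg Δ' (ren ρ M) ≡ deg Δ M
deg-ren h (fv x L)  = refl
deg-ren h (bv i)    = h i
deg-ren h (lam L M) = deg-ren (ext-lookup h) M
deg-ren h (app M N) = deg-ren h M

deg-wk : ∀ {Δ L} M → deg (L ∷ Δ) (wk M) ≡ deg Δ M
deg-wk = deg-ren (λ i → refl)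

-- Imposed on all names, dangling indices included: `deg` is total on raw terms, with `lookupD`
-- defaulting to `[]`, so `deg-inst` can do without well-formedness.
DegSub : List Index → List Index → Subst → Set
DegSub Δ Δ' σ = ∀ n → deg Δ' (σ n) ≡ degN Δ n

exts-deg : ∀ {Δ Δ' σ L} → DegSub Δ Δ' σ → DegSub (L ∷ Δ) (L ∷ Δ') (exts σ)
exts-deg h (bn zero)    = refl
exts-deg {σ = σ} h (bn (suc i)) = trans (deg-wk (σ (bn i))) (h (bn i))
exts-deg {σ = σ} h (fn x L)     = trans (deg-wk (σ (fn x L))) (h (fn x L))

deg-inst : ∀ {Δ Δ' σ} → DegSub Δ Δ' σ → ∀ M → deg Δ' (inst σ M) ≡ deg Δ M
deg-inst h (fv x L)  = h (fn x L)
deg-inst h (bv i)    = h (bn i)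
deg-inst h (lam L M) = deg-inst (exts-deg h) M
deg-inst h (app M N) = deg-inst h M

•-deg : ∀ {Δ Δ' σ N L} → deg Δ' N ≡ L → DegSub Δ Δ' σ → DegSub (L ∷ Δ) Δ' (N • σ)
•-deg eq h (bn zero)    = eq
•-deg eq h (bn (suc i)) = h (bn i)
•-deg eq h (fn x L)     = h (fn x L)

deg-[0≔] : ∀ {Δ L} M N → deg Δ N ≡ L → deg Δ (M [0≔ N ]) ≡ deg (L ∷ Δ) M
deg-[0≔] {Δ} M N eq = trans (cong (deg Δ) ([0≔]-inst M N)) (deg-inst (•-deg eq (λ n → refl)) M)

-- Free variables and well-formedness

sameVar-spec : ∀ x L y K → ((x , L) ≡ (y , K) × sameVar x L y K ≡ true)
                         ⊎ ((x , L) ≢ (y , K) × sameVar x L y K ≡ false)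
sameVar-spec x L y K with x ≟V y | L ≟L K
... | yes refl | yes refl = inj₁ (refl , refl)
... | yes refl | no ne    = inj₂ ((λ { refl → ne refl }) , refl)
... | no ne    | _        = inj₂ ((λ { refl → ne refl }) , refl)

⪯-refl : ∀ {L} → L ⪯ L
⪯-refl {L} = [] , sym (LP.++-identityʳ L)

⪯-trans : ∀ {L K J} → L ⪯ K → K ⪯ J → L ⪯ J
⪯-trans {L} (A , refl) (B , refl) = A ++ B , LP.++-assoc L A B

fvs-ren : ∀ ρ M → fvs (ren ρ M) ≡ fvs M
fvs-ren ρ (fv x L)  = refl
fvs-ren ρ (bv i)    = refl
fvs-ren ρ (lam L M) = fvs-ren (ext ρ) M
fvs-ren ρ (app M N) = cong₂ _++_ (fvs-ren ρ M) (fvs-ren ρ N)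

◇-self : ∀ {Δ M} → WF Δ M → M ◇ M
◇-self (wf-fv x L) y K J (here refl) (here refl) = refl
◇-self (wf-bv i lt) y K J () _
◇-self (wf-lam w le) y K J p q = ◇-self w y K J p q
◇-self (wf-app {M} {N} w v le j) y K J p q with MP.∈-++⁻ (fvs M) p | MP.∈-++⁻ (fvs M) q
... | inj₁ p' | inj₁ q' = ◇-self w y K J p' q'
... | inj₁ p' | inj₂ q' = j y K J p' q'
... | inj₂ p' | inj₁ q' = sym (j y J K q' p')
... | inj₂ p' | inj₂ q' = ◇-self v y K J p' q'

-- Passing to an argument can only extend the degree. In the adequacy proof this shows that
-- unlifting loses no information about free indexes.
deg-⪯-fvs : ∀ {Δ M} → WF Δ M → ∀ {x K} → (x , K) ∈ fvs M → deg Δ M ⪯ K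
deg-⪯-fvs (wf-fv x L) (here refl) = ⪯-refl
deg-⪯-fvs (wf-bv i lt) ()
deg-⪯-fvs (wf-lam w le) p = deg-⪯-fvs w p
deg-⪯-fvs (wf-app {M} {N} w v le j) p with MP.∈-++⁻ (fvs M) p
... | inj₁ q = deg-⪯-fvs w q
... | inj₂ q = ⪯-trans le (deg-⪯-fvs v q)

WF-ren : ∀ {Δ Δ' ρ} → LookupRen Δ Δ' ρ → (∀ {i} → i < length Δ → ρ i < length Δ') →
         ∀ {M} → WF Δ M → WF Δ' (ren ρ M)
WF-ren h b (wf-fv x L) = wf-fv x L
WF-ren h b (wf-bv i lt) = wf-bv _ (b lt)
WF-ren {ρ = ρ} h b (wf-app {M} {N} w v le j) =
  wf-app (WF-ren h b w) (WF-ren h b v)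
    (subst₂ _⪯_ (sym (deg-ren h M)) (sym (deg-ren h N)) le)
    (λ x L K p q → j x L K (subst (_ ∈_) (fvs-ren ρ M) p) (subst (_ ∈_) (fvs-ren ρ N) q))
WF-ren h b (wf-lam {L} {M} w le) =
  wf-lam (WF-ren (ext-lookup h) (λ { {zero} _ → s≤s z≤n ; {suc i} (s≤s lt) → s≤s (b lt) }) w)
         (subst (_⪯ L) (sym (deg-ren (ext-lookup h) M)) le)

WF-ren⁻ : ∀ {Δ Δ' ρ} → LookupRen Δ Δ' ρ → (∀ {i} → ρ i < length Δ' → i < length Δ) →
          ∀ M → WF Δ' (ren ρ M) → WF Δ M
WF-ren⁻ h b (fv x L) w = wf-fv x L
WF-ren⁻ h b (bv i) (wf-bv _ lt) = wf-bv i (b lt)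
WF-ren⁻ {ρ = ρ} h b (app M N) (wf-app w v le j) =
  wf-app (WF-ren⁻ h b M w) (WF-ren⁻ h b N v)
    (subst₂ _⪯_ (deg-ren h M) (deg-ren h N) le)
    (λ x L K p q → j x L K (subst (_ ∈_) (sym (fvs-ren ρ M)) p) (subst (_ ∈_) (sym (fvs-ren ρ N)) q))
WF-ren⁻ h b (lam L M) (wf-lam w le) =
  wf-lam (WF-ren⁻ (ext-lookup h) (λ { {zero} _ → s≤s z≤n ; {suc i} (s≤s lt) → s≤s (b lt) }) M w)
         (subst (_⪯ L) (deg-ren (ext-lookup h) M) le)

VarSet : Set₁
VarSet = Var → Index → Set

FV⊆ : VarSet → Tm → Set
FV⊆ P M = ∀ x L → (x , L) ∈ fvs M → P x L

-- Well-formedness of an instantiated application needs its two sides to be joinable, which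
-- conditions on single images cannot give. So all free variables of the result are bounded by one
-- set `P'`; if `P'` is `Functional`, any two subterms of the result are joinable.
record GoodSubst (Δ Δ' : List Index) (P P' : VarSet) (σ : Subst) : Set where
  field
    degs : DegSub Δ Δ' σ
    free : ∀ x L → P x L → WF Δ' (σ (fn x L)) × FV⊆ P' (σ (fn x L))
    bnd  : ∀ i → i < length Δ → WF Δ' (σ (bn i)) × FV⊆ P' (σ (bn i))

open GoodSubst

good-exts : ∀ {Δ Δ' P P' σ L} → GoodSubst Δ Δ' P P' σ → GoodSubst (L ∷ Δ) (L ∷ Δ') P P' (exts σ)
good-exts {Δ' = Δ'} {P' = P'} {σ} {L} g = record
  { degs = exts-deg (degs g)
  ; free = λ x K p → weaken (free g x K p)
  ; bnd  = λ { zero _ → wf-bv zero (s≤s z≤n) , (λ _ _ ())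
             ; (suc i) (s≤s lt) → weaken (bnd g i lt) } }
  where
  weaken : ∀ {N} → WF Δ' N × FV⊆ P' N → WF (L ∷ Δ') (wk N) × FV⊆ P' (wk N)
  weaken {N} (w , f) = WF-ren (λ i → refl) s≤s w , λ x K p → f x K (subst (_ ∈_) (fvs-ren suc N) p)

inst-FV : ∀ {Δ Δ' P P' σ M} → GoodSubst Δ Δ' P P' σ → WF Δ M → FV⊆ P M → FV⊆ P' (inst σ M)
inst-FV g (wf-fv x L) f = proj₂ (free g x L (f x L (here refl)))
inst-FV g (wf-bv i lt) f = proj₂ (bnd g i lt)
inst-FV g (wf-lam w le) f = inst-FV (good-exts g) w f
inst-FV {σ = σ} g (wf-app {M} {N} w v le j) f x L p with MP.∈-++⁻ (fvs (inst σ M)) p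
... | inj₁ q = inst-FV g w (λ y K r → f y K (MP.∈-++⁺ˡ r)) x L q
... | inj₂ q = inst-FV g v (λ y K r → f y K (MP.∈-++⁺ʳ (fvs M) r)) x L q

Functional : VarSet → Set
Functional P = ∀ x L K → P x L → P x K → L ≡ K

WF-inst : ∀ {Δ Δ' P P' σ M} → GoodSubst Δ Δ' P P' σ → Functional P' → WF Δ M → FV⊆ P M →
          WF Δ' (inst σ M)
WF-inst g fun (wf-fv x L) f = proj₁ (free g x L (f x L (here refl)))
WF-inst g fun (wf-bv i lt) f = proj₁ (bnd g i lt)
WF-inst g fun (wf-lam {L} {M} w le) f =
  wf-lam (WF-inst (good-exts g) fun w f) (subst (_⪯ L) (sym (deg-inst (exts-deg (degs g)) M)) le)
WF-inst {σ = σ} g fun (wf-app {M} {N} w v le j) f =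
  wf-app (WF-inst g fun w fM) (WF-inst g fun v fN)
    (subst₂ _⪯_ (sym (deg-inst (degs g) M)) (sym (deg-inst (degs g) N)) le)
    (λ x L K p q → fun x L K (inst-FV g w fM x L p) (inst-FV g v fN x K q))
  where
  fM : FV⊆ _ M
  fM y K r = f y K (MP.∈-++⁺ˡ r)
  fN : FV⊆ _ N
  fN y K r = f y K (MP.∈-++⁺ʳ (fvs M) r)

inst-cong-WF : ∀ {Δ M σ τ} → WF Δ M → (∀ x L → (x , L) ∈ fvs M → σ (fn x L) ≡ τ (fn x L)) →
               (∀ i → i < length Δ → σ (bn i) ≡ τ (bn i)) → inst σ M ≡ inst τ M
inst-cong-WF (wf-fv x L) f b = f x L (here refl)
inst-cong-WF (wf-bv i lt) f b = b i lt
inst-cong-WF (wf-lam {L} w le) f b = cong (lam L) (inst-cong-WF w (λ x K p → cong wk (f x K p))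
  (λ { zero _ → refl ; (suc i) (s≤s lt) → cong wk (b i lt) }))
inst-cong-WF (wf-app {M} w v le j) f b = cong₂ app
  (inst-cong-WF w (λ x K p → f x K (MP.∈-++⁺ˡ p)) b)
  (inst-cong-WF v (λ x K p → f x K (MP.∈-++⁺ʳ (fvs M) p)) b)

-- Abstracting a named variable

closing : ℕ → Var → Index → Subst
closing k x L (bn i)   = bv i
closing k x L (fn y K) = if sameVar x L y K then bv k else fv y K

closeAt-inst : ∀ k x L M → closeAt k x L M ≡ inst (closing k x L) M
closeAt-inst k x L (fv y K)  = refl
closeAt-inst k x L (bv i)    = refl
closeAt-inst k x L (lam J M) = cong (lam J) (trans (closeAt-inst (suc k) x L M) (inst-cong under M))
  where
  under : ∀ n → closing (suc k) x L n ≡ exts (closing k x L) n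
  under (bn zero)    = refl
  under (bn (suc i)) = refl
  under (fn y K) with sameVar x L y K
  ... | true  = refl
  ... | false = refl
closeAt-inst k x L (app M N) = cong₂ app (closeAt-inst k x L M) (closeAt-inst k x L N)

-- On terms without dangling indices this agrees with closeAt 0 x L, and it
-- respects degrees on all names.
close : Var → Index → Subst
close x L (bn i)   = bv (suc i)
close x L (fn y K) = closing 0 x L (fn y K)

close-deg : ∀ {Δ} x L → DegSub Δ (L ∷ Δ) (close x L)
close-deg x L (bn i)   = refl
close-deg x L (fn y K) with sameVar-spec x L y K
... | inj₁ (refl , eq) rewrite eq = refl
... | inj₂ (_ , eq) rewrite eq = refl

closeAt-close : ∀ {x L M} → Term M → closeAt 0 x L M ≡ inst (close x L) M
closeAt-close {x} {L} {M} w =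
  trans (closeAt-inst 0 x L M) (inst-cong-WF w (λ _ _ _ → refl) (λ i ()))

deg-ƛ : ∀ {x L M} → Term M → d (ƛ x L M) ≡ d M
deg-ƛ {x} {L} {M} w = trans (cong (deg (L ∷ [])) (closeAt-close {x} {L} w)) (deg-inst (close-deg x L) M)

closing-same : ∀ k x L → closing k x L (fn x L) ≡ bv k
closing-same k x L with sameVar-spec x L x L
... | inj₁ (_ , eq) rewrite eq = refl
... | inj₂ (ne , _) = ⊥-elim (ne refl)

closing-other : ∀ k {x L y K} → (x , L) ≢ (y , K) → closing k x L (fn y K) ≡ fv y K
closing-other k {x} {L} {y} {K} ne with sameVar-spec x L y K
... | inj₁ (eq , _) = ⊥-elim (ne eq)
... | inj₂ (_ , eq) rewrite eq = refl

close-open : ∀ {x L M} → WF (L ∷ []) M → ¬ (x , L) ∈ fvs M → closeAt 0 x L (M [0≔ fv x L ]) ≡ M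
close-open {x} {L} {M} w fresh = begin
  closeAt 0 x L (M [0≔ fv x L ])                     ≡⟨ closeAt-inst 0 x L (M [0≔ fv x L ]) ⟩
  inst (closing 0 x L) (M [0≔ fv x L ])              ≡⟨ cong (inst (closing 0 x L)) ([0≔]-inst M (fv x L)) ⟩
  inst (closing 0 x L) (inst (fv x L • var) M)       ≡⟨ inst-inst (closing 0 x L) (fv x L • var) M ⟩
  inst (inst (closing 0 x L) ∘ (fv x L • var)) M     ≡⟨ inst-cong-WF w
        (λ y K p → closing-other 0 {x} {L} {y} {K} (λ { refl → fresh p }))
        (λ { zero _ → closing-same 0 x L ; (suc i) (s≤s ()) }) ⟩
  inst var M                                         ≡⟨ inst-var M ⟩
  M                                                  ∎
  where open ≡-Reasoning

-- Fresh names

varId : Var → ℕ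
varId (v₁ n) = n
varId (v₂ n) = n

nameBound : Tm → ℕ
nameBound (fv x L)  = suc (varId x)
nameBound (bv i)    = 0
nameBound (lam L M) = nameBound M
nameBound (app M N) = nameBound M ⊔ nameBound N

nameBound-fvs : ∀ M {x K} → (x , K) ∈ fvs M → varId x < nameBound M
nameBound-fvs (fv x L) (here refl) = ℕP.≤-refl
nameBound-fvs (lam L M) p = nameBound-fvs M p
nameBound-fvs (app M N) p with MP.∈-++⁻ (fvs M) p
... | inj₁ q = ℕP.≤-trans (nameBound-fvs M q) (ℕP.m≤m⊔n (nameBound M) (nameBound N))
... | inj₂ q = ℕP.≤-trans (nameBound-fvs N q) (ℕP.m≤n⊔m (nameBound M) (nameBound N))

-- Freshness concerns the name at every index `K` at once, because joinability forbids the same name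
-- at two indexes.
fresh-var : ∀ M {x K} → nameBound M ≤ varId x → ¬ (x , K) ∈ fvs M
fresh-var M le p = ℕP.<⇒≱ (nameBound-fvs M p) le

-- Reduction preserves well-formedness and degrees

Preserves : (List Index → Tm → Tm → Set) → Set
Preserves R = ∀ {Δ M N} → R Δ M N → WF Δ M → WF Δ N × deg Δ N ≡ deg Δ M × fvs N ⊆ fvs M

-- The free variables of the contractum occur in the redex, and these form a functional set by
-- `◇-self` applied to the redex itself.
WF-[0≔] : ∀ {Δ L M N} → WF Δ (app (lam L M) N) → deg Δ N ≡ L →
          WF Δ (M [0≔ N ]) × fvs (M [0≔ N ]) ⊆ fvs (app (lam L M) N)
WF-[0≔] {Δ} {L} {M} {N} w@(wf-app (wf-lam wM _) wN _ _) eq rewrite [0≔]-inst M N =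
    WF-inst good (◇-self w) wM fM
  , λ {(x , K)} p → inst-FV good wM fM x K p
  where
  P : VarSet
  P x K = (x , K) ∈ fvs (app (lam L M) N)
  fM : FV⊆ P M
  fM x K p = MP.∈-++⁺ˡ p
  good : GoodSubst (L ∷ Δ) Δ P P (N • var)
  good = record
    { degs = •-deg eq (λ n → refl)
    ; free = λ x K p → wf-fv x K , λ { _ _ (here refl) → p }
    ; bnd  = λ { zero _ → wN , (λ x K p → MP.∈-++⁺ʳ (fvs M) p)
               ; (suc i) (s≤s lt) → wf-bv i lt , (λ _ _ ()) } }

β-preserves : Preserves βroot
β-preserves (β {L} {M} {N} eq) w with WF-[0≔] w eq
... | w' , sub' = w' , deg-[0≔] M N eq , sub'

η-preserves : Preserves ηroot
η-preserves {Δ} (η {L} {M} nf) (wf-lam (wf-app w _ _ _) _) = wD , degD , fvsD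
  where
  eq : wk (downAt 0 M) ≡ M
  eq = wk-down M nf
  wD : WF Δ (downAt 0 M)
  wD = WF-ren⁻ (λ i → refl) (λ { (s≤s lt) → lt }) (downAt 0 M) (subst (WF (L ∷ Δ)) (sym eq) w)
  degD : deg Δ (downAt 0 M) ≡ deg (L ∷ Δ) M
  degD = trans (sym (deg-wk (downAt 0 M))) (cong (deg (L ∷ Δ)) eq)
  fvsD : fvs (downAt 0 M) ⊆ fvs M ++ []
  fvsD p = MP.∈-++⁺ˡ (subst (_ ∈_) (trans (sym (fvs-ren suc (downAt 0 M))) (cong fvs eq)) p)

compat-preserves : ∀ {R} → Preserves R → Preserves (Compat R)
compat-preserves h (root r) w = h r w
compat-preserves h (appL {M} {M'} {N} s) (wf-app w v le j) with compat-preserves h s w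
... | w' , dg , sb = wf-app w' v (subst (_⪯ _) (sym dg) le) (λ x L K p q → j x L K (sb p) q) , dg
                   , λ p → [ (λ q → MP.∈-++⁺ˡ (sb q)) , MP.∈-++⁺ʳ (fvs M) ]′ (MP.∈-++⁻ (fvs M') p)
compat-preserves h (appR {M} {N} {N'} s) (wf-app w v le j) with compat-preserves h s v
... | v' , dg , sb = wf-app w v' (subst (_ ⪯_) (sym dg) le) (λ x L K p q → j x L K p (sb q)) , refl
                   , λ p → [ MP.∈-++⁺ˡ , (λ q → MP.∈-++⁺ʳ (fvs M) (sb q)) ]′ (MP.∈-++⁻ (fvs M) p)
compat-preserves h (lamC {L} s) (wf-lam w le) with compat-preserves h s w
... | w' , dg , sb = wf-lam w' (subst (_⪯ L) (sym dg) le) , dg , sb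

head-compat : ∀ {M N} → HeadRed M N → Compat βroot [] M N
head-compat (hβ eq)  = root (β eq)
head-compat (happ s) = appL (head-compat s)

raw-preserves : ∀ r {M N} → Raw r M N → Term M → Term N × d N ≡ d M × fvs N ⊆ fvs M
raw-preserves βk  s        = compat-preserves β-preserves s
raw-preserves βηk (inj₁ s) = compat-preserves β-preserves s
raw-preserves βηk (inj₂ s) = compat-preserves η-preserves s
raw-preserves hk  s        = compat-preserves β-preserves (head-compat s)

star-preserves : ∀ {r M N} → M ▷*[ r ] N → d N ≡ d M × fvs N ⊆ fvs M
star-preserves done = refl , id
star-preserves {r} ((w , _ , s) ◅ ss) with raw-preserves r s w | star-preserves ss
... | _ , dg , sb | dg' , sb' = trans dg' dg , sb ∘ sb'

star-term : ∀ {r M N} → Term M → M ▷*[ r ] N → Term N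
star-term w done              = w
star-term w ((_ , v , _) ◅ ss) = star-term v ss

-- Acting on indexes

mapI : (Index → Index) → Tm → Tm
mapI φ (fv x L)  = fv x (φ L)
mapI φ (bv i)    = bv i
mapI φ (lam L M) = lam (φ L) (mapI φ M)
mapI φ (app M N) = app (mapI φ M) (mapI φ N)

lift-mapI : ∀ i M → lift i M ≡ mapI (i ∷_) M
lift-mapI i (fv x L)  = refl
lift-mapI i (bv k)    = refl
lift-mapI i (lam L M) = cong (lam _) (lift-mapI i M)
lift-mapI i (app M N) = cong₂ app (lift-mapI i M) (lift-mapI i N)

mapI-mapI : ∀ φ ψ M → mapI φ (mapI ψ M) ≡ mapI (φ ∘ ψ) M
mapI-mapI φ ψ (fv x L)  = refl
mapI-mapI φ ψ (bv i)    = refl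
mapI-mapI φ ψ (lam L M) = cong (lam _) (mapI-mapI φ ψ M)
mapI-mapI φ ψ (app M N) = cong₂ app (mapI-mapI φ ψ M) (mapI-mapI φ ψ N)

mapI-cong : ∀ {φ ψ} → (∀ L → φ L ≡ ψ L) → ∀ M → mapI φ M ≡ mapI ψ M
mapI-cong eq (fv x L)  = cong (fv x) (eq L)
mapI-cong eq (bv i)    = refl
mapI-cong eq (lam L M) = cong₂ lam (eq L) (mapI-cong eq M)
mapI-cong eq (app M N) = cong₂ app (mapI-cong eq M) (mapI-cong eq N)

mapI-id : ∀ M → mapI id M ≡ M
mapI-id (fv x L)  = refl
mapI-id (bv i)    = refl
mapI-id (lam L M) = cong (lam L) (mapI-id M)
mapI-id (app M N) = cong₂ app (mapI-id M) (mapI-id N)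

lookupD-map : ∀ φ Δ {i} → i < length Δ → lookupD (map φ Δ) i ≡ φ (lookupD Δ i)
lookupD-map φ (L ∷ Δ) {zero}  _        = refl
lookupD-map φ (L ∷ Δ) {suc i} (s≤s lt) = lookupD-map φ Δ lt

-- Well-formedness matters at `bv`: a dangling index has the default degree `[]`, which `φ` need not
-- fix.
deg-mapI : ∀ φ {Δ M} → WF Δ M → deg (map φ Δ) (mapI φ M) ≡ φ (deg Δ M)
deg-mapI φ (wf-fv x L)       = refl
deg-mapI φ {Δ} (wf-bv i lt)  = lookupD-map φ Δ lt
deg-mapI φ (wf-app w v le j) = deg-mapI φ w
deg-mapI φ (wf-lam w le)     = deg-mapI φ w

∈-mapI⁺ : ∀ φ M {x L} → (x , L) ∈ fvs M → (x , φ L) ∈ fvs (mapI φ M)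
∈-mapI⁺ φ (fv x L) (here refl) = here refl
∈-mapI⁺ φ (lam L M) p = ∈-mapI⁺ φ M p
∈-mapI⁺ φ (app M N) p with MP.∈-++⁻ (fvs M) p
... | inj₁ q = MP.∈-++⁺ˡ (∈-mapI⁺ φ M q)
... | inj₂ q = MP.∈-++⁺ʳ (fvs (mapI φ M)) (∈-mapI⁺ φ N q)

∈-mapI⁻ : ∀ φ M {x K} → (x , K) ∈ fvs (mapI φ M) → Σ Index λ L → K ≡ φ L × (x , L) ∈ fvs M
∈-mapI⁻ φ (fv x L) (here refl) = L , refl , here refl
∈-mapI⁻ φ (lam L M) p = ∈-mapI⁻ φ M p
∈-mapI⁻ φ (app M N) p with MP.∈-++⁻ (fvs (mapI φ M)) p
... | inj₁ q = let (L , eq , r) = ∈-mapI⁻ φ M q in L , eq , MP.∈-++⁺ˡ r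
... | inj₂ q = let (L , eq , r) = ∈-mapI⁻ φ N q in L , eq , MP.∈-++⁺ʳ (fvs M) r

◇-mapI : ∀ φ M N → M ◇ N → mapI φ M ◇ mapI φ N
◇-mapI φ M N j x L K p q with ∈-mapI⁻ φ M p | ∈-mapI⁻ φ N q
... | L' , refl , p' | K' , refl , q' = cong φ (j x L' K' p' q')

Mono : (Index → Index) → Set
Mono φ = ∀ {L K} → L ⪯ K → φ L ⪯ φ K

WF-mapI : ∀ {φ} → Mono φ → ∀ {Δ M} → WF Δ M → WF (map φ Δ) (mapI φ M)
WF-mapI mono (wf-fv x L) = wf-fv x _
WF-mapI {φ} mono {Δ} (wf-bv i lt) = wf-bv i (subst (i <_) (sym (LP.length-map φ Δ)) lt)
WF-mapI {φ} mono (wf-app {M} {N} w v le j) = wf-app (WF-mapI mono w) (WF-mapI mono v)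
  (subst₂ _⪯_ (sym (deg-mapI φ w)) (sym (deg-mapI φ v)) (mono le)) (◇-mapI φ M N j)
WF-mapI {φ} mono (wf-lam w le) = wf-lam (WF-mapI mono w) (subst (_⪯ _) (sym (deg-mapI φ w)) (mono le))

shift-mapI : ∀ φ n c M → mapI φ (shift n c M) ≡ shift n c (mapI φ M)
shift-mapI φ n c (fv x L)  = refl
shift-mapI φ n c (bv i) with i <ᵇ c
... | true  = refl
... | false = refl
shift-mapI φ n c (lam L M) = cong (lam _) (shift-mapI φ n (suc c) M)
shift-mapI φ n c (app M N) = cong₂ app (shift-mapI φ n c M) (shift-mapI φ n c N)

substAt-mapI : ∀ φ k N M → mapI φ (substAt k N M) ≡ substAt k (mapI φ N) (mapI φ M)
substAt-mapI φ k N (fv x L)  = refl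
substAt-mapI φ k N (bv i) with i <ᵇ k | i ≡ᵇ k
... | true  | _     = refl
... | false | true  = shift-mapI φ k 0 N
... | false | false = refl
substAt-mapI φ k N (lam L M) = cong (lam _) (substAt-mapI φ (suc k) N M)
substAt-mapI φ k N (app M P) = cong₂ app (substAt-mapI φ k N M) (substAt-mapI φ k N P)

downAt-mapI : ∀ φ c M → mapI φ (downAt c M) ≡ downAt c (mapI φ M)
downAt-mapI φ c (fv x L)  = refl
downAt-mapI φ c (bv i) with i <ᵇ c
... | true  = refl
... | false = refl
downAt-mapI φ c (lam L M) = cong (lam _) (downAt-mapI φ (suc c) M)
downAt-mapI φ c (app M N) = cong₂ app (downAt-mapI φ c M) (downAt-mapI φ c N)

notFree-mapI : ∀ φ c M → NotFree c M → NotFree c (mapI φ M)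
notFree-mapI φ c (fv x L)  nf      = tt
notFree-mapI φ c (bv i)    nf      = nf
notFree-mapI φ c (lam L M) nf      = notFree-mapI φ (suc c) M nf
notFree-mapI φ c (app M N) (p , q) = notFree-mapI φ c M p , notFree-mapI φ c N q

MapsTo : (Index → Index) → (List Index → Tm → Tm → Set) → Set
MapsTo φ R = ∀ {Δ M N} → WF Δ M → R Δ M N → R (map φ Δ) (mapI φ M) (mapI φ N)

β-mapI : ∀ φ → MapsTo φ βroot
β-mapI φ (wf-app _ w _ _) (β {L} {M} {N} eq) =
  subst (βroot _ _) (sym (substAt-mapI φ 0 N M)) (β (trans (deg-mapI φ w) (cong φ eq)))

η-mapI : ∀ φ → MapsTo φ ηroot
η-mapI φ w (η {L} {M} nf) =
  subst (ηroot _ _) (sym (downAt-mapI φ 0 M)) (η (notFree-mapI φ 0 M nf))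

compat-mapI : ∀ {φ R} → MapsTo φ R → MapsTo φ (Compat R)
compat-mapI h w                 (root r) = root (h w r)
compat-mapI h (wf-app w _ _ _)  (appL s) = appL (compat-mapI h w s)
compat-mapI h (wf-app _ w _ _)  (appR s) = appR (compat-mapI h w s)
compat-mapI h (wf-lam w _)      (lamC s) = lamC (compat-mapI h w s)

head-mapI : ∀ φ {M N} → Term M → HeadRed M N → HeadRed (mapI φ M) (mapI φ N)
head-mapI φ (wf-app _ w _ _) (hβ {L} {M} {N} eq) =
  subst (HeadRed _) (sym (substAt-mapI φ 0 N M)) (hβ (trans (deg-mapI φ w) (cong φ eq)))
head-mapI φ (wf-app w _ _ _) (happ s) = happ (head-mapI φ w s)

raw-mapI : ∀ φ r {M N} → Term M → Raw r M N → Raw r (mapI φ M) (mapI φ N)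
raw-mapI φ βk  w s        = compat-mapI (β-mapI φ) w s
raw-mapI φ βηk w (inj₁ s) = inj₁ (compat-mapI (β-mapI φ) w s)
raw-mapI φ βηk w (inj₂ s) = inj₂ (compat-mapI (η-mapI φ) w s)
raw-mapI φ hk  w s        = head-mapI φ w s

star-mapI : ∀ {φ} → Mono φ → ∀ {r M N} → M ▷*[ r ] N → mapI φ M ▷*[ r ] mapI φ N
star-mapI mono done = done
star-mapI {φ} mono {r} ((w , v , s) ◅ ss) =
  (WF-mapI mono w , WF-mapI mono v , raw-mapI φ r w s) ◅ star-mapI mono ss

cons-mono : ∀ i → Mono (i ∷_)
cons-mono i (A , refl) = A , refl

++-mono : ∀ L → Mono (L ++_)
++-mono L {K} (A , refl) = A , sym (LP.++-assoc L K A)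

drop-mono : ∀ n → Mono (drop n)
drop-mono zero    le                       = le
drop-mono (suc n) {[]}    {K} _            = drop (suc n) K , refl
drop-mono (suc n) {i ∷ L} {.i ∷ K} (A , refl) = drop-mono n {L} (A , refl)

-- Indexes that do not start with L lose their first length L entries, too.
unlift : Index → Tm → Tm
unlift L = mapI (drop (length L))

lift* : Index → Tm → Tm
lift* L = mapI (L ++_)

drop-++ : ∀ (L K : Index) → drop (length L) (L ++ K) ≡ K
drop-++ []      K = refl
drop-++ (i ∷ L) K = drop-++ L K

unlift-lift* : ∀ L M → unlift L (lift* L M) ≡ M
unlift-lift* L M = trans (mapI-mapI _ _ M) (trans (mapI-cong (drop-++ L) M) (mapI-id M))

-- The prefix `L` spreads from the degree to every index in the term, since in a well-formed term
-- the degrees of arguments and the indexes of binders extend the degree of the whole. Hence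
-- dropping `length L` entries is reversible.
lift*-unlift : ∀ L {Δ M} → WF Δ M → L ⪯ deg Δ M → lift* L (unlift L M) ≡ M
lift*-unlift L w le = trans (mapI-mapI _ _ _) (go w le)
  where
  prefix : ∀ {K} → L ⪯ K → L ++ drop (length L) K ≡ K
  prefix (A , refl) = cong (L ++_) (drop-++ L A)
  go : ∀ {Δ M} → WF Δ M → L ⪯ deg Δ M → mapI ((L ++_) ∘ drop (length L)) M ≡ M
  go (wf-fv x K) le = cong (fv x) (prefix le)
  go (wf-bv i _) le = refl
  go (wf-app w v le j) le' = cong₂ app (go w le') (go v (⪯-trans le' le))
  go (wf-lam w le) le' = cong₂ lam (prefix (⪯-trans le' le)) (go w le')

unlift-++ : ∀ L K M → unlift (L ++ K) M ≡ unlift K (unlift L M)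
unlift-++ L K M = trans (mapI-cong (dd L) M) (sym (mapI-mapI _ _ M))
  where
  dd : ∀ (L : Index) J → drop (length (L ++ K)) J ≡ drop (length K) (drop (length L) J)
  dd []      J       = refl
  dd (i ∷ L) []      = sym (drop-[] (length K))
    where
    drop-[] : ∀ n → drop n [] ≡ ([] {A = ℕ})
    drop-[] zero    = refl
    drop-[] (suc n) = refl
  dd (i ∷ L) (_ ∷ J) = dd L J

unlift-𝓜 : ∀ {L K M} → 𝓜^ (L ++ K) M → 𝓜^ K (unlift L M)
unlift-𝓜 {L} {K} (w , eq) = WF-mapI (drop-mono (length L)) w
  , trans (deg-mapI _ w) (trans (cong (drop (length L)) eq) (drop-++ L K))

lift*-𝓜 : ∀ {L K M} → 𝓜^ K M → 𝓜^ (L ++ K) (lift* L M)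
lift*-𝓜 {L} (w , eq) = WF-mapI (++-mono L) w , trans (deg-mapI _ w) (cong (L ++_) eq)

lift-𝓜 : ∀ {i L M} → 𝓜^ L M → 𝓜^ (i ∷ L) (lift i M)
lift-𝓜 {i} {L} {M} m = subst (𝓜^ (i ∷ L)) (sym (lift-mapI i M)) (lift*-𝓜 {i ∷ []} m)

lift-unlift : ∀ {i L M} → 𝓜^ (i ∷ L) M → M ≡ lift i (unlift (i ∷ []) M)
lift-unlift {i} {L} {M} (w , eq) = sym (trans (lift-mapI i _)
  (lift*-unlift (i ∷ []) w (L , eq)))

unlift-lift : ∀ i M → unlift (i ∷ []) (lift i M) ≡ M
unlift-lift i M = trans (cong (unlift (i ∷ [])) (lift-mapI i M)) (unlift-lift* (i ∷ []) M)

-- Types as lists of conjuncts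

-- Modulo ≈, a type U of degree L is ē_L (T₁ ⊓ ... ⊓ Tₙ) with T₁, ..., Tₙ the
-- conjuncts of U.
conj : ∀ {L} → 𝕌 L → List 𝕋
conj (ty T)  = T ∷ []
conj (ω L)   = []
conj (U ⊓ V) = conj U ++ conj V
conj (ē i U) = conj U

⋂ : List 𝕋 → 𝕌 []
⋂ []       = ω []
⋂ (T ∷ Ts) = ty T ⊓ ⋂ Ts

ē* : ∀ L → 𝕌 [] → 𝕌 L
ē* []      U = U
ē* (i ∷ L) U = ē i (ē* L U)

conj-⋂ : ∀ Ts → conj (⋂ Ts) ≡ Ts
conj-⋂ []       = refl
conj-⋂ (T ∷ Ts) = cong (T ∷_) (conj-⋂ Ts)

conj-ē* : ∀ L U → conj (ē* L U) ≡ conj U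
conj-ē* []      U = refl
conj-ē* (i ∷ L) U = conj-ē* L U

conj-ē*⋂ : ∀ L Ts → conj (ē* L (⋂ Ts)) ≡ Ts
conj-ē*⋂ L Ts = trans (conj-ē* L (⋂ Ts)) (conj-⋂ Ts)

ē*-cong : ∀ L {U V} → U ≈ V → ē* L U ≈ ē* L V
ē*-cong []      eq = eq
ē*-cong (i ∷ L) eq = ē-cong (ē*-cong L eq)

ē*-mono : ∀ L {U V} → U ⊑ V → ē* L U ⊑ ē* L V
ē*-mono []      le = le
ē*-mono (i ∷ L) le = ē-mono (ē*-mono L le)

ē*-⊓ : ∀ L {U V} → ē* L (U ⊓ V) ≈ (ē* L U ⊓ ē* L V)
ē*-⊓ []      = ≈-refl
ē*-⊓ (i ∷ L) = ≈-trans (ē-cong (ē*-⊓ L)) ē-⊓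

ē*-ω : ∀ L → ē* L (ω []) ≈ ω L
ē*-ω []      = ≈-refl
ē*-ω (i ∷ L) = ≈-trans (ē-cong (ē*-ω L)) ē-ω

⋂-++ : ∀ Ts Ts' → ⋂ (Ts ++ Ts') ≈ (⋂ Ts ⊓ ⋂ Ts')
⋂-++ []       Ts' = ≈-sym ω-unit
⋂-++ (T ∷ Ts) Ts' = ≈-trans (⊓-cong ≈-refl (⋂-++ Ts Ts')) (≈-sym ⊓-assoc)

normal-form : ∀ {L} (U : 𝕌 L) → U ≈ ē* L (⋂ (conj U))
normal-form (ty T)  = ≈-trans (≈-sym ω-unit) ⊓-comm
normal-form (ω L)   = ≈-sym (ē*-ω L)
normal-form {L} (U ⊓ V) = ≈-trans (⊓-cong (normal-form U) (normal-form V))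
  (≈-trans (≈-sym (ē*-⊓ L)) (ē*-cong L (≈-sym (⋂-++ (conj U) (conj V)))))
normal-form (ē i U) = ē-cong (normal-form U)

-- Subtyping on conjuncts

mutual
  -- Subtyping with neither transitivity nor equations, hence open to inversion: on lists of
  -- conjuncts the laws of ⊓, ω and ē hold by construction. Arrows are comparable only when their
  -- domains have the same degree, which the lists do not record.
  data _≤T_ : 𝕋 → 𝕋 → Set where
    atom≤ : ∀ {a} → atom a ≤T atom a
    ⇒≤    : ∀ {L} {U V : 𝕌 L} {S T} → conj V ≤L conj U → S ≤T T → (U ⇒ S) ≤T (V ⇒ T)

  _≤L_ : List 𝕋 → List 𝕋 → Set
  Ss ≤L Ts = All (λ T → Any (_≤T T) Ss) Ts

mutual
  ≤T-refl : ∀ {T} → T ≤T T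
  ≤T-refl {atom a} = atom≤
  ≤T-refl {U ⇒ T}  = ⇒≤ (conj-≤-refl U) ≤T-refl

  conj-≤-refl : ∀ {L} (U : 𝕌 L) → conj U ≤L conj U
  conj-≤-refl (ty T)  = here ≤T-refl ∷ []
  conj-≤-refl (ω L)   = []
  conj-≤-refl (U ⊓ V) = AllP.++⁺ (All.map AnyP.++⁺ˡ (conj-≤-refl U))
                                 (All.map (AnyP.++⁺ʳ (conj U)) (conj-≤-refl V))
  conj-≤-refl (ē i U) = conj-≤-refl U

⊆⇒≤L : ∀ {Ss Ts} → Ts ⊆ Ss → Ss ≤L Ts
⊆⇒≤L sb = All.tabulate (λ p → Any.map (λ { refl → ≤T-refl }) (sb p))

≤L-refl : ∀ {Ts} → Ts ≤L Ts
≤L-refl = ⊆⇒≤L id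

mutual
  ≤T-trans : ∀ {R S T} → R ≤T S → S ≤T T → R ≤T T
  ≤T-trans atom≤    q          = q
  ≤T-trans (⇒≤ p q) (⇒≤ p' q') = ⇒≤ (≤L-trans p' p) (≤T-trans q q')

  ≤L-trans : ∀ {Rs Ss Ts} → Rs ≤L Ss → Ss ≤L Ts → Rs ≤L Ts
  ≤L-trans p []       = []
  ≤L-trans p (q ∷ qs) = ≤L-Any p q ∷ ≤L-trans p qs

  ≤L-Any : ∀ {Rs Ss T} → Rs ≤L Ss → Any (_≤T T) Ss → Any (_≤T T) Rs
  ≤L-Any (p ∷ ps) (here q)  = Any-≤T p q
  ≤L-Any (p ∷ ps) (there q) = ≤L-Any ps q

  Any-≤T : ∀ {Rs S T} → Any (_≤T S) Rs → S ≤T T → Any (_≤T T) Rs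
  Any-≤T (here p)  q = here (≤T-trans p q)
  Any-≤T (there p) q = there (Any-≤T p q)

≤L-++ : ∀ {Rs Ss Rs' Ss'} → Rs ≤L Rs' → Ss ≤L Ss' → (Rs ++ Ss) ≤L (Rs' ++ Ss')
≤L-++ {Rs} p q = AllP.++⁺ (All.map AnyP.++⁺ˡ p) (All.map (AnyP.++⁺ʳ Rs) q)

mutual
  ≈T-sound : ∀ {S T} → S ≈T T → S ≤T T × T ≤T S
  ≈T-sound ≈T-refl = ≤T-refl , ≤T-refl
  ≈T-sound (≈T-sym p) = let (a , b) = ≈T-sound p in b , a
  ≈T-sound (≈T-trans p q) = let (a , b) = ≈T-sound p ; (a' , b') = ≈T-sound q in
    ≤T-trans a a' , ≤T-trans b' b
  ≈T-sound (⇒-cong p q) = let (a , b) = ≈-sound p ; (a' , b') = ≈T-sound q in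
    ⇒≤ b a' , ⇒≤ a b'

  ≈-sound : ∀ {L} {U V : 𝕌 L} → U ≈ V → conj U ≤L conj V × conj V ≤L conj U
  ≈-sound ≈-refl = ≤L-refl , ≤L-refl
  ≈-sound (≈-sym p) = let (a , b) = ≈-sound p in b , a
  ≈-sound (≈-trans p q) = let (a , b) = ≈-sound p ; (a' , b') = ≈-sound q in
    ≤L-trans a a' , ≤L-trans b' b
  ≈-sound (ty-cong p) = let (a , b) = ≈T-sound p in here a ∷ [] , here b ∷ []
  ≈-sound (⊓-cong p q) = let (a , b) = ≈-sound p ; (a' , b') = ≈-sound q in
    ≤L-++ a a' , ≤L-++ b b'
  ≈-sound (ē-cong p) = ≈-sound p
  ≈-sound (⊓-comm {U = U} {V}) = ⊆⇒≤L (swap (conj V) (conj U)) , ⊆⇒≤L (swap (conj U) (conj V))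
    where
    swap : ∀ (Ss Ts : List 𝕋) → Ss ++ Ts ⊆ Ts ++ Ss
    swap Ss Ts p = [ MP.∈-++⁺ʳ Ts , MP.∈-++⁺ˡ ]′ (MP.∈-++⁻ Ss p)
  ≈-sound (⊓-assoc {U = U} {V} {W}) rewrite LP.++-assoc (conj U) (conj V) (conj W) = ≤L-refl , ≤L-refl
  ≈-sound (⊓-idem {U = U}) =
    ⊆⇒≤L MP.∈-++⁺ˡ , ⊆⇒≤L (λ p → [ id , id ]′ (MP.∈-++⁻ (conj U) p))
  ≈-sound ē-⊓ = ≤L-refl , ≤L-refl
  ≈-sound ω-unit = ≤L-refl , ≤L-refl
  ≈-sound ē-ω = ≤L-refl , ≤L-refl

⊑-sound : ∀ {L} {U V : 𝕌 L} → U ⊑ V → conj U ≤L conj V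
⊑-sound (⊑-refl p)    = proj₁ (≈-sound p)
⊑-sound (⊑-trans p q) = ≤L-trans (⊑-sound p) (⊑-sound q)
⊑-sound ⊓-lb          = ⊆⇒≤L MP.∈-++⁺ˡ
⊑-sound (⊓-mono p q)  = ≤L-++ (⊑-sound p) (⊑-sound q)
⊑-sound (⇒-mono p q)  with ⊑-sound q
... | here r ∷ [] = here (⇒≤ (⊑-sound p) r) ∷ []
⊑-sound (ē-mono p)    = ⊑-sound p

⊑-ω : ∀ {L} {U : 𝕌 L} → U ⊑ ω L
⊑-ω = ⊑-trans (⊑-refl (≈-sym ω-unit)) ⊓-lb

⊓-lb₂ : ∀ {L} {U V : 𝕌 L} → (U ⊓ V) ⊑ V
⊓-lb₂ = ⊑-trans (⊑-refl ⊓-comm) ⊓-lb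

⊓-glb : ∀ {L} {U V W : 𝕌 L} → U ⊑ V → U ⊑ W → U ⊑ (V ⊓ W)
⊓-glb p q = ⊑-trans (⊑-refl (≈-sym ⊓-idem)) (⊓-mono p q)

mutual
  ≤T-complete : ∀ {S T} → S ≤T T → ty S ⊑ ty T
  ≤T-complete atom≤ = ⊑-refl ≈-refl
  ≤T-complete (⇒≤ {L} {U} {V} p q) = ⇒-mono
    -- `≤L-complete` speaks of degree `[]`; normal forms carry it to degree `L`.
    (⊑-trans (⊑-refl (normal-form V)) (⊑-trans (ē*-mono L (≤L-complete p)) (⊑-refl (≈-sym (normal-form U)))))
    (≤T-complete q)

  ≤L-complete : ∀ {Ss Ts} → Ss ≤L Ts → ⋂ Ss ⊑ ⋂ Ts
  ≤L-complete []       = ⊑-ω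
  ≤L-complete (p ∷ ps) = ⊓-glb (Any-complete p) (≤L-complete ps)

  Any-complete : ∀ {Ss T} → Any (_≤T T) Ss → ⋂ Ss ⊑ ty T
  Any-complete (here p)  = ⊑-trans ⊓-lb (≤T-complete p)
  Any-complete (there p) = ⊑-trans ⊓-lb₂ (Any-complete p)

-- Syntax-directed typing

TyEnv : Set
TyEnv = Name → List 𝕋

_,,_ : TyEnv → List 𝕋 → TyEnv
(θ ,, Ts) (bn zero)    = Ts
(θ ,, Ts) (bn (suc i)) = θ (bn i)
(θ ,, Ts) (fn x L)     = θ (fn x L)

-- Typ Δ θ L M T says that M has type ē_L T, where a variable of degree K has
-- type ē_K (⋂ (θ n)) and the bound variables have the degrees listed in Δ.
Typ : List Index → TyEnv → Index → Tm → 𝕋 → Set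
Typ Δ θ L (fv x K)  T       = K ≡ L × Any (_≤T T) (θ (fn x K))
Typ Δ θ L (bv i)    T       = lookupD Δ i ≡ L × Any (_≤T T) (θ (bn i))
Typ Δ θ L (app M N) T       = Σ Index λ K → Σ (𝕌 K) λ U →
  Typ Δ θ L M (U ⇒ T) × deg Δ N ≡ L ++ K × All (Typ Δ θ (L ++ K) N) (conj U)
Typ Δ θ L (lam J M) (atom a)      = ⊥
Typ Δ θ L (lam J M) (_⇒_ {K} U T) = J ≡ L ++ K × Typ (J ∷ Δ) (θ ,, conj U) L M T

Typ-deg : ∀ M {Δ θ L T} → Typ Δ θ L M T → deg Δ M ≡ L
Typ-deg (fv x K)  (eq , _)          = eq
Typ-deg (bv i)    (eq , _)          = eq
Typ-deg (app M N) (_ , _ , p , _)   = Typ-deg M p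
Typ-deg (lam J M) {T = U ⇒ T} (_ , p) = Typ-deg M p

-- `Typ` has no subsumption clause: subsumption is pushed down to the variables, the only places
-- where `_≤T_` appears.
Typ-≤ : ∀ M {Δ θ θ' L S T} → (∀ n → θ' n ≤L θ n) → S ≤T T → Typ Δ θ L M S → Typ Δ θ' L M T
Typ-≤ (fv x K)  h le (eq , p) = eq , Any-≤T (≤L-Any (h (fn x K)) p) le
Typ-≤ (bv i)    h le (eq , p) = eq , Any-≤T (≤L-Any (h (bn i)) p) le
Typ-≤ (app M N) h le (K , U , p , dg , ps) =
  K , U , Typ-≤ M h (⇒≤ (conj-≤-refl U) le) p , dg , All.map (Typ-≤ N h ≤T-refl) ps
Typ-≤ (lam J M) h (⇒≤ q le) (eq , p) =
  eq , Typ-≤ M (λ { (bn zero) → q ; (bn (suc i)) → h (bn i) ; (fn x L) → h (fn x L) }) le p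

RenEnv : TyEnv → TyEnv → (ℕ → ℕ) → Set
RenEnv θ θ' ρ = ∀ n → θ' (renName ρ n) ≡ θ n

ext-env : ∀ {θ θ' ρ Ts} → RenEnv θ θ' ρ → RenEnv (θ ,, Ts) (θ' ,, Ts) (ext ρ)
ext-env h (bn zero)    = refl
ext-env h (bn (suc i)) = h (bn i)
ext-env h (fn x L)     = h (fn x L)

Typ-ren : ∀ M {Δ Δ' θ θ' ρ L T} → LookupRen Δ Δ' ρ → RenEnv θ θ' ρ →
          Typ Δ θ L M T → Typ Δ' θ' L (ren ρ M) T
Typ-ren (fv x K)  h r (eq , p) = eq , subst (Any _) (sym (r (fn x K))) p
Typ-ren (bv i)    h r (eq , p) = trans (h i) eq , subst (Any _) (sym (r (bn i))) p
Typ-ren (app M N) h r (K , U , p , dg , ps) =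
  K , U , Typ-ren M h r p , trans (deg-ren h N) dg , All.map (Typ-ren N h r) ps
Typ-ren (lam J M) {T = U ⇒ T} h r (eq , p) = eq , Typ-ren M (ext-lookup h) (ext-env r) p

Typ-ren⁻ : ∀ M {Δ Δ' θ θ' ρ L T} → LookupRen Δ Δ' ρ → RenEnv θ θ' ρ →
           Typ Δ' θ' L (ren ρ M) T → Typ Δ θ L M T
Typ-ren⁻ (fv x K)  h r (eq , p) = eq , subst (Any _) (r (fn x K)) p
Typ-ren⁻ (bv i)    h r (eq , p) = trans (sym (h i)) eq , subst (Any _) (r (bn i)) p
Typ-ren⁻ (app M N) h r (K , U , p , dg , ps) =
  K , U , Typ-ren⁻ M h r p , trans (sym (deg-ren h N)) dg , All.map (Typ-ren⁻ N h r) ps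
Typ-ren⁻ (lam J M) {T = U ⇒ T} h r (eq , p) = eq , Typ-ren⁻ M (ext-lookup h) (ext-env r) p

Typ-wk : ∀ M {Δ θ J Ts L T} → Typ Δ θ L M T → Typ (J ∷ Δ) (θ ,, Ts) L (wk M) T
Typ-wk M = Typ-ren M (λ i → refl) (λ { (bn i) → refl ; (fn x L) → refl })

Typ-wk⁻ : ∀ M {Δ θ J Ts L T} → Typ (J ∷ Δ) (θ ,, Ts) L (wk M) T → Typ Δ θ L M T
Typ-wk⁻ M = Typ-ren⁻ M (λ i → refl) (λ { (bn i) → refl ; (fn x L) → refl })

SubTyped : List Index → TyEnv → List Index → TyEnv → Subst → Set
SubTyped Δ θ Δ' θ' σ = ∀ n → All (Typ Δ' θ' (degN Δ n) (σ n)) (θ n)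

Typ-var : ∀ Δ θ n → All (Typ Δ θ (degN Δ n) (var n)) (θ n)
Typ-var Δ θ (bn i)   = All.map (refl ,_) ≤L-refl
Typ-var Δ θ (fn x L) = All.map (refl ,_) ≤L-refl

var-Typ : ∀ Δ θ n {L Ts} → All (Typ Δ θ L (var n)) Ts → θ n ≤L Ts
var-Typ Δ θ (bn i)   = All.map proj₂
var-Typ Δ θ (fn x L) = All.map proj₂

exts-typed : ∀ {Δ θ Δ' θ' σ J Ts} → SubTyped Δ θ Δ' θ' σ →
             SubTyped (J ∷ Δ) (θ ,, Ts) (J ∷ Δ') (θ' ,, Ts) (exts σ)
exts-typed {Δ' = Δ'} {θ'} {J = J} {Ts} h (bn zero) = Typ-var (J ∷ Δ') (θ' ,, Ts) (bn zero)
exts-typed {σ = σ} h (bn (suc i)) = All.map (Typ-wk (σ (bn i))) (h (bn i))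
exts-typed {σ = σ} h (fn x L)     = All.map (Typ-wk (σ (fn x L))) (h (fn x L))

Typ-LB : ∀ M {Δ θ L Ss T} → All (Typ Δ θ L M) Ss → Any (_≤T T) Ss → Typ Δ θ L M T
Typ-LB M (p ∷ ps) (here le) = Typ-≤ M (λ n → ≤L-refl) le p
Typ-LB M (p ∷ ps) (there q) = Typ-LB M ps q

Typ-inst : ∀ M {Δ θ Δ' θ' σ L T} → DegSub Δ Δ' σ → SubTyped Δ θ Δ' θ' σ →
           Typ Δ θ L M T → Typ Δ' θ' L (inst σ M) T
Typ-inst (fv x K) {σ = σ} dg h (refl , p) = Typ-LB (σ (fn x K)) (h (fn x K)) p
Typ-inst (bv i)   {σ = σ} dg h (refl , p) = Typ-LB (σ (bn i)) (h (bn i)) p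
Typ-inst (app M N) dg h (K , U , p , eq , ps) =
  K , U , Typ-inst M dg h p , trans (deg-inst dg N) eq , All.map (Typ-inst N dg h) ps
Typ-inst (lam J M) {T = U ⇒ T} dg h (eq , p) =
  eq , Typ-inst M (exts-deg dg) (exts-typed h) p

_≟N_ : (m n : Name) → Dec (m ≡ n)
bn i ≟N bn j with i ℕ.≟ j
... | yes refl = yes refl
... | no ne    = no λ { refl → ne refl }
bn i ≟N fn x L = no λ ()
fn x L ≟N bn i = no λ ()
fn x L ≟N fn y K with x ≟V y | L ≟L K
... | yes refl | yes refl = yes refl
... | no ne    | _        = no λ { refl → ne refl }
... | yes _    | no ne    = no λ { refl → ne refl }

only : Name → 𝕋 → TyEnv
only m T n with m ≟N n
... | yes _ = T ∷ []
... | no _  = []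

only-typed : ∀ {Δ Δ' θ' σ} m {L T} → DegSub Δ Δ' σ → Typ Δ' θ' L (σ m) T →
             SubTyped Δ (only m T) Δ' θ' σ
only-typed {σ = σ} m dg p n with m ≟N n
... | no _     = []
... | yes refl = subst (λ L → Typ _ _ L (σ m) _) (trans (sym (Typ-deg (σ m) p)) (dg m)) p ∷ []

only-self : ∀ m T → Any (_≤T T) (only m T m)
only-self m T with m ≟N m
... | yes _ = here ≤T-refl
... | no ne = ⊥-elim (ne refl)

_⊎E_ : TyEnv → TyEnv → TyEnv
(θ ⊎E θ') n = θ n ++ θ' n

-- The converse of Typ-inst: the types at which σ n is used in a typing of
-- inst σ M are collected in an environment for M.
mutual
  Typ-inst⁻ : ∀ M {Δ Δ' θ' σ L T} → DegSub Δ Δ' σ → Typ Δ' θ' L (inst σ M) T →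
              Σ TyEnv λ θ → SubTyped Δ θ Δ' θ' σ × Typ Δ θ L M T
  Typ-inst⁻ (fv x K) {σ = σ} {T = T} dg p =
      only (fn x K) T , only-typed (fn x K) dg p
    , (trans (sym (dg (fn x K))) (Typ-deg (σ (fn x K)) p) , only-self (fn x K) T)
  Typ-inst⁻ (bv i) {σ = σ} {T = T} dg p =
      only (bn i) T , only-typed (bn i) dg p
    , (trans (sym (dg (bn i))) (Typ-deg (σ (bn i)) p) , only-self (bn i) T)
  Typ-inst⁻ (app M N) dg (K , U , p , eq , ps) with Typ-inst⁻ M dg p | Typ-inst⁻* N dg ps
  ... | θ₁ , h₁ , q | θ₂ , h₂ , qs =
      θ₁ ⊎E θ₂ , (λ n → AllP.++⁺ (h₁ n) (h₂ n))
    , K , U , Typ-≤ M (λ n → ⊆⇒≤L MP.∈-++⁺ˡ) ≤T-refl q , trans (sym (deg-inst dg N)) eq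
    , All.map (Typ-≤ N (λ n → ⊆⇒≤L (MP.∈-++⁺ʳ (θ₁ n))) ≤T-refl) qs
  Typ-inst⁻ (lam J M) {Δ' = Δ'} {θ'} {σ} {T = U ⇒ T} dg (eq , p) with Typ-inst⁻ M (exts-deg dg) p
  ... | θ₁ , h₁ , q =
      θ₁ ∘ renName suc
    , (λ { (bn i)   → All.map (Typ-wk⁻ (σ (bn i))) (h₁ (bn (suc i)))
         ; (fn x L) → All.map (Typ-wk⁻ (σ (fn x L))) (h₁ (fn x L)) })
    , eq
    -- `exts σ` sends `bn zero` to `bv 0` itself, so every type collected for it lies above a
    -- conjunct of `U`, and `conj U` may replace the collected list.
    , Typ-≤ M (λ { (bn zero) → var-Typ (J ∷ Δ') (θ' ,, conj U) (bn zero) (h₁ (bn zero))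
                 ; (bn (suc i)) → ≤L-refl ; (fn x L) → ≤L-refl }) ≤T-refl q

  Typ-inst⁻* : ∀ M {Δ Δ' θ' σ L Ts} → DegSub Δ Δ' σ → All (Typ Δ' θ' L (inst σ M)) Ts →
               Σ TyEnv λ θ → SubTyped Δ θ Δ' θ' σ × All (Typ Δ θ L M) Ts
  Typ-inst⁻* M dg [] = (λ _ → []) , (λ n → []) , []
  Typ-inst⁻* M dg (p ∷ ps) with Typ-inst⁻ M dg p | Typ-inst⁻* M dg ps
  ... | θ₁ , h₁ , q | θ₂ , h₂ , qs =
      θ₁ ⊎E θ₂ , (λ n → AllP.++⁺ (h₁ n) (h₂ n))
    , Typ-≤ M (λ n → ⊆⇒≤L MP.∈-++⁺ˡ) ≤T-refl q
    ∷ All.map (Typ-≤ M (λ n → ⊆⇒≤L (MP.∈-++⁺ʳ (θ₁ n))) ≤T-refl) qs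

-- Subject reduction and expansion

SubjectReduction : (List Index → Tm → Tm → Set) → Set
SubjectReduction R = ∀ {Δ M N θ L T} → WF Δ M → R Δ M N → Typ Δ θ L M T → Typ Δ θ L N T

SubjectExpansion : (List Index → Tm → Tm → Set) → Set
SubjectExpansion R = ∀ {Δ M N θ L T} → WF Δ M → R Δ M N → Typ Δ θ L N T → Typ Δ θ L M T

•-typed : ∀ {Δ θ N J Ts} → All (Typ Δ θ J N) Ts → SubTyped (J ∷ Δ) (θ ,, Ts) Δ θ (N • var)
•-typed ps (bn zero)    = ps
•-typed {Δ} {θ} ps (bn (suc i)) = Typ-var Δ θ (bn i)
•-typed {Δ} {θ} ps (fn x L)     = Typ-var Δ θ (fn x L)

β-reduction : SubjectReduction βroot
β-reduction {Δ} {θ = θ} {L} {T} w (β {M = M} {N} refl) (K , U , (eq , p) , eq' , ps) =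
  subst (λ P → Typ Δ θ L P T) (sym ([0≔]-inst M N))
    (Typ-inst M (•-deg refl (λ n → refl)) (•-typed (subst (λ J → All (Typ Δ θ J N) (conj U)) (sym eq') ps)) p)

-- The types at which copies of `N` are used are intersected into one domain `U`. If no copy is
-- typed, `U` is `ē* K (ω [])` and only the degree of `N` is constrained, so erased arguments do no
-- harm. The suffix `K` comes from well-formedness of the abstraction.
β-expansion : SubjectExpansion βroot
β-expansion {Δ} {θ = θ} {L} {T} (wf-app (wf-lam {M = M} _ (K , eqK)) _ _ _) (β {N = N} refl) p
  with Typ-inst⁻ M (•-deg {N = N} refl (λ n → refl)) (subst (λ P → Typ Δ θ L P T) ([0≔]-inst M N) p)
... | θ₁ , h₁ , q = K , U , (eq , Typ-≤ M le ≤T-refl q) , eq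
                  , subst₂ (λ J Ts → All (Typ Δ θ J N) Ts) eq (sym eqU) (h₁ (bn zero))
  where
  U : 𝕌 K
  U = ē* K (⋂ (θ₁ (bn zero)))
  eqU : conj U ≡ θ₁ (bn zero)
  eqU = conj-ē*⋂ K (θ₁ (bn zero))
  eq : deg Δ N ≡ L ++ K
  eq = trans eqK (cong (_++ K) (Typ-deg M q))
  le : ∀ n → (θ ,, conj U) n ≤L θ₁ n
  le (bn zero)    = subst (_≤L θ₁ (bn zero)) (sym eqU) ≤L-refl
  le (bn (suc i)) = var-Typ Δ θ (bn i) (h₁ (bn (suc i)))
  le (fn x J)     = var-Typ Δ θ (fn x J) (h₁ (fn x J))

⇒-≤-domain : ∀ {K K'} {U : 𝕌 K} {V : 𝕌 K'} {T} → K ≡ K' → conj U ≤L conj V → (V ⇒ T) ≤T (U ⇒ T)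
⇒-≤-domain refl le = ⇒≤ le ≤T-refl

-- `M` has some type `V ⇒ T` and is applied to the bound variable, whose types are `conj U`. So `U`
-- lies below `V`, and contravariance turns `V ⇒ T` into `U ⇒ T`. The degrees of `U` and `V` agree
-- after cancelling the prefix `L`.
η-reduction : SubjectReduction ηroot
η-reduction {Δ} {θ = θ} {L} {U ⇒ T} w (η {J} {M} nf) (eq , K , V , p , eq' , qs) =
  Typ-wk⁻ (downAt 0 M) (subst (λ P → Typ (J ∷ Δ) (θ ,, conj U) L P (U ⇒ T)) (sym (wk-down M nf))
    (Typ-≤ M (λ n → ≤L-refl)
      (⇒-≤-domain (LP.++-cancelˡ L _ _ (trans (sym eq) eq'))
        (var-Typ (J ∷ Δ) (θ ,, conj U) (bn zero) qs)) p))

compat-reduction : ∀ {R} → Preserves R → SubjectReduction R → SubjectReduction (Compat R)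
compat-reduction pr h w (root r) p = h w r p
compat-reduction pr h (wf-app w _ _ _) (appL s) (K , U , p , eq , ps) =
  K , U , compat-reduction pr h w s p , eq , ps
compat-reduction pr h (wf-app _ w _ _) (appR s) (K , U , p , eq , ps) =
  K , U , p , trans (proj₁ (proj₂ (compat-preserves pr s w))) eq , All.map (compat-reduction pr h w s) ps
compat-reduction pr h {T = U ⇒ T} (wf-lam w _) (lamC s) (eq , p) = eq , compat-reduction pr h w s p

compat-expansion : ∀ {R} → Preserves R → SubjectExpansion R → SubjectExpansion (Compat R)
compat-expansion pr h w (root r) p = h w r p
compat-expansion pr h (wf-app w _ _ _) (appL s) (K , U , p , eq , ps) =
  K , U , compat-expansion pr h w s p , eq , ps
compat-expansion pr h (wf-app _ w _ _) (appR s) (K , U , p , eq , ps) =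
  K , U , p , trans (sym (proj₁ (proj₂ (compat-preserves pr s w)))) eq , All.map (compat-expansion pr h w s) ps
compat-expansion pr h {T = U ⇒ T} (wf-lam w _) (lamC s) (eq , p) = eq , compat-expansion pr h w s p

-- Typing and lifting

record LiftedEnv (i : ℕ) (θ θ' : TyEnv) : Set where
  field
    bnd≡  : ∀ k → θ' (bn k) ≡ θ (bn k)
    free≡ : ∀ x K → θ' (fn x (i ∷ K)) ≡ θ (fn x K)

open LiftedEnv

lifted-,, : ∀ {i θ θ' Ts} → LiftedEnv i θ θ' → LiftedEnv i (θ ,, Ts) (θ' ,, Ts)
lifted-,, h = record { bnd≡ = λ { zero → refl ; (suc k) → bnd≡ h k } ; free≡ = free≡ h }

Typ-lift : ∀ {i θ θ'} → LiftedEnv i θ θ' → ∀ {Δ M} → WF Δ M → ∀ {L T} →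
           Typ Δ θ L M T → Typ (map (i ∷_) Δ) θ' (i ∷ L) (mapI (i ∷_) M) T
Typ-lift h (wf-fv x K) (refl , p) = refl , subst (Any _) (sym (free≡ h x K)) p
Typ-lift {i} h {Δ} (wf-bv k lt) (refl , p) = lookupD-map (i ∷_) Δ lt , subst (Any _) (sym (bnd≡ h k)) p
Typ-lift {i} h (wf-app w v _ _) (K , U , p , eq , ps) =
  K , U , Typ-lift h w p , trans (deg-mapI (i ∷_) v) (cong (i ∷_) eq) , All.map (Typ-lift h v) ps
Typ-lift {i} h (wf-lam w _) {T = U ⇒ T} (eq , p) = cong (i ∷_) eq , Typ-lift (lifted-,, h) w p

Typ-lift⁻ : ∀ {i θ θ'} → LiftedEnv i θ θ' → ∀ {Δ M} → WF Δ M → ∀ {L T} →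
            Typ (map (i ∷_) Δ) θ' (i ∷ L) (mapI (i ∷_) M) T → Typ Δ θ L M T
Typ-lift⁻ h (wf-fv x K) (refl , p) = refl , subst (Any _) (free≡ h x K) p
Typ-lift⁻ {i} h {Δ} (wf-bv k lt) (eq , p) =
  LP.∷-injectiveʳ (trans (sym (lookupD-map (i ∷_) Δ lt)) eq) , subst (Any _) (bnd≡ h k) p
Typ-lift⁻ {i} h (wf-app w v _ _) (K , U , p , eq , ps) =
  K , U , Typ-lift⁻ h w p , LP.∷-injectiveʳ (trans (sym (deg-mapI (i ∷_) v)) eq) , All.map (Typ-lift⁻ h v) ps
Typ-lift⁻ {i} h (wf-lam w _) {T = U ⇒ T} (eq , p) = LP.∷-injectiveʳ eq , Typ-lift⁻ (lifted-,, h) w p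

-- From typing derivations to syntax-directed typing

typed-𝓜 : ∀ {L M Γ} {U : 𝕌 L} → M ∶⟨ Γ ⊢ U ⟩ → 𝓜^ L M
typed-𝓜 (ax x T)      = wf-fv x [] , refl
typed-𝓜 (ω-ty w)      = w , refl
typed-𝓜 (→I {x = x} {L} p _ w)  = w , trans (deg-ƛ {x} {L} (proj₁ (typed-𝓜 p))) (proj₂ (typed-𝓜 p))
typed-𝓜 (→I' {x = x} {L} p _ w) = w , trans (deg-ƛ {x} {L} (proj₁ (typed-𝓜 p))) (proj₂ (typed-𝓜 p))
typed-𝓜 (→E p _ _ w)  = w , proj₂ (typed-𝓜 p)
typed-𝓜 (⊓I p _)      = typed-𝓜 p
typed-𝓜 (e j p)       = lift-𝓜 (typed-𝓜 p)
typed-𝓜 (sub p _ _)   = typed-𝓜 p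

conj? : ∀ {L} → Maybe (𝕌 L) → List 𝕋
conj? (just U) = conj U
conj? nothing  = []

envOf : Env → TyEnv
envOf Γ (bn i)   = []
envOf Γ (fn x L) = conj? (Γ x L)

single-same : ∀ x L (U : 𝕌 L) → single x L U x L ≡ just U
single-same x L U with x ≟V x | L ≟L L
... | yes _ | yes refl = refl
... | yes _ | no ne    = ⊥-elim (ne refl)
... | no ne | _        = ⊥-elim (ne refl)

single-other : ∀ {x L y K} (U : 𝕌 L) → (x , L) ≢ (y , K) → single x L U y K ≡ nothing
single-other {x} {L} {y} {K} U ne with x ≟V y | L ≟L K
... | yes refl | yes refl = ⊥-elim (ne refl)
... | yes _    | no _     = refl
... | no _     | _        = refl

remove-same : ∀ x L Γ → remove x L Γ x L ≡ nothing
remove-same x L Γ with sameVar-spec x L x L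
... | inj₁ (_ , eq) rewrite eq = refl
... | inj₂ (ne , _) = ⊥-elim (ne refl)

remove-other : ∀ {x L y K} Γ → (x , L) ≢ (y , K) → remove x L Γ y K ≡ Γ y K
remove-other {x} {L} {y} {K} Γ ne with sameVar-spec x L y K
... | inj₁ (eq , _) = ⊥-elim (ne eq)
... | inj₂ (_ , eq) rewrite eq = refl

close-typed : ∀ {Δ θ θ' x L Ts} → (∀ i → θ (bn i) ≡ θ' (bn i)) → θ (fn x L) ≡ Ts →
              (∀ y K → (x , L) ≢ (y , K) → θ (fn y K) ≡ θ' (fn y K)) →
              SubTyped Δ θ (L ∷ Δ) (θ' ,, Ts) (close x L)
close-typed {Δ} {θ} {θ'} {x} {L} {Ts} hb hx hf (bn i) rewrite hb i =
  Typ-var (L ∷ Δ) (θ' ,, Ts) (bn (suc i))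
close-typed {Δ} {θ} {θ'} {x} {L} {Ts} hb hx hf (fn y K) with sameVar-spec x L y K
... | inj₁ (refl , eq) rewrite eq | hx = Typ-var (L ∷ Δ) (θ' ,, Ts) (bn 0)
... | inj₂ (ne , eq) rewrite eq | hf y K ne = Typ-var (L ∷ Δ) (θ' ,, Ts) (fn y K)

⊓E-≤₁ : ∀ Γ Γ' n → envOf (Γ ⊓E Γ') n ≤L envOf Γ n
⊓E-≤₁ Γ Γ' (bn i) = []
⊓E-≤₁ Γ Γ' (fn x L) with Γ x L | Γ' x L
... | just U  | just V  = ⊆⇒≤L MP.∈-++⁺ˡ
... | just U  | nothing = ≤L-refl
... | nothing | _       = []

⊓E-≤₂ : ∀ Γ Γ' n → envOf (Γ ⊓E Γ') n ≤L envOf Γ' n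
⊓E-≤₂ Γ Γ' (bn i) = []
⊓E-≤₂ Γ Γ' (fn x L) with Γ x L | Γ' x L
... | just U  | just V  = ⊆⇒≤L (MP.∈-++⁺ʳ (conj U))
... | just U  | nothing = []
... | nothing | _       = ≤L-refl

⊑E-≤ : ∀ {Γ Γ'} → Γ ⊑E Γ' → ∀ n → envOf Γ n ≤L envOf Γ' n
⊑E-≤ h (bn i) = []
⊑E-≤ {Γ} {Γ'} h (fn x L) with Γ x L | Γ' x L | h x L
... | _ | _ | nothing = []
... | _ | _ | just le = ⊑-sound le

ēE-same : ∀ j Γ x K → ēE j Γ x (j ∷ K) ≡ Maybe.map (ē j) (Γ x K)
ēE-same j Γ x K with j ℕ.≟ j
... | yes refl = refl
... | no ne    = ⊥-elim (ne refl)

ēE-lifted : ∀ j Γ → LiftedEnv j (envOf Γ) (envOf (ēE j Γ))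
ēE-lifted j Γ = record { bnd≡ = λ k → refl ; free≡ = eq }
  where
  eq : ∀ x K → conj? (ēE j Γ x (j ∷ K)) ≡ conj? (Γ x K)
  eq x K rewrite ēE-same j Γ x K with Γ x K
  ... | just U  = refl
  ... | nothing = refl

-- Rules `→I` and `→I'` collapse into the single `lam` clause, because an undeclared variable and
-- one of type ω both get the empty list; `ω-ty` leaves nothing to prove for the same reason.
typed-Typ : ∀ {L M Γ} {U : 𝕌 L} → M ∶⟨ Γ ⊢ U ⟩ → All (Typ [] (envOf Γ) L M) (conj U)
typed-Typ (ax x T) rewrite single-same x [] (ty T) = (refl , here ≤T-refl) ∷ []
typed-Typ (ω-ty w) = []
typed-Typ (→I {M} {Γ} {T} {x} {L} {U} p eq w) with typed-Typ p
... | q ∷ [] = (refl , subst (λ P → Typ (L ∷ []) _ [] P T) (sym (closeAt-close (proj₁ (typed-𝓜 p))))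
    (Typ-inst M (close-deg x L)
      (close-typed (λ i → refl) (cong conj? eq) (λ y K ne → cong conj? (sym (remove-other Γ ne)))) q)) ∷ []
typed-Typ (→I' {M} {Γ} {T} {x} {L} p eq w) with typed-Typ p
... | q ∷ [] = (refl , subst (λ P → Typ (L ∷ []) _ [] P T) (sym (closeAt-close (proj₁ (typed-𝓜 p))))
    (Typ-inst M (close-deg x L)
      (close-typed (λ i → refl) (cong conj? eq) (λ y K ne → refl)) q)) ∷ []
typed-Typ (→E {M₁} {M₂} {Γ₁} {Γ₂} {K} {T} {U} p p' _ _) with typed-Typ p
... | q ∷ [] = (K , U , Typ-≤ M₁ (⊓E-≤₁ Γ₁ Γ₂) ≤T-refl q , proj₂ (typed-𝓜 p')
               , All.map (Typ-≤ M₂ (⊓E-≤₂ Γ₁ Γ₂) ≤T-refl) (typed-Typ p')) ∷ []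
typed-Typ (⊓I p q) = AllP.++⁺ (typed-Typ p) (typed-Typ q)
typed-Typ (e {M} {Γ} {L} {U} j p) rewrite lift-mapI j M =
  All.map (Typ-lift (ēE-lifted j Γ) (proj₁ (typed-𝓜 p))) (typed-Typ p)
typed-Typ (sub {M} p le le') =
  All.map (λ q → Typ-≤ M (⊑E-≤ le) ≤T-refl (Typ-LB M (typed-Typ p) q)) (⊑-sound le')

∈-closeAt : ∀ k x L M {y K} → (y , K) ∈ fvs (closeAt k x L M) → (y , K) ∈ fvs M × (x , L) ≢ (y , K)
∈-closeAt k x L (fv z J) p with sameVar-spec x L z J
... | inj₁ (_ , eq) rewrite eq with () ← p
∈-closeAt k x L (fv z J) p | inj₂ (ne , eq) rewrite eq with p
... | here refl = here refl , ne
∈-closeAt k x L (lam J M) p = ∈-closeAt (suc k) x L M p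
∈-closeAt k x L (app M N) p with MP.∈-++⁻ (fvs (closeAt k x L M)) p
... | inj₁ q = let (r , ne) = ∈-closeAt k x L M q in MP.∈-++⁺ˡ r , ne
... | inj₂ q = let (r , ne) = ∈-closeAt k x L N q in MP.∈-++⁺ʳ (fvs M) r , ne

-- The list traversal local to env^ω cannot be named; unification in
-- env^ω-traversal finds it.
mutual
  traversal : Tm → (y : Var) (K : Index) → List (Var × Index) → Maybe (𝕌 K)
  traversal = _

  env^ω-traversal : ∀ M y K → env^ω M y K ≡ traversal M y K (fvs M)
  env^ω-traversal M y K with fvs M
  ... | xs = refl

traversal-∈ : ∀ M {y K} xs → (y , K) ∈ xs → traversal M y K xs ≡ just (ω K)
traversal-∈ M {y} {K} ((x , L) ∷ xs) p with sameVar-spec x L y K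
... | inj₁ (_ , eq) rewrite eq = refl
... | inj₂ (ne , eq) rewrite eq with p
...   | here refl = ⊥-elim (ne refl)
...   | there q   = traversal-∈ M xs q

traversal-∉ : ∀ M {y K} xs → ¬ (y , K) ∈ xs → traversal M y K xs ≡ nothing
traversal-∉ M [] p = refl
traversal-∉ M {y} {K} ((x , L) ∷ xs) p with sameVar-spec x L y K
... | inj₁ (refl , eq) = ⊥-elim (p (here refl))
... | inj₂ (_ , eq) rewrite eq = traversal-∉ M xs (p ∘ there)

env^ω-∈ : ∀ M {y K} → (y , K) ∈ fvs M → env^ω M y K ≡ just (ω K)
env^ω-∈ M {y} {K} p = trans (env^ω-traversal M y K) (traversal-∈ M (fvs M) p)

env^ω-∉ : ∀ M {y K} → ¬ (y , K) ∈ fvs M → env^ω M y K ≡ nothing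
env^ω-∉ M {y} {K} p = trans (env^ω-traversal M y K) (traversal-∉ M (fvs M) p)

fvs-dom : ∀ {L M Γ} {U : 𝕌 L} → M ∶⟨ Γ ⊢ U ⟩ → ∀ {y K} → (y , K) ∈ fvs M → IsJust (Γ y K)
fvs-dom (ax x T) (here refl) rewrite single-same x [] (ty T) = tt
fvs-dom (ω-ty {M} w) p rewrite env^ω-∈ M p = tt
fvs-dom (→I {M} {Γ} {x = x} {L} q eq w) p with ∈-closeAt 0 x L M p
... | r , ne rewrite remove-other Γ ne = fvs-dom q r
fvs-dom (→I' {M} {x = x} {L} q eq w) p = fvs-dom q (proj₁ (∈-closeAt 0 x L M p))
fvs-dom (→E {M₁} {M₂} {Γ₁} {Γ₂} p₁ p₂ _ _) {y} {K} p with MP.∈-++⁻ (fvs M₁) p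
... | inj₁ q with Γ₁ y K | Γ₂ y K | fvs-dom p₁ q
...   | just _ | just _  | _ = tt
...   | just _ | nothing | _ = tt
fvs-dom (→E {M₁} {M₂} {Γ₁} {Γ₂} p₁ p₂ _ _) {y} {K} p | inj₂ q with Γ₁ y K | Γ₂ y K | fvs-dom p₂ q
...   | just _  | just _ | _ = tt
...   | nothing | just _ | _ = tt
fvs-dom (⊓I q _) p = fvs-dom q p
fvs-dom (e {M} {Γ} j q) {y} p rewrite lift-mapI j M with ∈-mapI⁻ (j ∷_) M p
... | K , refl , r rewrite ēE-same j Γ y K with Γ y K | fvs-dom q r
...   | just _ | _ = tt
fvs-dom (sub {Γ = Γ} {Γ'} q le _) {y} {K} p with Γ' y K | Γ y K | le y K | fvs-dom q p
... | _ | _ | just _ | _ = tt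

typed-closed : ∀ {L M} {U : 𝕌 L} → M ∶⟨ ∅ ⊢ U ⟩ → Closed M
typed-closed {M = M} p with fvs M | fvs-dom p
... | []    | _ = refl
... | _ ∷ _ | h = ⊥-elim (h (here refl))

-- From syntax-directed typing to typing derivations

_∈?_ : (v : Var × Index) (xs : List (Var × Index)) → Dec (v ∈ xs)
_∈?_ = DecMembership._∈?_ (ProdP.≡-dec _≟V_ _≟L_)

-- `_⊑E_` relates only environments with equal domains, and `ω-ty` fixes the domain to the free
-- variables; so the total `θ` is cut down to exactly these.
restrict : TyEnv → Tm → Env
restrict θ M y K = if does ((y , K) ∈? fvs M) then just (ē* K (⋂ (θ (fn y K)))) else nothing

restrict-∈ : ∀ θ M {y K} → (y , K) ∈ fvs M → restrict θ M y K ≡ just (ē* K (⋂ (θ (fn y K))))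
restrict-∈ θ M {y} {K} p with (y , K) ∈? fvs M
... | yes _ = refl
... | no np = ⊥-elim (np p)

restrict-∉ : ∀ θ M {y K} → ¬ (y , K) ∈ fvs M → restrict θ M y K ≡ nothing
restrict-∉ θ M {y} {K} np with (y , K) ∈? fvs M
... | yes p = ⊥-elim (np p)
... | no _  = refl

restrict-dom : ∀ θ M {y K} → IsJust (restrict θ M y K) → (y , K) ∈ fvs M
restrict-dom θ M {y} {K} j with (y , K) ∈? fvs M
... | yes p = p

restrict-⊑ : ∀ θ M {Γ} →
  (∀ y K → (y , K) ∈ fvs M → Σ (𝕌 K) λ V → Γ y K ≡ just V × (ē* K (⋂ (θ (fn y K))) ⊑ V)) →
  (∀ y K → ¬ (y , K) ∈ fvs M → Γ y K ≡ nothing) → restrict θ M ⊑E Γ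
restrict-⊑ θ M hin hout y K with (y , K) ∈? fvs M
... | yes p with hin y K p
...   | V , eq , le rewrite eq = just le
restrict-⊑ θ M hin hout y K | no np rewrite hout y K np = nothing

-- Term size, and opening a binder with a fresh name

size : Tm → ℕ
size (fv x L)  = 1
size (bv i)    = 1
size (lam L M) = suc (size M)
size (app M N) = suc (size M + size N)

size-mapI : ∀ φ M → size (mapI φ M) ≡ size M
size-mapI φ (fv x L)  = refl
size-mapI φ (bv i)    = refl
size-mapI φ (lam L M) = cong suc (size-mapI φ M)
size-mapI φ (app M N) = cong suc (cong₂ _+_ (size-mapI φ M) (size-mapI φ N))

size-ren : ∀ ρ M → size (ren ρ M) ≡ size M
size-ren ρ (fv x L)  = refl
size-ren ρ (bv i)    = refl
size-ren ρ (lam L M) = cong suc (size-ren (ext ρ) M)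
size-ren ρ (app M N) = cong suc (cong₂ _+_ (size-ren ρ M) (size-ren ρ N))

size-inst : ∀ {σ} → (∀ n → size (σ n) ≡ 1) → ∀ M → size (inst σ M) ≡ size M
size-inst h (fv x L)  = h (fn x L)
size-inst h (bv i)    = h (bn i)
size-inst {σ} h (lam L M) = cong suc (size-inst under M)
  where
  under : ∀ n → size (exts σ n) ≡ 1
  under (bn zero)    = refl
  under (bn (suc i)) = trans (size-ren suc (σ (bn i))) (h (bn i))
  under (fn x L)     = trans (size-ren suc (σ (fn x L))) (h (fn x L))
size-inst h (app M N) = cong suc (cong₂ _+_ (size-inst h M) (size-inst h N))

Typ-agree : ∀ M {Δ θ θ' L T} → (∀ i → θ (bn i) ≡ θ' (bn i)) →
            (∀ x K → (x , K) ∈ fvs M → θ (fn x K) ≡ θ' (fn x K)) →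
            Typ Δ θ L M T → Typ Δ θ' L M T
Typ-agree (fv x K) hb hf (eq , p) = eq , subst (Any _) (hf x K (here refl)) p
Typ-agree (bv i) hb hf (eq , p) = eq , subst (Any _) (hb i) p
Typ-agree (app M N) hb hf (K , U , p , eq , ps) =
    K , U , Typ-agree M hb (λ x J r → hf x J (MP.∈-++⁺ˡ r)) p , eq
  , All.map (Typ-agree N hb (λ x J r → hf x J (MP.∈-++⁺ʳ (fvs M) r))) ps
Typ-agree (lam J M) {T = U ⇒ T} hb hf (eq , p) =
  eq , Typ-agree M (λ { zero → refl ; (suc i) → hb i }) hf p

_[_^_↦_] : TyEnv → Var → Index → List 𝕋 → TyEnv
(θ [ x ^ L ↦ Ts ]) (bn i)   = θ (bn i)
(θ [ x ^ L ↦ Ts ]) (fn y K) = if sameVar x L y K then Ts else θ (fn y K)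

update-same : ∀ θ x L Ts → (θ [ x ^ L ↦ Ts ]) (fn x L) ≡ Ts
update-same θ x L Ts with sameVar-spec x L x L
... | inj₁ (_ , eq) rewrite eq = refl
... | inj₂ (ne , _) = ⊥-elim (ne refl)

update-other : ∀ θ {x L Ts y K} → (x , L) ≢ (y , K) → (θ [ x ^ L ↦ Ts ]) (fn y K) ≡ θ (fn y K)
update-other θ {x} {L} {Ts} {y} {K} ne with sameVar-spec x L y K
... | inj₁ (eq , _) = ⊥-elim (ne eq)
... | inj₂ (_ , eq) rewrite eq = refl

fvs-substAt : ∀ k N M → fvs M ⊆ fvs (substAt k N M)
fvs-substAt k N (fv x L)  p = p
fvs-substAt k N (lam L M) p = fvs-substAt (suc k) N M p
fvs-substAt k N (app M P) p with MP.∈-++⁻ (fvs M) p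
... | inj₁ q = MP.∈-++⁺ˡ (fvs-substAt k N M q)
... | inj₂ q = MP.∈-++⁺ʳ (fvs (substAt k N M)) (fvs-substAt k N P q)

-- The typing rules abstract a named variable, so a de Bruijn body must be given a name before its
-- derivation can be built. `ƛ-opened` shows that abstracting this name again restores the original
-- term.
module Opening {J M n} (w : WF (J ∷ []) M) (fresh : nameBound M ≤ n) where
  x : Var
  x = v₂ n

  opened : Tm
  opened = M [0≔ fv x J ]

  notin : ∀ {K} → ¬ (x , K) ∈ fvs M
  notin = fresh-var M fresh

  P P' : VarSet
  P y K  = (y , K) ∈ fvs M
  P' y K = (x , J) ≡ (y , K) ⊎ (y , K) ∈ fvs M

  good : GoodSubst (J ∷ []) [] P P' (fv x J • var)
  good = record
    { degs = •-deg refl (λ n → refl)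
    ; free = λ y K p → wf-fv y K , λ { _ _ (here refl) → inj₂ p }
    ; bnd  = λ { zero _ → wf-fv x J , (λ { _ _ (here refl) → inj₁ refl }) ; (suc i) (s≤s ()) } }

  functional : Functional P'
  functional y L K (inj₁ refl) (inj₁ refl) = refl
  functional y L K (inj₁ refl) (inj₂ q)    = ⊥-elim (notin q)
  functional y L K (inj₂ p)    (inj₁ refl) = ⊥-elim (notin p)
  functional y L K (inj₂ p)    (inj₂ q)    = ◇-self w y L K p q

  opened-term : Term opened
  opened-term = subst (WF []) (sym ([0≔]-inst M (fv x J))) (WF-inst good functional w (λ _ _ p → p))

  opened-fvs : FV⊆ P' opened
  opened-fvs = subst (FV⊆ P') (sym ([0≔]-inst M (fv x J))) (inst-FV good w (λ _ _ p → p))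

  ƛ-opened : ƛ x J opened ≡ lam J M
  ƛ-opened = cong (lam J) (close-open w notin)

  size-opened : size opened ≡ size M
  size-opened = trans (cong size ([0≔]-inst M (fv x J))) (size-inst one M)
    where
    one : ∀ n → size ((fv x J • var) n) ≡ 1
    one (bn zero)    = refl
    one (bn (suc i)) = refl
    one (fn y K)     = refl

  opened-Typ : ∀ {θ Ts L T} → Typ (J ∷ []) (θ ,, Ts) L M T → Typ [] (θ [ x ^ J ↦ Ts ]) L opened T
  opened-Typ {θ} {Ts} {L} {T} p = subst (λ N → Typ [] θ' L N T) (sym ([0≔]-inst M (fv x J)))
    (Typ-inst M (•-deg refl (λ n → refl)) (•-typed self)
      (Typ-agree M (λ { zero → refl ; (suc i) → refl })
        (λ y K q → sym (update-other θ {x} {J} {Ts} {y} {K} (λ { refl → notin q }))) p))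
    where
    θ' : TyEnv
    θ' = θ [ x ^ J ↦ Ts ]
    self : All (Typ [] θ' J (fv x J)) Ts
    self = subst (All _) (update-same θ x J Ts) (Typ-var [] θ' (fn x J))

mutual
  -- `n` bounds the size because neither an opened body nor an unlifted term is a subterm. At fixed
  -- `n` first the degree `L` and then the list `Ts` decrease. A term of degree `i ∷ L` is a
  -- lifting, so rule `e` brings everything down to degree `[]`.
  Typ-typed* : ∀ n L {θ M Ts} → size M ≤ n → 𝓜^ L M → All (Typ [] θ L M) Ts →
               M ∶⟨ restrict θ M ⊢ ē* L (⋂ Ts) ⟩
  Typ-typed* n (i ∷ L) {θ} {M} {Ts} le m ps =
    subst (λ P → P ∶⟨ restrict θ M ⊢ ē* (i ∷ L) (⋂ Ts) ⟩) (sym M≡)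
      (sub (e i (Typ-typed* n L (subst (_≤ n) (sym (size-mapI (drop 1) M)) le) m'
        (All.map (Typ-lift⁻ lifted (proj₁ m') ∘ subst (λ P → Typ [] θ (i ∷ L) P _) M≡') ps)))
        (restrict-⊑ θ M hin hout) (⊑-refl ≈-refl))
    where
    M' : Tm
    M' = unlift (i ∷ []) M
    m' : 𝓜^ L M'
    m' = unlift-𝓜 {i ∷ []} m
    M≡ : M ≡ lift i M'
    M≡ = lift-unlift m
    M≡' : M ≡ mapI (i ∷_) M'
    M≡' = trans M≡ (lift-mapI i M')
    θ' : TyEnv
    θ' (bn k)   = θ (bn k)
    θ' (fn y K) = θ (fn y (i ∷ K))
    lifted : LiftedEnv i θ' θ
    lifted = record { bnd≡ = λ _ → refl ; free≡ = λ _ _ → refl }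
    hin : ∀ y K → (y , K) ∈ fvs M →
          Σ (𝕌 K) λ V → ēE i (restrict θ' M') y K ≡ just V × (ē* K (⋂ (θ (fn y K))) ⊑ V)
    hin y K p with ∈-mapI⁻ (i ∷_) M' (subst (λ N → (y , K) ∈ fvs N) M≡' p)
    ... | K' , refl , q = _ , trans (ēE-same i _ y K') (cong (Maybe.map (ē i)) (restrict-∈ θ' M' q))
                        , ⊑-refl ≈-refl
    hout : ∀ y K → ¬ (y , K) ∈ fvs M → ēE i (restrict θ' M') y K ≡ nothing
    hout y [] np = refl
    hout y (j ∷ K) np with j ℕ.≟ i
    ... | no _     = refl
    ... | yes refl = cong (Maybe.map (ē i)) (restrict-∉ θ' M'
      (λ q → np (subst (λ N → (y , i ∷ K) ∈ fvs N) (sym M≡') (∈-mapI⁺ (i ∷_) M' q))))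
  Typ-typed* n [] {θ} {M} le (w , eq) [] =
    sub (subst (λ L → M ∶⟨ env^ω M ⊢ ω L ⟩) eq (ω-ty w))
        (restrict-⊑ θ M (λ y K p → ω K , env^ω-∈ M p , ⊑-ω) (λ y K np → env^ω-∉ M np)) (⊑-refl ≈-refl)
  Typ-typed* n [] le m (p ∷ ps) = ⊓I (Typ-typed n le m p) (Typ-typed* n [] le m ps)

  Typ-typed : ∀ n {θ M T} → size M ≤ n → 𝓜^ [] M → Typ [] θ [] M T → M ∶⟨ restrict θ M ⊢ ty T ⟩
  Typ-typed n {θ} {fv x []} {T} le m (refl , p) = sub (ax x T) (restrict-⊑ θ (fv x []) hin hout) (⊑-refl ≈-refl)
    where
    hin : ∀ y K → (y , K) ∈ (x , []) ∷ [] →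
          Σ (𝕌 K) λ V → single x [] (ty T) y K ≡ just V × (ē* K (⋂ (θ (fn y K))) ⊑ V)
    hin y K (here refl) = ty T , single-same x [] (ty T) , Any-complete p
    hout : ∀ y K → ¬ (y , K) ∈ (x , []) ∷ [] → single x [] (ty T) y K ≡ nothing
    hout y K np = single-other (ty T) (λ { refl → np (here refl) })
  Typ-typed n {M = bv i} le (wf-bv _ () , _) p
  Typ-typed (suc n) {θ} {app M N} {T} (s≤s le) (w@(wf-app wM wN _ j) , eq) (K , U , p , eqK , ps) =
    sub (→E (Typ-typed n (ℕP.≤-trans (ℕP.m≤m+n (size M) (size N)) le) (wM , eq) p)
            (sub (Typ-typed* n K (ℕP.≤-trans (ℕP.m≤n+m (size N) (size M)) le) (wN , eqK) ps)
                 (λ y J → MaybeRel-refl _) (⊑-refl (≈-sym (normal-form U))))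
            (λ y J J' q r → j y J J' (restrict-dom θ M q) (restrict-dom θ N r)) w)
        (restrict-⊑ θ (app M N) hin hout) (⊑-refl ≈-refl)
    where
    MaybeRel-refl : ∀ {J} (m : Maybe (𝕌 J)) → MaybeRel m m
    MaybeRel-refl nothing  = nothing
    MaybeRel-refl (just V) = just (⊑-refl ≈-refl)
    hin : ∀ y J → (y , J) ∈ fvs M ++ fvs N →
          Σ (𝕌 J) λ V → (restrict θ M ⊓E restrict θ N) y J ≡ just V × (ē* J (⋂ (θ (fn y J))) ⊑ V)
    hin y J q with (y , J) ∈? fvs M | (y , J) ∈? fvs N
    ... | yes _ | yes _ = _ , refl , ⊑-refl (≈-sym ⊓-idem)
    ... | yes _ | no _  = _ , refl , ⊑-refl ≈-refl
    ... | no _  | yes _ = _ , refl , ⊑-refl ≈-refl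
    ... | no r  | no r' = ⊥-elim ([ r , r' ]′ (MP.∈-++⁻ (fvs M) q))
    hout : ∀ y J → ¬ (y , J) ∈ fvs M ++ fvs N → (restrict θ M ⊓E restrict θ N) y J ≡ nothing
    hout y J nq rewrite restrict-∉ θ M {y} {J} (nq ∘ MP.∈-++⁺ˡ)
                      | restrict-∉ θ N {y} {J} (nq ∘ MP.∈-++⁺ʳ (fvs M)) = refl
  Typ-typed (suc n) {θ} {lam J M} {_⇒_ {K} U T} (s≤s le) (w@(wf-lam wM _) , eq) (refl , p) =
    -- Whether the bound variable occurs decides between `→I` and `→I'`. In the second case the
    -- domain is ω, and contravariance with `U ⊑ ω` gives the domain `U`.
    abstraction ((x , J) ∈? fvs opened)
    where
    open Opening wM ℕP.≤-refl
    θ' : TyEnv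
    θ' = θ [ x ^ J ↦ conj U ]
    body : opened ∶⟨ restrict θ' opened ⊢ ty T ⟩
    body = Typ-typed n (subst (_≤ n) (sym size-opened) le)
             (opened-term , trans (deg-[0≔] M (fv x J) refl) eq) (opened-Typ p)
    termƛ : Term (ƛ x J opened)
    termƛ = subst Term (sym ƛ-opened) w
    other : ∀ {y K} → (y , K) ∈ fvs M → (x , J) ≢ (y , K)
    other q refl = notin q
    inside : ∀ y K → (y , K) ∈ fvs M →
             Σ (𝕌 K) λ V → restrict θ' opened y K ≡ just V × (ē* K (⋂ (θ (fn y K))) ⊑ V)
    inside y K q = _ , restrict-∈ θ' opened (fvs-substAt 0 (fv x J) M q)
      , subst (λ Ts → ē* K (⋂ (θ (fn y K))) ⊑ ē* K (⋂ Ts)) (sym (update-other θ {x} {J} {conj U} (other q))) (⊑-refl ≈-refl)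
    abstraction : Dec ((x , J) ∈ fvs opened) → lam J M ∶⟨ restrict θ (lam J M) ⊢ ty (U ⇒ T) ⟩
    abstraction (yes q) = subst (λ P → P ∶⟨ restrict θ (lam J M) ⊢ ty (U ⇒ T) ⟩) ƛ-opened
      (sub (→I body (restrict-∈ θ' opened q) termƛ)
        (restrict-⊑ θ (lam J M)
          (λ y K r → let (V , eqV , leV) = inside y K r in
             V , trans (remove-other (restrict θ' opened) (other r)) eqV , leV)
          removed)
        (⇒-mono (subst (λ Ts → U ⊑ ē* J (⋂ Ts)) (sym (update-same θ x J (conj U))) (⊑-refl (normal-form U)))
                (⊑-refl ≈-refl)))
      where
      removed : ∀ y K → ¬ (y , K) ∈ fvs M → remove x J (restrict θ' opened) y K ≡ nothing
      removed y K nr with sameVar-spec x J y K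
      ... | inj₁ (refl , _) = remove-same x J (restrict θ' opened)
      ... | inj₂ (ne , _)   = trans (remove-other (restrict θ' opened) ne)
        (restrict-∉ θ' opened (λ r → [ ne , nr ]′ (opened-fvs y K r)))
    abstraction (no nq) = subst (λ P → P ∶⟨ restrict θ (lam J M) ⊢ ty (U ⇒ T) ⟩) ƛ-opened
      (sub (→I' body (restrict-∉ θ' opened nq) termƛ)
        (restrict-⊑ θ (lam J M) inside
          (λ y K nr → restrict-∉ θ' opened
             (λ r → [ (λ { refl → nq r }) , nr ]′ (opened-fvs y K r))))
        (⇒-mono ⊑-ω (⊑-refl ≈-refl)))

Typ⇒typed : ∀ {L θ M} (U : 𝕌 L) → 𝓜^ L M → Closed M → All (Typ [] θ L M) (conj U) → M ∶⟨ ∅ ⊢ U ⟩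
Typ⇒typed {L} {θ} {M} U m cl ps =
  sub (Typ-typed* (size M) L ℕP.≤-refl m ps) empty (⊑-refl (≈-sym (normal-form U)))
  where
  empty : ∅ ⊑E restrict θ M
  empty y K rewrite restrict-∉ θ M {y} {K} (λ p → MP.∉[] (subst ((y , K) ∈_) cl p)) = nothing

-- Confluence of βη-reduction

-- Parallel βη-reduction in the style of Tait and Martin-Löf. `Δ` is kept since β is guarded by a
-- degree. η-redexes are given by weakening instead of `NotFree`, and the equations in `pβ` and `pη`
-- spare pattern matching from unifying with `wk` or a substitution.
data Par : List Index → Tm → Tm → Set where
  pfv  : ∀ {Δ x L} → Par Δ (fv x L) (fv x L)
  pbv  : ∀ {Δ i} → Par Δ (bv i) (bv i)
  papp : ∀ {Δ M M' N N'} → Par Δ M M' → Par Δ N N' → Par Δ (app M N) (app M' N')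
  plam : ∀ {Δ L M M'} → Par (L ∷ Δ) M M' → Par Δ (lam L M) (lam L M')
  pβ   : ∀ {Δ L M M' N N' P} → deg Δ N ≡ L → Par (L ∷ Δ) M M' → Par Δ N N' →
         P ≡ M' [0≔ N' ] → Par Δ (app (lam L M) N) P
  pη   : ∀ {Δ L M M' Q} → Q ≡ wk M → Par Δ M M' → Par Δ (lam L (app Q (bv 0))) M'

par-refl : ∀ {Δ} M → Par Δ M M
par-refl (fv x L)  = pfv
par-refl (bv i)    = pbv
par-refl (lam L M) = plam (par-refl M)
par-refl (app M N) = papp (par-refl M) (par-refl N)

par-deg : ∀ {Δ M M'} → Par Δ M M' → deg Δ M' ≡ deg Δ M
par-deg pfv        = refl
par-deg pbv        = refl
par-deg (papp p q) = par-deg p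
par-deg (plam p)   = par-deg p
par-deg (pβ {M' = M'} {N' = N'} eq p q refl) =
  trans (deg-[0≔] M' N' (trans (par-deg q) eq)) (par-deg p)
par-deg (pη {M = M} refl p) = trans (par-deg p) (sym (deg-wk M))

par-ren : ∀ {Δ Δ' ρ M M'} → LookupRen Δ Δ' ρ → Par Δ M M' → Par Δ' (ren ρ M) (ren ρ M')
par-ren h pfv        = pfv
par-ren h pbv        = pbv
par-ren h (papp p q) = papp (par-ren h p) (par-ren h q)
par-ren h (plam p)   = plam (par-ren (ext-lookup h) p)
par-ren {ρ = ρ} h (pβ {M' = M'} {N = N} {N'} eq p q refl) =
  pβ (trans (deg-ren h N) eq) (par-ren (ext-lookup h) p) (par-ren h q) (ren-[0≔] ρ M' N')
par-ren {ρ = ρ} h (pη {M = M} refl p) = pη (ren-wk ρ M) (par-ren h p)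

par-exts : ∀ {Δ' σ τ L} → (∀ n → Par Δ' (σ n) (τ n)) → ∀ n → Par (L ∷ Δ') (exts σ n) (exts τ n)
par-exts h (bn zero)    = pbv
par-exts h (bn (suc i)) = par-ren (λ _ → refl) (h (bn i))
par-exts h (fn x L)     = par-ren (λ _ → refl) (h (fn x L))

par-inst : ∀ {Δ Δ' σ τ M M'} → DegSub Δ Δ' σ → (∀ n → Par Δ' (σ n) (τ n)) →
           Par Δ M M' → Par Δ' (inst σ M) (inst τ M')
par-inst dg h (pfv {x = x} {L}) = h (fn x L)
par-inst dg h (pbv {i = i})     = h (bn i)
par-inst dg h (papp p q)        = papp (par-inst dg h p) (par-inst dg h q)
par-inst dg h (plam p)          = plam (par-inst (exts-deg dg) (par-exts h) p)
par-inst {τ = τ} dg h (pβ {M' = M'} {N = N} {N'} eq p q refl) =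
  pβ (trans (deg-inst dg N) eq) (par-inst (exts-deg dg) (par-exts h) p) (par-inst dg h q)
     (inst-[0≔] τ M' N')
par-inst {σ = σ} dg h (pη {M = M} refl p) = pη (inst-wk σ M) (par-inst dg h p)

par-[0≔] : ∀ {Δ L M M' N N'} → deg Δ N ≡ L → Par (L ∷ Δ) M M' → Par Δ N N' →
           Par Δ (M [0≔ N ]) (M' [0≔ N' ])
par-[0≔] {M = M} {M'} {N} {N'} eq p q = subst₂ (Par _) (sym ([0≔]-inst M N)) (sym ([0≔]-inst M' N'))
  (par-inst (•-deg eq (λ n → refl)) (λ { (bn zero) → q ; (bn (suc i)) → pbv ; (fn x L) → pfv }) p)

app-ren : ∀ {ρ Q} B → app Q (bv 0) ≡ ren (ext ρ) B → Σ Tm λ B₁ → B ≡ app B₁ (bv 0) × Q ≡ ren (ext ρ) B₁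
app-ren (app B₁ (bv zero)) refl = B₁ , refl , refl

-- `ext ρ` fixes 0, so an occurrence of index 0 in `M` would give one in `wk P`.
wk-ren : ∀ {ρ P} M → wk P ≡ ren (ext ρ) M → Σ Tm λ M₀ → M ≡ wk M₀ × P ≡ ren ρ M₀
wk-ren {ρ} {P} M eq = downAt 0 M , sym M≡
  , wk-injective (trans eq (trans (cong (ren (ext ρ)) (sym M≡)) (ren-wk ρ (downAt 0 M))))
  where
  M≡ : wk (downAt 0 M) ≡ M
  M≡ = wk-down M (notFree-ren {0} {0} (λ { zero _ → refl ; (suc i) () }) M
         (subst (NotFree 0) eq (ren-notFree (λ i ()) P)))

-- Applied to `wk`: reducing the function part of an η-redex leaves it a weakened term, so the
-- η-step remains possible.
par-ren⁻ : ∀ M {Δ Δ' ρ X} → LookupRen Δ Δ' ρ → Par Δ' (ren ρ M) X →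
           Σ Tm λ M' → X ≡ ren ρ M' × Par Δ M M'
par-ren⁻ M h p = go M h p refl
  where
  go : ∀ M {Δ Δ' ρ Y X} → LookupRen Δ Δ' ρ → Par Δ' Y X → Y ≡ ren ρ M →
       Σ Tm λ M' → X ≡ ren ρ M' × Par Δ M M'
  go (fv x L) h pfv refl = fv x L , refl , pfv
  go (bv i) h pbv refl = bv i , refl , pbv
  go (app M N) h (papp p q) refl with go M h p refl | go N h q refl
  ... | M' , refl , p' | N' , refl , q' = app M' N' , refl , papp p' q'
  go (app (lam L M) N) {ρ = ρ} h (pβ eq p q refl) refl with go M (ext-lookup h) p refl | go N h q refl
  ... | M' , refl , p' | N' , refl , q' =
    M' [0≔ N' ] , sym (ren-[0≔] ρ M' N') , pβ (trans (sym (deg-ren h N)) eq) p' q' refl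
  go (lam L M) h (plam p) refl with go M (ext-lookup h) p refl
  ... | M' , refl , p' = lam L M' , refl , plam p'
  go (lam L B) {ρ = ρ} h (pη refl p) eq with app-ren B (lam-injective eq)
    where
    lam-injective : ∀ {L K M N} → lam L M ≡ lam K N → M ≡ N
    lam-injective refl = refl
  ... | B₁ , refl , eq₁ with wk-ren B₁ eq₁
  ... | M₀ , refl , eq₂ with go M₀ h p eq₂
  ... | M' , eq₃ , p' = M' , eq₃ , pη refl p'

lam-wk : ∀ {L P} M → lam L P ≡ wk M → Σ Tm λ P₀ → M ≡ lam L P₀ × P ≡ ren (ext suc) P₀
lam-wk (lam L P₀) refl = P₀ , refl , refl

-- The overlap λx.(λy.P)x of a β-redex with an η-redex is trivial: both
-- contractions give λy.P.
diamond : ∀ n {Δ M A B} → size M ≤ n → Par Δ M A → Par Δ M B → Σ Tm λ C → Par Δ A C × Par Δ B C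
diamond-β : ∀ n {Δ L M M₂ N N₁ N₂ X} → size (app (lam L M) N) ≤ n → deg Δ N ≡ L →
            Par Δ (lam L M) X → Par Δ N N₁ → Par (L ∷ Δ) M M₂ → Par Δ N N₂ →
            Σ Tm λ C → Par Δ (app X N₁) C × Par Δ (M₂ [0≔ N₂ ]) C
diamond-η : ∀ n {Δ L M M' Q X} → Q ≡ wk M → size (lam L (app Q (bv 0))) ≤ n →
            Par (L ∷ Δ) (app Q (bv 0)) X → Par Δ M M' →
            Σ Tm λ C → Par Δ (lam L X) C × Par Δ M' C

size-left : ∀ {M N n} → size M + size N ≤ n → size M ≤ n
size-left {M} {N} = ℕP.≤-trans (ℕP.m≤m+n (size M) (size N))

size-right : ∀ {M N n} → size M + size N ≤ n → size N ≤ n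
size-right {M} {N} = ℕP.≤-trans (ℕP.m≤n+m (size N) (size M))

size-η : ∀ M {n} → suc (size (wk M) + 1) ≤ n → size M ≤ n
size-η M le = ℕP.≤-trans (ℕP.≤-reflexive (sym (size-ren suc M)))
  (ℕP.≤-trans (ℕP.m≤m+n (size (wk M)) 1) (ℕP.≤-trans (ℕP.n≤1+n _) le))

swap-join : ∀ {Δ A B} → (Σ Tm λ C → Par Δ A C × Par Δ B C) → Σ Tm λ C → Par Δ B C × Par Δ A C
swap-join (C , p , q) = C , q , p

diamond n le pfv pfv = _ , pfv , pfv
diamond n le pbv pbv = _ , pbv , pbv
diamond (suc n) (s≤s le) (papp {M = M} {N = N} p q) (papp p' q')
  with diamond n (size-left {M} {N} le) p p' | diamond n (size-right {M} {N} le) q q'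
... | P , a , b | Q , a' , b' = app P Q , papp a a' , papp b b'
diamond n le (papp p q) (pβ eq p' q' refl) = diamond-β n le eq p q p' q'
diamond n le (pβ eq p q refl) (papp p' q') = swap-join (diamond-β n le eq p' q' p q)
diamond (suc n) (s≤s le) (pβ {M = M} {N = N} eq p q refl) (pβ _ p' q' refl)
  with diamond n (ℕP.≤-trans (ℕP.n≤1+n (size M)) (size-left {lam [] M} {N} le)) p p'
     | diamond n (size-right {lam [] M} {N} le) q q'
... | P , a , b | Q , a' , b' = P [0≔ Q ]
  , par-[0≔] (trans (par-deg q) eq) a a' , par-[0≔] (trans (par-deg q') eq) b b'
diamond (suc n) (s≤s le) (plam p) (plam p') with diamond n le p p'
... | P , a , b = lam _ P , plam a , plam b
diamond n le (plam p) (pη eq p') = diamond-η n eq le p p'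
diamond n le (pη eq p) (plam p') = swap-join (diamond-η n eq le p' p)
diamond (suc n) (s≤s le) (pη {M = M} eq p) (pη eq' p')
  with refl ← wk-injective (trans (sym eq) eq') with refl ← eq =
  diamond n (size-η M le) p p'

diamond-β (suc n) {M = M} {N = N} (s≤s le) eq (plam p) q p' q'
  with diamond n (ℕP.≤-trans (ℕP.n≤1+n (size M)) (size-left {lam [] M} {N} le)) p p'
     | diamond n (size-right {lam [] M} {N} le) q q'
... | P , a , b | Q , a' , b' = P [0≔ Q ]
  , pβ (trans (par-deg q) eq) a a' refl , par-[0≔] (trans (par-deg q') eq) b b'
-- The term is `(λx.Px)N`. Contracting by η or by β yields an application of a reduct of `P` to a
-- reduct of `N` either way.
diamond-β (suc n) {N = N} {N₁} {N₂} (s≤s le) eq (pη {M = P} eqP p) q (papp r pbv) q'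
  with refl ← eqP with par-ren⁻ P (λ _ → refl) r
... | P₂ , refl , r'
  with diamond n (size-η P (ℕP.≤-trans (ℕP.n≤1+n _) (size-left {lam [] (app (wk P) (bv 0))} {N} le))) p r'
     | diamond n (size-right {lam [] (app (wk P) (bv 0))} {N} le) q q'
... | C , a , b | D , a' , b' = app C D , papp a a'
  , subst (λ Z → Par _ (app Z _) (app C D)) (sym (wk-[0≔] P₂ N₂))
      (papp b (subst (λ Z → Par _ Z D) (sym ([0≔]-inst (bv 0) N₂)) b'))
-- The term is `(λx.(λy.P₀)x)N`. One side erases the outer λ by η; the other contracts the inner
-- redex, which also restores the body of `λy.P₀`, and then the outer one. What remains is the same
-- problem for the smaller redex `(λy.P₀)N`.
diamond-β (suc n) {Δ} {N = N} {N₁} {N₂} (s≤s le) refl (pη {M = P} eqP p) q (pβ refl r pbv refl) q'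
  with lam-wk P eqP
... | P₀ , refl , refl with par-ren⁻ P₀ {deg Δ N ∷ Δ} (ext-lookup (λ _ → refl)) r
... | P₂ , refl , r' =
  subst (λ Z → Σ Tm λ C → Par _ (app _ N₁) C × Par _ (Z [0≔ N₂ ]) C) (sym (ext-wk-[0≔] P₂))
    (diamond-β n (ℕP.≤-trans small le) refl p q r' q')
  where
  small : size (app (lam [] P₀) N) ≤ size (lam [] (app (wk (lam [] P₀)) (bv 0))) + size N
  small = s≤s (s≤s (ℕP.+-monoˡ-≤ (size N) (ℕP.≤-trans (ℕP.≤-reflexive (sym (size-ren (ext suc) P₀)))
            (ℕP.≤-trans (ℕP.m≤m+n _ 1) (ℕP.n≤1+n _)))))

diamond-η (suc n) {M = M} eqM (s≤s le) (papp r pbv) p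
  with refl ← eqM with par-ren⁻ M (λ _ → refl) r
... | M₁ , refl , r'
  with diamond n (size-η M le) r' p
... | C , a , b = C , pη refl a , b
diamond-η (suc n) {Δ} {L} {M} eqM (s≤s le) (pβ refl r pbv refl) p with lam-wk M eqM
... | P₀ , refl , refl with par-ren⁻ P₀ {L ∷ Δ} (ext-lookup (λ _ → refl)) r
... | P₂ , refl , r' =
  subst (λ Z → Σ Tm λ C → Par _ (lam _ Z) C × Par _ _ C) (sym (ext-wk-[0≔] P₂))
    (diamond n (size-η (lam [] P₀) le) (plam r') p)

Par* : List Index → Tm → Tm → Set
Par* Δ = Star (Par Δ)

par-strip : ∀ {Δ M A B} → Par Δ M A → Par* Δ M B → Σ Tm λ C → Par* Δ A C × Par Δ B C
par-strip p done = _ , done , p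
par-strip {M = M} p (q ◅ qs) with diamond (size M) ℕP.≤-refl p q
... | _ , p' , q' with par-strip q' qs
... | C , ps , r = C , p' ◅ ps , r

par-confluent : ∀ {Δ M A B} → Par* Δ M A → Par* Δ M B → Σ Tm λ C → Par* Δ A C × Par* Δ B C
par-confluent done qs = _ , qs , done
par-confluent (p ◅ ps) qs with par-strip p qs
... | _ , qs' , p' with par-confluent ps qs'
... | C , a , b = C , a , p' ◅ b

par*-inst : ∀ {Δ Δ' σ M N} → DegSub Δ Δ' σ → Par* Δ M N → Par* Δ' (inst σ M) (inst σ N)
par*-inst {σ = σ} dg = gmap (inst σ) (par-inst dg (λ n → par-refl (σ n)))

βη : List Index → Tm → Tm → Set
βη Δ M N = Compat βroot Δ M N ⊎ Compat ηroot Δ M N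

par-compat : ∀ {R} → (∀ {Δ M N} → R Δ M N → Par Δ M N) → ∀ {Δ M N} → Compat R Δ M N → Par Δ M N
par-compat h (root r)         = h r
par-compat h (appL {N = N} s) = papp (par-compat h s) (par-refl N)
par-compat h (appR {M} s)     = papp (par-refl M) (par-compat h s)
par-compat h (lamC s)         = plam (par-compat h s)

βη-par : ∀ {Δ M N} → βη Δ M N → Par Δ M N
βη-par (inj₁ s) = par-compat (λ { (β {M = M} {N} eq) → pβ eq (par-refl M) (par-refl N) refl }) s
βη-par (inj₂ s) = par-compat (λ { (η {M = M} nf) → pη (sym (wk-down M nf)) (par-refl _) }) s

βη-lam : ∀ {Δ L M N} → Star (βη (L ∷ Δ)) M N → Star (βη Δ) (lam L M) (lam L N)
βη-lam = gmap (lam _) [ inj₁ ∘ lamC , inj₂ ∘ lamC ]′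

βη-app : ∀ {Δ M M' N N'} → Star (βη Δ) M M' → Star (βη Δ) N N' → Star (βη Δ) (app M N) (app M' N')
βη-app {M' = M'} {N} p q = gmap (λ P → app P N) [ inj₁ ∘ appL , inj₂ ∘ appL ]′ p
                        ◅◅ gmap (app M') [ inj₁ ∘ appR , inj₂ ∘ appR ]′ q

par-βη : ∀ {Δ M N} → Par Δ M N → Star (βη Δ) M N
par-βη pfv        = done
par-βη pbv        = done
par-βη (papp p q) = βη-app (par-βη p) (par-βη q)
par-βη (plam p)   = βη-lam (par-βη p)
par-βη (pβ eq p q refl) =
  βη-app (βη-lam (par-βη p)) (par-βη q) ◅◅ (inj₁ (root (β (trans (par-deg q) eq))) ◅ done)
par-βη (pη {M = M} refl p) =
  inj₂ (root (subst (ηroot _ _) (down-wk M) (η (ren-notFree (λ i ()) M)))) ◅ par-βη p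

steps : ∀ {M N} → Term M → Star (βη []) M N → M ▷*[ βηk ] N
steps w done = done
steps w (s ◅ ss) with raw-preserves βηk s w
... | w' , _ = (w , w' , s) ◅ steps w' ss

par*-steps : ∀ {M N} → Term M → Par* [] M N → M ▷*[ βηk ] N
par*-steps w done = done
par*-steps w (p ◅ ps) = let ss = steps w (par-βη p) in ss ◅◅ par*-steps (star-term w ss) ps

steps-par* : ∀ {M N} → M ▷*[ βηk ] N → Par* [] M N
steps-par* = gmap id (λ { (_ , _ , s) → βη-par s })

confluent : ∀ {M A B} → Term M → M ▷*[ βηk ] A → M ▷*[ βηk ] B →
            Σ Tm λ C → A ▷*[ βηk ] C × B ▷*[ βηk ] C
confluent w p q with par-confluent (steps-par* p) (steps-par* q)
... | C , a , b = C , par*-steps (star-term w p) a , par*-steps (star-term w q) b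

-- Realisability

spine-deg : ∀ {x L M} → Spine x L M → d M ≡ L
spine-deg hd     = refl
spine-deg (ap s) = spine-deg s

spine-mapI : ∀ φ {x L M} → Spine x L M → Spine x (φ L) (mapI φ M)
spine-mapI φ hd     = hd
spine-mapI φ (ap s) = ap (spine-mapI φ s)

app-term : ∀ {M N} → 𝓜^ [] M → Term N → M ◇ N → Term (app M N)
app-term {N = N} (w , eq) v j = wf-app w v (d N , cong (_++ d N) (sym eq)) j

raw-appL : ∀ r {M N P} → Raw r M N → Raw r (app M P) (app N P)
raw-appL βk  s        = appL s
raw-appL βηk (inj₁ s) = inj₁ (appL s)
raw-appL βηk (inj₂ s) = inj₂ (appL s)
raw-appL hk  s        = happ s

star-appL : ∀ {r M N P} → Term (app M P) → M ▷*[ r ] N → app M P ▷*[ r ] app N P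
star-appL w done = done
star-appL {r} w ((_ , _ , s) ◅ ss) with raw-preserves r (raw-appL r s) w
... | w' , _ = (w , w' , raw-appL r s) ◅ star-appL w' ss

star-𝓜⁻ : ∀ {r L M N} → M ▷*[ r ] N → 𝓜^ L N → 𝓜^ L M
star-𝓜⁻ done m = m
star-𝓜⁻ ss@((w , _) ◅ _) (_ , eq) = w , trans (sym (proj₁ (star-preserves ss))) eq

raw-β : ∀ r {L M N} → d N ≡ L → Raw r (app (lam L M) N) (M [0≔ N ])
raw-β βk  eq = root (β eq)
raw-β βηk eq = inj₁ (root (β eq))
raw-β hk  eq = hβ eq

module Semantics {r : Kind} (ℐ : Interp r) where
  open Interp ℐ

  mutual
    neutral-T : ∀ T {n M} → 𝒩 [] (v₁ n) M → ⟦ T ⟧T ℐ M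
    neutral-T (atom a) {n} {M} m = I-neut a n M m
    neutral-T (U ⇒ T) (w , s) = w , λ N N∈U j →
      neutral-T T (app-term (w , spine-deg s) (proj₁ (degree-U U N∈U)) j , ap s)

    neutral-U : ∀ {L} (U : 𝕌 L) {n M} → 𝒩 L (v₁ n) M → ⟦ U ⟧ ℐ M
    neutral-U (ty T)  m       = neutral-T T m
    neutral-U (ω L)   (w , s) = w , spine-deg s
    neutral-U (U ⊓ V) m       = neutral-U U m , neutral-U V m
    neutral-U (ē i U) {M = M} (w , s) = unlift (i ∷ []) M
      , neutral-U U (WF-mapI (drop-mono 1) w , spine-mapI (drop 1) s)
      , lift-unlift (w , spine-deg s)

    -- `_⇝_` does not mention degrees. They are recovered by applying `M` to a fresh variable of 𝒱₁,
    -- which is neutral and so lies in `⟦ U ⟧`: the application has the degree of `M`. Neutral terms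
    -- in turn need degrees in order to be applied, hence the mutual recursion.
    degree-T : ∀ T {M} → ⟦ T ⟧T ℐ M → 𝓜^ [] M
    degree-T (atom a) {M} m = I-deg a M m
    degree-T (_⇒_ {L} U T) {M} (w , h) = w , proj₂ (degree-T T
      (h (fv (v₁ (nameBound M)) L) (neutral-U U (wf-fv _ _ , hd))
         (λ { x K _ p (here refl) → ⊥-elim (fresh-var M ℕP.≤-refl p) })))

    degree-U : ∀ {L} (U : 𝕌 L) {M} → ⟦ U ⟧ ℐ M → 𝓜^ L M
    degree-U (ty T)  m              = degree-T T m
    degree-U (ω L)   m              = m
    degree-U (U ⊓ V) (m , _)        = degree-U U m
    degree-U (ē i U) (N , m , refl) = lift-𝓜 (degree-U U m)

  saturated-T : ∀ T → Saturated r (⟦ T ⟧T ℐ)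
  saturated-T (atom a) = I-sat a
  saturated-T (U ⇒ T) M N ss m@(w , h) = proj₁ mM , λ P P∈U j →
      saturated-T T (app M P) (app N P)
        (star-appL (app-term mM (proj₁ (degree-U U P∈U)) j) ss)
        (h P P∈U (λ x L K p q → j x L K (proj₂ (star-preserves ss) p) q))
    where
    mM : 𝓜^ [] M
    mM = star-𝓜⁻ ss (degree-T (U ⇒ T) m)

  saturated-U : ∀ {L} (U : 𝕌 L) → Saturated r (⟦ U ⟧ ℐ)
  saturated-U (ty T)  M N ss m       = saturated-T T M N ss m
  saturated-U (ω L)   M N ss m       = star-𝓜⁻ ss m
  saturated-U (U ⊓ V) M N ss (m , m') = saturated-U U M N ss m , saturated-U V M N ss m'
  saturated-U (ē i U) M N ss (N' , m , refl) = unlift (i ∷ []) M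
    , saturated-U U (unlift (i ∷ []) M) N'
        (subst (unlift (i ∷ []) M ▷*[ r ]_) (unlift-lift i N') (star-mapI (drop-mono 1) ss)) m
    , lift-unlift (star-𝓜⁻ ss (lift-𝓜 {i} (degree-U U m)))

  -- For M of degree L this is membership in ⟦ ē_L T ⟧.
  At : Index → Tm → 𝕋 → Set
  At L M T = ⟦ T ⟧T ℐ (unlift L M)

  at-lift* : ∀ L K M → unlift (L ++ K) (lift* L M) ≡ unlift K M
  at-lift* L K M = trans (unlift-++ L K (lift* L M)) (cong (unlift K) (unlift-lift* L M))

  at-lift : ∀ i L M → unlift (i ∷ L) (lift i M) ≡ unlift L M
  at-lift i L M = trans (cong (unlift (i ∷ L)) (lift-mapI i M)) (at-lift* (i ∷ []) L M)

  ⟦⟧⇒At : ∀ {L} (U : 𝕌 L) {M} → ⟦ U ⟧ ℐ M → All (At L M) (conj U)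
  ⟦⟧⇒At (ty T)  {M} m     = subst (⟦ T ⟧T ℐ) (sym (mapI-id M)) m ∷ []
  ⟦⟧⇒At (ω L)   m         = []
  ⟦⟧⇒At (U ⊓ V) (m , m')  = AllP.++⁺ (⟦⟧⇒At U m) (⟦⟧⇒At V m')
  ⟦⟧⇒At {i ∷ L} (ē i U) (N , m , refl) =
    All.map (λ {T} → subst (⟦ T ⟧T ℐ) (sym (at-lift i L N))) (⟦⟧⇒At U m)

  At⇒⟦⟧ : ∀ {L} (U : 𝕌 L) {M} → 𝓜^ L M → All (At L M) (conj U) → ⟦ U ⟧ ℐ M
  At⇒⟦⟧ (ty T)  {M} m (p ∷ []) = subst (⟦ T ⟧T ℐ) (mapI-id M) p
  At⇒⟦⟧ (ω L)   m ps = m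
  At⇒⟦⟧ (U ⊓ V) m ps = At⇒⟦⟧ U m (AllP.++⁻ˡ (conj U) ps) , At⇒⟦⟧ V m (AllP.++⁻ʳ (conj U) ps)
  At⇒⟦⟧ {i ∷ L} (ē i U) {M} m ps = unlift (i ∷ []) M
    , At⇒⟦⟧ U (unlift-𝓜 {i ∷ []} m) (All.map (λ {T} → subst (⟦ T ⟧T ℐ) (unlift-++ (i ∷ []) L M)) ps)
    , lift-unlift m

  mutual
    ≤T-⟦⟧ : ∀ {S T} → S ≤T T → ∀ {M} → ⟦ S ⟧T ℐ M → ⟦ T ⟧T ℐ M
    ≤T-⟦⟧ atom≤ m = m
    ≤T-⟦⟧ (⇒≤ {U = U} {V} p q) (w , h) = w , λ N N∈V j →
      ≤T-⟦⟧ q (h N (At⇒⟦⟧ U (degree-U V N∈V) (≤L-⟦⟧ p (⟦⟧⇒At V N∈V))) j)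

    ≤L-⟦⟧ : ∀ {M Ss Ts} → Ss ≤L Ts → All (λ S → ⟦ S ⟧T ℐ M) Ss → All (λ T → ⟦ T ⟧T ℐ M) Ts
    ≤L-⟦⟧ []       ms = []
    ≤L-⟦⟧ (p ∷ ps) ms = Any-⟦⟧ p ms ∷ ≤L-⟦⟧ ps ms

    Any-⟦⟧ : ∀ {M Ss T} → Any (_≤T T) Ss → All (λ S → ⟦ S ⟧T ℐ M) Ss → ⟦ T ⟧T ℐ M
    Any-⟦⟧ (here p)  (m ∷ _)  = ≤T-⟦⟧ p m
    Any-⟦⟧ (there p) (_ ∷ ms) = Any-⟦⟧ p ms

  -- A general `L` is needed because arguments sit at degree `L ++ K`. In the λ case an argument `N`
  -- of degree `K` is lifted to `L ++ K`, the β-step is performed there, and its unlifting together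
  -- with saturation gives the claim.
  adequacy : ∀ M {Δ θ L T σ} → Typ Δ θ L M T → DegSub Δ [] σ →
             (∀ n → All (At (degN Δ n) (σ n)) (θ n)) → Term (inst σ M) → At L (inst σ M) T
  adequacy (fv x K) (refl , p) dg h w = Any-⟦⟧ p (h (fn x K))
  adequacy (bv i)   (refl , p) dg h w = Any-⟦⟧ p (h (bn i))
  adequacy (app M N) {L = L} {σ = σ} (K , U , p , eq , ps) dg h (wf-app wM wN _ j) =
    proj₂ (adequacy M p dg h wM) (unlift L (inst σ N))
      (At⇒⟦⟧ U (unlift-𝓜 {L} (wN , trans (deg-inst dg N) eq))
        (All.map (λ {T} q → subst (⟦ T ⟧T ℐ) (unlift-++ L K (inst σ N)) (adequacy N q dg h wN)) ps))
      (◇-mapI _ (inst σ M) (inst σ N) j)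
  adequacy (lam J M) {Δ} {θ} {L} {_⇒_ {K} U T} {σ} (refl , p) dg h w =
    WF-mapI (drop-mono (length L)) w , λ N N∈U j → β-expand N N∈U j
    where
    X : Tm
    X = lam J (inst (exts σ) M)
    degX : d X ≡ L
    degX = trans (deg-inst (exts-deg dg) M) (Typ-deg M p)
    β-expand : ∀ N → ⟦ U ⟧ ℐ N → unlift L X ◇ N → ⟦ T ⟧T ℐ (app (unlift L X) N)
    β-expand N N∈U j =
      saturated-T T _ _ (subst (λ Z → app (unlift L X) Z ▷*[ r ] unlift L (inst (N⁺ • σ) M))
                               (unlift-lift* L N) (star-mapI (drop-mono (length L)) step))
        (adequacy M p (•-deg (proj₂ mN) dg) env wB)
      where
      N⁺ : Tm
      N⁺ = lift* L N
      mN : 𝓜^ (L ++ K) N⁺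
      mN = lift*-𝓜 {L} (degree-U U N∈U)
      joinable : X ◇ N⁺
      -- Every free index of `X` begins with its degree `L`, so equality of the unlifted indexes,
      -- given by `j`, implies equality of the original ones.
      joinable x A B a b with deg-⪯-fvs w a | ∈-mapI⁻ (L ++_) N b
      ... | A' , eqA | B' , refl , b' = trans eqA' (cong (L ++_) A'≡B')
        where
        eqA' : A ≡ L ++ A'
        eqA' = trans eqA (cong (_++ A') degX)
        A'≡B' : A' ≡ B'
        A'≡B' = trans (sym (trans (cong (drop (length L)) eqA') (drop-++ L A')))
                      (j x _ B' (∈-mapI⁺ (drop (length L)) X a) b')
      wA : Term (app X N⁺)
      wA = wf-app w (proj₁ mN) (K , trans (proj₂ mN) (cong (_++ K) (sym degX))) joinable
      wB₀ : Term (inst (exts σ) M [0≔ N⁺ ])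
      wB₀ = proj₁ (WF-[0≔] wA (proj₂ mN))
      wB : Term (inst (N⁺ • σ) M)
      wB = subst Term (exts-[0≔] σ M N⁺) wB₀
      step : app X N⁺ ▷*[ r ] inst (N⁺ • σ) M
      step = subst (app X N⁺ ▷*[ r ]_) (exts-[0≔] σ M N⁺) ((wA , wB₀ , raw-β r (proj₂ mN)) ◅ done)
      env : ∀ n → All (At (degN (J ∷ Δ) n) ((N⁺ • σ) n)) ((θ ,, conj U) n)
      env (bn zero)    = All.map (λ {T} → subst (⟦ T ⟧T ℐ) (sym (at-lift* L K N))) (⟦⟧⇒At U N∈U)
      env (bn (suc i)) = h (bn i)
      env (fn x A)     = h (fn x A)

  soundness : ∀ {L M} {U : 𝕌 L} → M ∶⟨ ∅ ⊢ U ⟩ → ⟦ U ⟧ ℐ M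
  soundness {L} {M} {U} p = At⇒⟦⟧ U (typed-𝓜 p)
    (All.map (λ {T} q → subst (λ N → At L N T) (inst-var M)
       (adequacy M q (λ n → refl) (λ { (bn i) → [] ; (fn x K) → [] })
         (subst Term (sym (inst-var M)) (proj₁ (typed-𝓜 p)))))
      (typed-Typ p))

-- Completeness

-- The domains of all arrows inside a type, at any depth: exactly the lists for which a test
-- variable will be requested. They are finitely many, so no enumeration of all types is required.
domains : ∀ {L} → 𝕌 L → List (List 𝕋)
domainsT : 𝕋 → List (List 𝕋)
domains (ty T)  = domainsT T
domains (ω L)   = []
domains (U ⊓ V) = domains U ++ domains V
domains (ē i U) = domains U
domainsT (atom a) = []
domainsT (U ⇒ T)  = conj U ∷ domains U ++ domainsT T

NoV₁ : Tm → Set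
NoV₁ M = ∀ n K → ¬ (v₁ n , K) ∈ fvs M

-- h n is the type, up to its degree prefix, given to the variables named
-- v₂ n; Has L M T is a notion of "M has type ē_L T".
record Typability (r : Kind) (h : ℕ → List 𝕋) : Set₁ where
  field
    Has        : Index → Tm → 𝕋 → Set
    has-var    : ∀ n L {T} → T ∈ h n → Has L (fv (v₂ n) L) T
    has-app    : ∀ {M N K T} {U : 𝕌 K} → Term (app M N) → d N ≡ K → Has [] M (U ⇒ T) →
                 All (Has K N) (conj U) → Has [] (app M N) T
    has-abs    : ∀ {n M K T} {U : 𝕌 K} → 𝓜^ [] M → (∀ J → ¬ (v₂ n , J) ∈ fvs M) → h n ≡ conj U →
                 Has [] (app M (fv (v₂ n) K)) T → Has [] M (U ⇒ T)
    has-lift   : ∀ {i L M T} → 𝓜^ L M → Has L M T → Has (i ∷ L) (lift i M) T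
    has-unlift : ∀ {i L M T} → 𝓜^ L M → Has (i ∷ L) (lift i M) T → Has L M T
    has-expand : ∀ {M N T} → Step r M N → Has [] N T → Has [] M T

module Canonical {r h Ds} (τ : Typability r h)
  (often : ∀ {Ts} → Ts ∈ Ds → ∀ b → Σ ℕ λ n → b ≤ n × h n ≡ Ts) where
  open Typability τ

  -- The implication encodes the union with the set of terms that have a free
  -- variable in 𝒱₁.
  canonical : Interp r
  canonical = record
    { I      = λ a M → 𝓜^ [] M × (NoV₁ M → Has [] M (atom a))
    ; I-deg  = λ a M → proj₁
    ; I-sat  = λ a M N ss (m , p) → star-𝓜⁻ ss m ,
                 λ nv → expand ss (p (λ n K q → nv n K (proj₂ (star-preserves ss) q)))
    ; I-neut = λ a n M (w , s) → (w , spine-deg s) , λ nv → ⊥-elim (nv n [] (head-free s))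
    }
    where
    expand : ∀ {M N T} → M ▷*[ r ] N → Has [] N T → Has [] M T
    expand done p = p
    expand (s ◅ ss) p = has-expand s (expand ss p)
    head-free : ∀ {x L M} → Spine x L M → (x , L) ∈ fvs M
    head-free hd     = here refl
    head-free (ap s) = MP.∈-++⁺ˡ (head-free s)

  open Semantics canonical using (degree-T; degree-U)

  mutual
    -- At an arrow the two directions call each other: the test variable enters `⟦ U ⟧` by
    -- `reify-U`, while an arbitrary argument from `⟦ U ⟧` receives its types by `reflect-U`.
    reflect-T : ∀ T → domainsT T ⊆ Ds → ∀ {M} → ⟦ T ⟧T canonical M → NoV₁ M → Has [] M T
    reflect-T (atom a) sb (_ , p) nv = p nv
    reflect-T (_⇒_ {L} U T) sb {M} m@(w , f) nv with often (sb (here refl)) (nameBound M)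
    ... | n , le , eq = has-abs (degree-T (U ⇒ T) m) (λ J → fresh-var M le) eq
      (reflect-T T (sb ∘ there ∘ MP.∈-++⁺ʳ (domains U))
        (f y (reify-U U (sb ∘ there ∘ MP.∈-++⁺ˡ) (wf-fv (v₂ n) L , refl)
               (λ _ → All.tabulate (λ {T'} p → has-var n L (subst (T' ∈_) (sym eq) p))))
             (λ { x K _ p (here refl) → ⊥-elim (fresh-var M le p) }))
        -- The test variable is taken from 𝒱₂, so the application still avoids 𝒱₁.
        (λ k K p → [ nv k K , (λ { (here ()) }) ]′ (MP.∈-++⁻ (fvs M) p)))
      where
      y : Tm
      y = fv (v₂ n) L

    reflect-U : ∀ {L} (U : 𝕌 L) → domains U ⊆ Ds → ∀ {M} → ⟦ U ⟧ canonical M → NoV₁ M →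
                All (Has L M) (conj U)
    reflect-U (ty T)  sb m        nv = reflect-T T sb m nv ∷ []
    reflect-U (ω L)   sb m        nv = []
    reflect-U (U ⊓ V) sb (m , m') nv =
      AllP.++⁺ (reflect-U U (sb ∘ MP.∈-++⁺ˡ) m nv) (reflect-U V (sb ∘ MP.∈-++⁺ʳ (domains U)) m' nv)
    reflect-U (ē i U) sb (N , m , refl) nv =
      All.map (has-lift (degree-U U m)) (reflect-U U sb m
        (λ n K p → nv n (i ∷ K) (subst (λ P → (v₁ n , i ∷ K) ∈ fvs P) (sym (lift-mapI i N)) (∈-mapI⁺ (i ∷_) N p))))

    reify-T : ∀ T → domainsT T ⊆ Ds → ∀ {M} → 𝓜^ [] M → (NoV₁ M → Has [] M T) → ⟦ T ⟧T canonical M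
    reify-T (atom a) sb m p = m , p
    reify-T (U ⇒ T) sb {M} m p = proj₁ m , λ N N∈U j →
      let (wN , degN) = degree-U U N∈U
          w           = app-term m wN j
      in reify-T T (sb ∘ there ∘ MP.∈-++⁺ʳ (domains U)) (w , proj₂ m) λ nv →
           has-app w degN (p (λ n K q → nv n K (MP.∈-++⁺ˡ q)))
             (reflect-U U (sb ∘ there ∘ MP.∈-++⁺ˡ) N∈U (λ n K q → nv n K (MP.∈-++⁺ʳ (fvs M) q)))

    reify-U : ∀ {L} (U : 𝕌 L) → domains U ⊆ Ds → ∀ {M} → 𝓜^ L M → (NoV₁ M → All (Has L M) (conj U)) →
              ⟦ U ⟧ canonical M
    reify-U (ty T)  sb m p = reify-T T sb m (All.head ∘ p)
    reify-U (ω L)   sb m p = m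
    reify-U (U ⊓ V) sb m p =
        reify-U U (sb ∘ MP.∈-++⁺ˡ) m (AllP.++⁻ˡ (conj U) ∘ p)
      , reify-U V (sb ∘ MP.∈-++⁺ʳ (domains U)) m (AllP.++⁻ʳ (conj U) ∘ p)
    reify-U {i ∷ L} (ē i U) sb {M} m p = M' , reify-U U sb m'
        (λ nv → All.map (has-unlift m' ∘ subst (λ P → Has (i ∷ L) P _) M≡)
          (p (λ n K q → nv n (drop 1 K) (∈-mapI⁺ (drop 1) M q)))) , M≡
      where
      M' : Tm
      M' = unlift (i ∷ []) M
      m' : 𝓜^ L M'
      m' = unlift-𝓜 {i ∷ []} m
      M≡ : M ≡ lift i M'
      M≡ = lift-unlift m

module Models (h : ℕ → List 𝕋) where
  -- The list of `v₂ n` does not depend on the index, which makes typability invariant under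
  -- lifting. Variables of 𝒱₁ get the empty list, as typability is only asked of terms without them.
  θ : TyEnv
  θ (bn i)        = []
  θ (fn (v₁ n) L) = []
  θ (fn (v₂ n) L) = h n

  θ-lifted : ∀ i → LiftedEnv i θ θ
  θ-lifted i = record { bnd≡ = λ k → refl ; free≡ = λ { (v₁ n) K → refl ; (v₂ n) K → refl } }

  HasTyp : Index → Tm → 𝕋 → Set
  HasTyp = Typ [] θ

  var-has : ∀ n L {T} → T ∈ h n → HasTyp L (fv (v₂ n) L) T
  var-has n L = All.lookup (Typ-var [] θ (fn (v₂ n) L))

  lift-has : ∀ {i L M T} → 𝓜^ L M → HasTyp L M T → HasTyp (i ∷ L) (lift i M) T
  lift-has {i} {L} {M} {T} (w , _) p =
    subst (λ N → HasTyp (i ∷ L) N T) (sym (lift-mapI i M)) (Typ-lift (θ-lifted i) w p)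

  unlift-has : ∀ {i L M T} → 𝓜^ L M → HasTyp (i ∷ L) (lift i M) T → HasTyp L M T
  unlift-has {i} {L} {M} {T} (w , _) p =
    Typ-lift⁻ (θ-lifted i) w (subst (λ N → HasTyp (i ∷ L) N T) (lift-mapI i M) p)

  β-expand : ∀ {L M N T} → Term M → Compat βroot [] M N → HasTyp L N T → HasTyp L M T
  β-expand = compat-expansion β-preserves β-expansion

  typability : ∀ r → (∀ {L M N T} → Step r M N → HasTyp L N T → HasTyp L M T) → Typability r h
  typability r expand = record
    { Has        = HasTyp
    ; has-var    = var-has
    ; has-app    = λ {_} {_} {K} {_} {U} _ eq p ps → K , U , p , eq , ps
    -- As in `η-reduction`: the types of the test variable are those of `U`, so the domain `V` found
    -- for `M` lies above `U`.
    ; has-abs    = λ {n} {M} {K} {T} {U} m fresh eq (K' , V , p , eq' , ps) →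
                     Typ-≤ M (λ n → ≤L-refl)
                       (⇒-≤-domain eq' (subst (_≤L conj V) eq (var-Typ [] θ (fn (v₂ n) K) ps))) p
    ; has-lift   = lift-has
    ; has-unlift = unlift-has
    ; has-expand = expand
    }

  typability-β : Typability βk h
  typability-β = typability βk (λ (w , _ , s) → β-expand w s)

  typability-h : Typability hk h
  typability-h = typability hk (λ (w , _ , s) → β-expand w (head-compat s))

  star-reduction : ∀ {θ L M N T} → M ▷*[ βηk ] N → Typ [] θ L M T → Typ [] θ L N T
  star-reduction done p = p
  star-reduction ((w , _ , inj₁ s) ◅ ss) p = star-reduction ss (compat-reduction β-preserves β-reduction w s p)
  star-reduction ((w , _ , inj₂ s) ◅ ss) p = star-reduction ss (compat-reduction η-preserves η-reduction w s p)

  HasReduct : Index → Tm → 𝕋 → Set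
  HasReduct L M T = Σ Tm λ N → M ▷*[ βηk ] N × HasTyp L N T

  -- Each conjunct may be witnessed by a different reduct; confluence joins them, and subject
  -- reduction for βη keeps all the types.
  common-reduct : ∀ {L M Ts} → Term M → All (HasReduct L M) Ts →
                  Σ Tm λ N → M ▷*[ βηk ] N × All (HasTyp L N) Ts
  common-reduct w [] = _ , done , []
  common-reduct w ((N , ss , p) ∷ ps) with common-reduct w ps
  ... | N' , ss' , ps' with confluent w ss ss'
  ... | C , cs , cs' = C , ss ◅◅ cs , star-reduction cs p ∷ All.map (star-reduction cs') ps'

  forget : ∀ {M N} → M ▷*[ βηk ] N → Star (βη []) M N
  forget = gmap id (λ (_ , _ , s) → s)

  -- λy.My reduces both to M and, when My reduces to N, to the typable term
  -- λy.N; confluence and subject reduction give a typable reduct of M.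
  abs-reduct : ∀ {n M K T} {U : 𝕌 K} → 𝓜^ [] M → (∀ J → ¬ (v₂ n , J) ∈ fvs M) → h n ≡ conj U →
               HasReduct [] (app M (fv (v₂ n) K)) T → HasReduct [] M (U ⇒ T)
  abs-reduct {n} {M} {K} {T} {U} (w , eq) fresh hn (N , ss , p) =
    let (C , cs , cs') = par-confluent (pη refl (par-refl M) ◅ done) expanded→λN
    in C , par*-steps w cs
     , star-reduction (par*-steps (star-term wE (par*-steps wE expanded→λN)) cs') (refl , body)
    where
    σ : Subst
    σ = close (v₂ n) K
    E : Tm
    E = lam K (app (wk M) (bv 0))
    wE : Term E
    wE = wf-lam (wf-app (WF-ren (λ i → refl) s≤s w) (wf-bv 0 (s≤s z≤n)) (K , K≡) (λ _ _ _ _ ())) (K , K≡)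
      where
      K≡ : K ≡ deg (K ∷ []) (wk M) ++ K
      K≡ = cong (_++ K) (sym (trans (deg-wk M) eq))
    M≡ : inst σ M ≡ wk M
    M≡ = trans (inst-cong-WF w (λ y J q → closing-other 0 {v₂ n} {K} {y} {J} (λ { refl → fresh J q })) (λ i ()))
               (ren-as-inst suc M)
    expanded→λN : Par* [] E (lam K (inst σ N))
    expanded→λN = gmap (lam K) plam
      (subst₂ (λ P Q → Par* (K ∷ []) (app P Q) (inst σ N)) M≡ (closing-same 0 (v₂ n) K)
        (par*-inst (close-deg (v₂ n) K) (steps-par* ss)))
    body : Typ (K ∷ []) (θ ,, conj U) [] (inst σ N) T
    body = Typ-inst N (close-deg (v₂ n) K) (close-typed (λ i → refl) hn (λ y J ne → refl)) p

  typability-βη : Typability βηk h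
  typability-βη = record
    { Has        = HasReduct
    ; has-var    = λ n L p → _ , done , var-has n L p
    ; has-app    = app-reduct
    ; has-abs    = abs-reduct
    ; has-lift   = λ { {i} m (N , ss , p) → lift i N
                     , subst₂ (_▷*[ βηk ]_) (sym (lift-mapI i _)) (sym (lift-mapI i N)) (star-mapI (cons-mono i) ss)
                     , lift-has {i} (star-𝓜 m ss) p }
    ; has-unlift = unlift-reduct
    ; has-expand = λ { s (N , ss , p) → N , s ◅ ss , p }
    }
    where
    star-𝓜 : ∀ {L M N} → 𝓜^ L M → M ▷*[ βηk ] N → 𝓜^ L N
    star-𝓜 (w , eq) ss = star-term w ss , trans (proj₁ (star-preserves ss)) eq
    app-reduct : ∀ {M N K T} {U : 𝕌 K} → Term (app M N) → d N ≡ K → HasReduct [] M (U ⇒ T) →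
                 All (HasReduct K N) (conj U) → HasReduct [] (app M N) T
    app-reduct {K = K} {U = U} w@(wf-app _ wN _ _) eq (M' , ss , p) ps with common-reduct wN ps
    ... | N' , ss' , ps' = app M' N' , steps w (βη-app (forget ss) (forget ss'))
                         , K , U , p , trans (proj₁ (star-preserves ss')) eq , ps'
    unlift-reduct : ∀ {i L M T} → 𝓜^ L M → HasReduct (i ∷ L) (lift i M) T → HasReduct L M T
    unlift-reduct {i} {L} {M} {T} m (N , ss , p) = unlift (i ∷ []) N
      , subst (_▷*[ βηk ] unlift (i ∷ []) N) (unlift-lift i M) (star-mapI (drop-mono 1) ss)
      , unlift-has {i} (unlift-𝓜 {i ∷ []} mN) (subst (λ P → HasTyp (i ∷ L) P T) (lift-unlift mN) p)
      where
      mN : 𝓜^ (i ∷ L) N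
      mN = star-𝓜 (lift-𝓜 {i} m) ss

-- The extra entry `a` keeps the period positive when the list is empty.
cycle : ∀ {A : Set} → A → List A → ℕ → A
cycle a as n = lookup (a ∷ as) (n mod suc (length as))

cycle-often : ∀ {A : Set} (a : A) as {x} → x ∈ as → ∀ b → Σ ℕ λ n → b ≤ n × cycle a as n ≡ x
-- `k` is the period, so adding `b * k` does not change the residue `j`, and `b ≤ b * k` because `k`
-- is positive.
cycle-often a as {x} p b = toℕ j + b * k
  , ℕP.≤-trans (ℕP.≤-trans (ℕP.≤-reflexive (sym (ℕP.*-identityʳ b))) (ℕP.*-monoʳ-≤ b (s≤s z≤n))) (ℕP.m≤n+m (b * k) (toℕ j))
  , trans (cong (lookup (a ∷ as)) (FinP.toℕ-injective mod≡)) (sym (AnyP.lookup-index (there {x = a} p)))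
  where
  k : ℕ
  k = suc (length as)
  j : Fin k
  j = Any.index (there {x = a} p)
  mod≡ : toℕ ((toℕ j + b * k) mod k) ≡ toℕ j
  mod≡ = trans (FinP.toℕ-fromℕ< _) (trans ([m+kn]%n≡m%n (toℕ j) b k) (m<n⇒m%n≡m (FinP.toℕ<n j)))

closed-NoV₁ : ∀ {M} → Closed M → NoV₁ M
closed-NoV₁ cl n K p = MP.∉[] (subst (_ ∈_) cl p)

closed-reduct : ∀ {r M N} → Closed M → M ▷*[ r ] N → Closed N
closed-reduct {N = N} cl ss with fvs N | proj₂ (star-preserves ss)
... | []    | _  = refl
... | _ ∷ _ | sb = ⊥-elim (MP.∉[] (subst (_ ∈_) cl (sb (here refl))))

-- Realisers of a fixed type

module _ {L} (U : 𝕌 L) where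
  variableTypes : ℕ → List 𝕋
  variableTypes = cycle [] (domains U)

  open Models variableTypes

  real-𝓜 : ∀ {r M} → Typability r variableTypes → Real r U M → 𝓜^ L M
  real-𝓜 τ (_ , _ , m) = degree-U U (m canonical)
    where
    open Canonical {Ds = domains U} τ (cycle-often [] (domains U))
    open Semantics canonical

  real-has : ∀ {r M} (τ : Typability r variableTypes) → Real r U M → All (Typability.Has τ L M) (conj U)
  real-has {M = M} τ (_ , cl , m) = reflect-U U id (m canonical) (closed-NoV₁ {M} cl)
    where
    open Canonical {Ds = domains U} τ (cycle-often [] (domains U))

  typable-real : ∀ {r M} → 𝓜^ L M × M ∶⟨ ∅ ⊢ U ⟩ → Real r U M
  typable-real ((w , _) , p) = w , typed-closed p , λ ℐ → Semantics.soundness ℐ p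

  real-typable-β : ∀ {M} → Real βk U M → 𝓜^ L M × M ∶⟨ ∅ ⊢ U ⟩
  real-typable-β R = m , Typ⇒typed U m (proj₁ (proj₂ R)) (real-has typability-β R)
    where
    m : 𝓜^ L _
    m = real-𝓜 typability-β R

  real-typable-h : ∀ {M} → Real hk U M → 𝓜^ L M × M ∶⟨ ∅ ⊢ U ⟩
  real-typable-h R = m , Typ⇒typed U m (proj₁ (proj₂ R)) (real-has typability-h R)
    where
    m : 𝓜^ L _
    m = real-𝓜 typability-h R

  ReductTypable : Tm → Set
  ReductTypable M = 𝓜^ L M × Closed M × Σ Tm (λ N → M ▷*[ βηk ] N × N ∶⟨ ∅ ⊢ U ⟩)

  real-reduct : ∀ {M} → Real βηk U M → ReductTypable M
  real-reduct R@(w , cl , _) with real-𝓜 typability-βη R | common-reduct w (real-has typability-βη R)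
  ... | m | N , ss , ps = m , cl , N , ss
    , Typ⇒typed U (star-term w ss , trans (proj₁ (star-preserves ss)) (proj₂ m)) (closed-reduct cl ss) ps

  reduct-real : ∀ {M} → ReductTypable M → Real βηk U M
  reduct-real ((w , _) , cl , N , ss , p) =
    w , cl , λ ℐ → Semantics.saturated-U ℐ U _ N ss (Semantics.soundness ℐ p)

  -- The given reduct and the typable reduct `P` of `M` have a common reduct `C`. It inherits the
  -- type of `P` by subject reduction, and so witnesses the characterisation for `N`.
  real-stable : ∀ {M N} → Real βηk U M → M ▷*[ βηk ] N → Real βηk U N
  real-stable R ss with real-reduct R
  ... | (w , eq) , cl , P , ss' , p with confluent w ss ss'
  ... | C , cs , cs' = reduct-real ((star-term w ss , trans (proj₁ (star-preserves ss)) eq)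
      , closed-reduct cl ss , C , cs
      , Typ⇒typed U (star-term w (ss' ◅◅ cs') , trans (proj₁ (star-preserves (ss' ◅◅ cs'))) eq)
          (closed-reduct cl (ss' ◅◅ cs')) (All.map (star-reduction cs') (typed-Typ p)))

theorem6 : ∀ {L} (U : 𝕌 L) →
    ((M : Tm) → Real βηk U M ⇔
    (𝓜^ L M × Closed M × Σ Tm (λ N → M ▷*[ βηk ] N × N ∶⟨ ∅ ⊢ U ⟩)))
    × ((M : Tm) → Real βk U M ⇔ (𝓜^ L M × M ∶⟨ ∅ ⊢ U ⟩))
    × ((M : Tm) → Real hk U M ⇔ (𝓜^ L M × M ∶⟨ ∅ ⊢ U ⟩))
    × ((M N : Tm) → Real βηk U M → M ▷*[ βηk ] N → Real βηk U N)
theorem6 U = (λ M → mk⇔ (real-reduct U) (reduct-real U))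
           , (λ M → mk⇔ (real-typable-β U) (typable-real U))
           , (λ M → mk⇔ (real-typable-h U) (typable-real U))
           , (λ M N → real-stable U)
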